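{- Let $n \ge 5000$ be an integer. Every $n$-vertex $F_5$-free $3$-graph $\mathcal{H}$ with $\delta(\mathcal{H}) > \frac{4n^2}{45}$ is $3$-partite.
   Context: A $3$-graph is a collection $\mathcal{H}$ of $3$-element subsets (edges) of a finite vertex set $V(\mathcal{H})$. The degree of a vertex $v$ is the number of edges containing $v$, and $\delta(\mathcal{H})$ is the minimum degree. $F_5$ is the $3$-graph on $\{a,b,c,d,e\}$ with edge set $\{abc, abd, cde\}$; $\mathcal{H}$ is $F_5$-free if it contains no subgraph isomorphic to $F_5$. $\mathcal{H}$ is $3$-partite if $V(\mathcal{H})$ can be partitioned into three sets such that every edge of $\mathcal{H}$ contains exactly one vertex from each set. -}

module Defs where

open import Data.Nat using (ℕ; _*_; _<_; _>_)
open import Data.Fin using (Fin; toℕ)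
open import Data.Fin.Properties using (_<?_; _≟_)
open import Data.Bool using (Bool; true; false; _∧_; _∨_)
open import Data.List using (List; length; filter; concatMap; allFin; [_]; [])
open import Data.Product using (_×_; _,_; Σ; ∃-syntax)
open import Data.Sum using (_⊎_)
open import Relation.Nullary using (¬_; does)
open import Relation.Nullary.Decidable using (⌊_⌋)
open import Relation.Binary.PropositionalEquality using (_≡_; _≢_)

-- A 3-graph on the vertex set Fin n.  Its edge set is
--   { {a,b,c} : toℕ a < toℕ b < toℕ c  and  edgeAt a b c ≡ true }.
-- Values of edgeAt on triples that are not strictly increasing are ignored,
-- so every 3-element subset of Fin n is represented exactly once.
record ThreeGraph (n : ℕ) : Set where
  field
    edgeAt : Fin n → Fin n → Fin n → Bool
open ThreeGraph public

Sorted : ∀ {n} → Fin n → Fin n → Fin n → Set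
Sorted a b c = (toℕ a < toℕ b) × (toℕ b < toℕ c)

Edge : ∀ {n} → ThreeGraph n → Fin n → Fin n → Fin n → Set
Edge H x y z =
  x ≢ y × x ≢ z × y ≢ z ×
  ∃[ a ] ∃[ b ] ∃[ c ] (Sorted a b c × edgeAt H a b c ≡ true ×
    (x ≡ a ⊎ x ≡ b ⊎ x ≡ c) × (y ≡ a ⊎ y ≡ b ⊎ y ≡ c) × (z ≡ a ⊎ z ≡ b ⊎ z ≡ c))

sortedTriples : (n : ℕ) → List (Fin n × Fin n × Fin n)
sortedTriples n =
  concatMap (λ a → concatMap (λ b → concatMap (λ c →
    if′ (⌊ toℕ a Data.Nat.<? toℕ b ⌋ ∧ ⌊ toℕ b Data.Nat.<? toℕ c ⌋) (c , a , b , c))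
    (allFin n)) (allFin n)) (allFin n)
  where
  if′ : Bool → (Fin n × Fin n × Fin n × Fin n) → List (Fin n × Fin n × Fin n)
  if′ true  (_ , a , b , c) = [ (a , b , c) ]
  if′ false _               = []

degree : ∀ {n} → ThreeGraph n → Fin n → ℕ
degree {n} H v = length (filter
  (λ { (a , b , c) → Data.Bool.T? (edgeAt H a b c ∧
         (⌊ v ≟ a ⌋ ∨ ⌊ v ≟ b ⌋ ∨ ⌊ v ≟ c ⌋)) })
  (sortedTriples n))

ContainsF5 : ∀ {n} → ThreeGraph n → Set
ContainsF5 {n} H =
  ∃[ a ] ∃[ b ] ∃[ c ] ∃[ d ] ∃[ e ]
    (a ≢ b × a ≢ c × a ≢ d × a ≢ e × b ≢ c × b ≢ d × b ≢ e ×
     c ≢ d × c ≢ e × d ≢ e ×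
     Edge H a b c × Edge H a b d × Edge H c d e)

F5Free : ∀ {n} → ThreeGraph n → Set
F5Free H = ¬ ContainsF5 H

ThreePartite : ∀ {n} → ThreeGraph n → Set
ThreePartite {n} H =
  Σ (Fin n → Fin 3) λ f → ∀ x y z → Edge H x y z →
    f x ≢ f y × f x ≢ f z × f y ≢ f z

{-# OPTIONS --safe #-}
module Submission where

-- Let G be the shadow graph of H.  If xyz is an edge then a pair common to the links of x and y
-- must contain z, so the links of the vertices of a clique of G are almost disjoint.  Hence G has
-- no K₆, and, by Turán's theorem, not too many edges.  Given a K₄ in G, the union of its four links
-- has more than n²/3 edges, so it contains another K₄; its edges are coloured by the four links,
-- and F₅-freeness makes the colouring proper unless some pairs have codegree at most 2 (few vertices
-- have many such pairs in their link).  A proper colouring has two monochromatic perfect matchings,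
-- which gives a K₆.  So G has no K₄.
--
-- It remains to show that a K₄-free graph in which every neighbourhood spans more than 4n²/45 edges
-- is 3-colourable.  The basic tool is to add up the numbers of edges in the neighbourhoods of a few
-- vertices w, noting that adjacent w never see a common edge.
-- (i) If N is triangle-free with more than 4n²/45 edges and the degrees outside N are on average at
-- most |N|, then N is bipartite: take an edge uv of N with large degree sum; a vertex of N joined to
-- both N(u) and N(v) closes a 5-cycle, and two counts around it contradict each other.
-- (ii) By (i) the neighbourhood of a vertex of maximum degree is bipartite; extend its classes to
-- disjoint independent sets X, Y that cannot be enlarged, and let S be the rest.  If X or Y meets
-- every triangle, (i) applies to its complement.  Otherwise there is a triangle inside S, or a
-- triangle XSS together with a triangle YSS, and then so many pairs between S and X ∪ Y are missing
-- that the degree condition fails.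

open import Defs
open import Data.Bool using (Bool; true; false; _∧_; _∨_; not)
open import Data.Bool.Properties using (∧-comm; ∨-zeroʳ) renaming (_≟_ to _≟ᵇ_)
open import Data.Empty using (⊥; ⊥-elim)
open import Data.Fin using (Fin; zero; suc; toℕ)
open import Data.Fin.Properties using (any?; pigeonhole; toℕ-injective) renaming (_≟_ to _≟ᶠ_)
open import Data.List using (List; []; _∷_; length; map; concatMap; filter; allFin; tabulate; lookup)
open import Data.List.Membership.Propositional using (_∈_)
open import Data.List.Membership.Propositional.Properties using (∈-allFin; ∈-lookup)
open import Data.List.Properties using (length-++; filter-++)
open import Data.List.Relation.Unary.All as All using (All; []; _∷_)
open import Data.List.Relation.Unary.AllPairs using (AllPairs; []; _∷_)
open import Data.List.Relation.Unary.Any using (here; there)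
open import Data.Nat using (ℕ; zero; suc; _+_; _*_; _∸_; _≤_; _<_; _≤?_; _<?_; z≤n; s≤s; >-nonZero)
open import Data.Nat.ListAction using () renaming (sum to sumˡ)
open import Data.Nat.Properties
open import Data.Nat.Tactic.RingSolver using (solve-∀)
open import Data.Product using (_×_; _,_; Σ; ∃; ∃-syntax; proj₁; proj₂)
open import Data.Sum using (_⊎_; inj₁; inj₂)
open import Data.Unit using (⊤; tt)
open import Function using (_∘_; case_of_; flip; id)
open import Relation.Binary.Definitions using (Tri; tri<; tri≈; tri>)
open import Relation.Binary.PropositionalEquality using (_≡_; _≢_; refl; sym; trans; cong; cong₂; subst; subst₂; ≢-sym)
open import Relation.Nullary using (¬_; Dec; yes; no; does; contradiction)
open import Relation.Nullary.Decidable using (⌊_⌋; decidable-stable; _×-dec_; _⊎-dec_; ¬?; dec-true)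
open import Algebra.Properties.Semiring.Sum +-*-semiring using (sum; sum-cong-≗; ∑-distrib-+; ∑-comm; *-distribˡ-sum; *-distribʳ-sum)

-- The constant is exact. Blow up the wheel with five rim vertices, each rim vertex to 2n/15
-- vertices and the hub to n/3. The triangles of this graph form an F₅-free 3-graph, because an F₅
-- would put a K₄ on a, b, c, d; every degree is 4n²/45, and the odd rim forbids a 3-partition.
-- Hence the two counts around a 5-cycle leave no slack in their quadratic and cubic terms when |N|
-- = 2n/3, and they have to be combined with exactly the right weights. For the shadow graph the
-- densities decide the route. Up to linear overlaps, six links fill 48/45 of all ordered pairs,
-- which is impossible, but five fill only 40/45, so this count stops at K₆. Four links fill 32/45,
-- which exceeds the Turán density 2/3 of K₄-free graphs by 2/45. Out of this margin the argument
-- pays for the link pairs of small codegree, at most 4/100 for four well-chosen vertices; the 1/225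
-- that is left must beat 20n, which is why n has to be large. All edge counts are over ordered
-- pairs, so that no halves occur.

-- Elementary inequalities between natural numbers.

-- The format of the polynomial certificates below: `A ≤ B` is a nonnegative combination of
-- hypotheses and AM-GM inequalities, and a ring identity shows `A` to be `B` plus a polynomial with
-- natural coefficients and positive constant term.
absurd-≤ : ∀ {A B} c → A ≤ B → A ≡ B + suc c → ⊥
absurd-≤ {A} {B} c A≤B eq = <-irrefl refl (≤-trans (m<m+n B {suc c} (s≤s z≤n)) (subst (_≤ B) eq A≤B))

2ab≤a²+b² : ∀ a b → 2 * (a * b) ≤ a * a + b * b
2ab≤a²+b² a b with ≤-total a b
... | inj₁ a≤b = subst (λ b → 2 * (a * b) ≤ a * a + b * b) (m+[n∸m]≡n a≤b) (go a (b ∸ a))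
  where
  go : ∀ a k → 2 * (a * (a + k)) ≤ a * a + (a + k) * (a + k)
  go a k = subst (2 * (a * (a + k)) ≤_) (eq a k) (m≤m+n _ (k * k))
    where
    eq : ∀ a k → 2 * (a * (a + k)) + k * k ≡ a * a + (a + k) * (a + k)
    eq = solve-∀
... | inj₂ b≤a = subst (λ a → 2 * (a * b) ≤ a * a + b * b) (m+[n∸m]≡n b≤a) (go b (a ∸ b))
  where
  go : ∀ b k → 2 * ((b + k) * b) ≤ (b + k) * (b + k) + b * b
  go b k = subst (2 * ((b + k) * b) ≤_) (eq b k) (m≤m+n _ (k * k))
    where
    eq : ∀ b k → 2 * ((b + k) * b) + k * k ≡ (b + k) * (b + k) + b * b
    eq = solve-∀

m²≤n²⇒m≤n : ∀ {m n} → m * m ≤ n * n → m ≤ n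
m²≤n²⇒m≤n {m} {n} le with m ≤? n
... | yes p = p
... | no ¬p = contradiction (<-≤-trans (*-mono-< (≰⇒> ¬p) (≰⇒> ¬p)) le) (<-irrefl refl)

<*⇒0< : ∀ {m} c k → m < c * k → 0 < k
<*⇒0< {m} c zero lt = ⊥-elim (n≮0 (subst (m <_) (*-zeroʳ c) lt))
<*⇒0< c (suc k) lt = s≤s z≤n

-- Indicators and finite sums.

⟦_⟧ : Bool → ℕ
⟦ true ⟧ = 1
⟦ false ⟧ = 0

⟦⟧≤1 : ∀ p → ⟦ p ⟧ ≤ 1
⟦⟧≤1 true = ≤-refl
⟦⟧≤1 false = z≤n

⟦⟧-∧ : ∀ p q → ⟦ p ∧ q ⟧ ≡ ⟦ p ⟧ * ⟦ q ⟧
⟦⟧-∧ true q = sym (+-identityʳ _)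
⟦⟧-∧ false q = refl

⟦⟧-∧≤ : ∀ p q → ⟦ p ∧ q ⟧ ≤ ⟦ p ⟧
⟦⟧-∧≤ true q = ⟦⟧≤1 q
⟦⟧-∧≤ false q = z≤n

⟦⟧-mono : ∀ {p q} → (p ≡ true → q ≡ true) → ⟦ p ⟧ ≤ ⟦ q ⟧
⟦⟧-mono {false} f = z≤n
⟦⟧-mono {true} {q} f rewrite f refl = ≤-refl

⟦⟧-bound : ∀ {p m} → (p ≡ true → 1 ≤ m) → ⟦ p ⟧ ≤ m
⟦⟧-bound {false} f = z≤n
⟦⟧-bound {true} f = f refl

⟦⟧-true : ∀ {p} → p ≡ true → 1 ≤ ⟦ p ⟧
⟦⟧-true refl = ≤-refl

⟦⟧-false : ∀ {p} → (p ≡ true → ⊥) → ⟦ p ⟧ ≤ 0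
⟦⟧-false = ⟦⟧-bound ∘ (⊥-elim ∘_)

⟦⟧-excl₂ : ∀ {p q} → (p ≡ true → q ≡ true → ⊥) → ⟦ p ⟧ + ⟦ q ⟧ ≤ 1
⟦⟧-excl₂ {false} {q} f = ⟦⟧≤1 q
⟦⟧-excl₂ {true} {false} f = ≤-refl
⟦⟧-excl₂ {true} {true} f = ⊥-elim (f refl refl)

⟦⟧-excl₃ : ∀ {p q r} → (p ≡ true → q ≡ true → ⊥) → (p ≡ true → r ≡ true → ⊥) →
  (q ≡ true → r ≡ true → ⊥) → ⟦ p ⟧ + (⟦ q ⟧ + ⟦ r ⟧) ≤ 1
⟦⟧-excl₃ {false} f g h = ⟦⟧-excl₂ h
⟦⟧-excl₃ {true} {false} f g h = s≤s (⟦⟧-false (g refl))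
⟦⟧-excl₃ {true} {true} f g h = ⊥-elim (f refl refl)

∧-true : ∀ {p q} → p ≡ true → q ≡ true → p ∧ q ≡ true
∧-true refl refl = refl

∧-left : ∀ {p q} → p ∧ q ≡ true → p ≡ true
∧-left {true} _ = refl

∧-right : ∀ {p q} → p ∧ q ≡ true → q ≡ true
∧-right {true} e = e

not-true : ∀ {p} → (p ≡ true → ⊥) → not p ≡ true
not-true {false} _ = refl
not-true {true} h = ⊥-elim (h refl)

does-true : ∀ {a} {A : Set a} (d : Dec A) → does d ≡ true → A
does-true (yes p) _ = p

bool-cases : ∀ b → b ≡ true ⊎ b ≡ false
bool-cases true = inj₁ refl
bool-cases false = inj₂ refl

⟦⟧-pos : ∀ {p} → 0 < ⟦ p ⟧ → p ≡ true
⟦⟧-pos {true} _ = refl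

sum-mono : ∀ {n} {f g : Fin n → ℕ} → (∀ i → f i ≤ g i) → sum f ≤ sum g
sum-mono {zero} le = z≤n
sum-mono {suc n} le = +-mono-≤ (le zero) (sum-mono (le ∘ suc))

sum-const : ∀ n c → sum {n} (λ _ → c) ≡ n * c
sum-const zero c = refl
sum-const (suc n) c = cong (c +_) (sum-const n c)

sum-zero : ∀ n → sum {n} (λ _ → 0) ≡ 0
sum-zero n = trans (sum-const n 0) (*-zeroʳ n)

sum-pos : ∀ {n} (f : Fin n → ℕ) → 0 < sum f → ∃[ i ] 0 < f i
sum-pos {suc n} f pos with f zero in eq
... | suc _ = zero , subst (0 <_) (sym eq) (s≤s z≤n)
... | zero with sum-pos (f ∘ suc) pos
... | i , p = suc i , p

sum-point : ∀ {n} (z : Fin n) → sum (λ i → ⟦ does (i ≟ᶠ z) ⟧) ≡ 1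
sum-point {suc n} zero = cong suc (trans (sum-cong-≗ {n} (λ i → refl)) (sum-zero n))
sum-point (suc z) = sum-point z

argmax : ∀ {n} → Fin n → (f : Fin n → ℕ) → ∃[ i ] (∀ j → f j ≤ f i)
argmax {suc zero} _ f = zero , λ { zero → ≤-refl }
argmax {suc (suc n)} _ f with argmax zero (f ∘ suc)
... | i , max with ≤-total (f zero) (f (suc i))
... | inj₁ le = suc i , λ { zero → le ; (suc j) → max j }
... | inj₂ ge = zero , λ { zero → ≤-refl ; (suc j) → ≤-trans (max j) ge }

∑∑ : ∀ {n} → (Fin n → Fin n → ℕ) → ℕ
∑∑ f = sum λ a → sum λ b → f a b

∑∑-mono : ∀ {n} {f g : Fin n → Fin n → ℕ} → (∀ a b → f a b ≤ g a b) → ∑∑ f ≤ ∑∑ g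
∑∑-mono le = sum-mono λ a → sum-mono (le a)

∑∑-cong : ∀ {n} {f g : Fin n → Fin n → ℕ} → (∀ a b → f a b ≡ g a b) → ∑∑ f ≡ ∑∑ g
∑∑-cong eq = sum-cong-≗ λ a → sum-cong-≗ (eq a)

∑∑-+ : ∀ {n} (f g : Fin n → Fin n → ℕ) → ∑∑ (λ a b → f a b + g a b) ≡ ∑∑ f + ∑∑ g
∑∑-+ f g = trans (sum-cong-≗ λ a → ∑-distrib-+ (f a) (g a)) (∑-distrib-+ (sum ∘ f) (sum ∘ g))

∑∑-* : ∀ {n} c (f : Fin n → Fin n → ℕ) → ∑∑ (λ a b → c * f a b) ≡ c * ∑∑ f
∑∑-* c f = trans (sum-cong-≗ λ a → sym (*-distribˡ-sum c (f a))) (sym (*-distribˡ-sum c (sum ∘ f)))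

∑∑-comm : ∀ {n} (f : Fin n → Fin n → ℕ) → ∑∑ f ≡ ∑∑ (flip f)
∑∑-comm f = ∑-comm f

∑∑-const : ∀ n c → ∑∑ {n} (λ _ _ → c) ≡ n * (n * c)
∑∑-const n c = trans (sum-cong-≗ {n} λ _ → sum-const n c) (sum-const n (n * c))

∑∑-zeros : ∀ n → ∑∑ {n} (λ _ _ → 0) ≡ 0
∑∑-zeros n = trans (∑∑-const n 0) (trans (cong (n *_) (*-zeroʳ n)) (*-zeroʳ n))

∑∑-product : ∀ {n} (f g : Fin n → ℕ) → ∑∑ (λ a b → f a * g b) ≡ sum f * sum g
∑∑-product f g = trans (sum-cong-≗ λ a → sym (*-distribˡ-sum (f a) g)) (sym (*-distribʳ-sum (sum g) f))

∑∑-symmetrise : ∀ {n} (f : Fin n → Fin n → ℕ) → ∑∑ (λ a b → f a b + f b a) ≡ 2 * ∑∑ f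
∑∑-symmetrise f = trans (∑∑-+ f (flip f)) (cong (∑∑ f +_) (trans (sym (∑∑-comm f)) (sym (+-identityʳ _))))

∑∑-pos : ∀ {n} (f : Fin n → Fin n → ℕ) → 0 < ∑∑ f → ∃[ a ] ∃[ b ] 0 < f a b
∑∑-pos f pos with sum-pos _ pos
... | a , p with sum-pos _ p
... | b , q = a , b , q

∑∑-row : ∀ {n} (z : Fin n) → ∑∑ {n} (λ a _ → ⟦ does (a ≟ᶠ z) ⟧) ≡ n
∑∑-row {n} z = trans (sum-cong-≗ λ a → sum-const n ⟦ does (a ≟ᶠ z) ⟧) (trans (sym (*-distribˡ-sum n λ a → ⟦ does (a ≟ᶠ z) ⟧)) (trans (cong (n *_) (sum-point z)) (*-identityʳ n)))

∑∑-cross : ∀ {n} (z : Fin n) → ∑∑ {n} (λ a b → ⟦ does (a ≟ᶠ z) ⟧ + ⟦ does (b ≟ᶠ z) ⟧) ≡ 2 * n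
∑∑-cross z = trans (∑∑-symmetrise λ a _ → ⟦ does (a ≟ᶠ z) ⟧) (cong (2 *_) (∑∑-row z))

-- Degree sums along the edges of a graph.

module EdgeAveraging {n : ℕ} (i : Fin n → Fin n → Bool) (i-comm : ∀ a b → i a b ≡ i b a)
  (P : Fin n → Bool) (i⇒P : ∀ {a b} → i a b ≡ true → P a ≡ true) where

  deg : Fin n → ℕ
  deg a = sum λ b → ⟦ i a b ⟧

  squares size : ℕ
  squares = sum λ a → deg a * deg a
  size = sum (⟦_⟧ ∘ P)

  deg-outside : ∀ {a} → P a ≡ false → deg a ≡ 0
  deg-outside {a} Pa = trans (sum-cong-≗ λ b → zero-if b (bool-cases (i a b))) (sum-zero n)
    where
    zero-if : ∀ b → i a b ≡ true ⊎ i a b ≡ false → ⟦ i a b ⟧ ≡ 0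
    zero-if b (inj₁ e) = case trans (sym Pa) (i⇒P e) of λ ()
    zero-if b (inj₂ e) = cong ⟦_⟧ e

  -- AM-GM is applied to each product `deg a * deg b`. Products with an end outside `P` vanish, so
  -- the size of `P` appears instead of `n`.
  cauchy-schwarz : ∑∑ (λ a b → ⟦ i a b ⟧) * ∑∑ (λ a b → ⟦ i a b ⟧) ≤ squares * size
  cauchy-schwarz = *-cancelˡ-≤ 2 (begin
    2 * (sum deg * sum deg) ≡⟨ cong (2 *_) (sym (∑∑-product deg deg)) ⟩
    2 * ∑∑ (λ a b → deg a * deg b) ≡⟨ sym (∑∑-* 2 λ a b → deg a * deg b) ⟩
    ∑∑ (λ a b → 2 * (deg a * deg b)) ≤⟨ ∑∑-mono pt ⟩
    ∑∑ (λ a b → deg a * deg a * ⟦ P b ⟧ + deg b * deg b * ⟦ P a ⟧) ≡⟨ ∑∑-symmetrise (λ a b → deg a * deg a * ⟦ P b ⟧) ⟩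
    2 * ∑∑ (λ a b → deg a * deg a * ⟦ P b ⟧) ≡⟨ cong (2 *_) (∑∑-product (λ a → deg a * deg a) (⟦_⟧ ∘ P)) ⟩
    2 * (squares * size) ∎)
    where
    open ≤-Reasoning
    bool-pt : ∀ p q m k → (p ≡ false → m ≡ 0) → (q ≡ false → k ≡ 0) → 2 * (m * k) ≤ m * m * ⟦ q ⟧ + k * k * ⟦ p ⟧
    bool-pt false q m k m≡0 _ rewrite m≡0 refl = z≤n
    bool-pt true false m k _ k≡0 rewrite k≡0 refl | *-zeroʳ m = z≤n
    bool-pt true true m k _ _ rewrite *-identityʳ (m * m) | *-identityʳ (k * k) = 2ab≤a²+b² m k
    pt : ∀ a b → 2 * (deg a * deg b) ≤ deg a * deg a * ⟦ P b ⟧ + deg b * deg b * ⟦ P a ⟧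
    pt a b = bool-pt (P a) (P b) (deg a) (deg b) deg-outside deg-outside

  -- Summed over the ordered edges, `deg a + deg b` gives every squared degree twice.
  squares-bound : ∀ c C → (∀ a b → i a b ≡ true → c * (deg a + deg b) ≤ C) → c * (2 * squares) ≤ C * ∑∑ (λ a b → ⟦ i a b ⟧)
  squares-bound c C h = begin
    c * (2 * squares) ≡⟨ cong (c *_) (sym pairs) ⟩
    c * ∑∑ (λ a b → f a b + f b a) ≡⟨ sym (∑∑-* c λ a b → f a b + f b a) ⟩
    ∑∑ (λ a b → c * (f a b + f b a)) ≤⟨ ∑∑-mono pt ⟩
    ∑∑ (λ a b → C * ⟦ i a b ⟧) ≡⟨ ∑∑-* C (λ a b → ⟦ i a b ⟧) ⟩
    C * ∑∑ (λ a b → ⟦ i a b ⟧) ∎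
    where
    open ≤-Reasoning
    f : Fin n → Fin n → ℕ
    f a b = ⟦ i a b ⟧ * deg a
    pairs : ∑∑ (λ a b → f a b + f b a) ≡ 2 * squares
    pairs = trans (∑∑-symmetrise f) (cong (2 *_) (sum-cong-≗ λ a → sym (*-distribʳ-sum (deg a) λ b → ⟦ i a b ⟧)))
    bool-pt : ∀ p m k → (p ≡ true → c * (m + k) ≤ C) → c * (⟦ p ⟧ * m + ⟦ p ⟧ * k) ≤ C * ⟦ p ⟧
    bool-pt false m k _ rewrite *-zeroʳ c = z≤n
    bool-pt true m k h rewrite *-identityʳ C | *-identityˡ m | *-identityˡ k = h refl
    pt : ∀ a b → c * (f a b + f b a) ≤ C * ⟦ i a b ⟧
    pt a b = subst (λ p → c * (f a b + ⟦ p ⟧ * deg b) ≤ C * ⟦ i a b ⟧) (i-comm a b) (bool-pt (i a b) (deg a) (deg b) (h a b))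

  Heavy : ℕ → ℕ → Fin n → Fin n → Set
  Heavy c C u v = i u v ≡ true × C < c * (deg u + deg v)

  heavy? : ∀ c C → Dec (∃[ u ] ∃[ v ] Heavy c C u v)
  heavy? c C = any? λ u → any? λ v → (i u v ≟ᵇ true) ×-dec (C <? c * (deg u + deg v))

  heavy-edge : ∀ c C → (c * (2 * squares) ≤ C * ∑∑ (λ a b → ⟦ i a b ⟧) → ⊥) → ∃[ u ] ∃[ v ] Heavy c C u v
  heavy-edge c C big = decidable-stable (heavy? c C)
    λ none → big (squares-bound c C λ a b e → ≮⇒≥ λ lt → none (a , b , e , lt))

-- Turán's theorem.

-- The one inequality besides the hypotheses is AM-GM for (k+1)r and Δ, which agree in the balanced
-- complete multipartite graph.
turán-arith : ∀ k q r Δ e → suc k * q ≤ k * (Δ * Δ) → e ≤ q + 2 * (r * Δ) → suc (suc k) * e ≤ suc k * ((r + Δ) * (r + Δ))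
turán-arith k q r Δ e hq he = *-cancelˡ-≤ (suc k) (+-cancelʳ-≤ (2 * (suc k * r * Δ)) _ _ (begin
  suc k * (suc (suc k) * e) + 2 * (suc k * r * Δ) ≤⟨ +-mono-≤ (*-monoʳ-≤ (suc k) (*-monoʳ-≤ (suc (suc k)) he)) (2ab≤a²+b² (suc k * r) Δ) ⟩
  suc k * (suc (suc k) * (q + 2 * (r * Δ))) + (suc k * r * (suc k * r) + Δ * Δ) ≡⟨ e₁ k q r Δ ⟩
  suc (suc k) * (suc k * q) + (2 * (suc k * suc (suc k) * (r * Δ)) + (suc k * r * (suc k * r) + Δ * Δ)) ≤⟨ +-monoˡ-≤ _ (*-monoʳ-≤ (suc (suc k)) hq) ⟩
  suc (suc k) * (k * (Δ * Δ)) + (2 * (suc k * suc (suc k) * (r * Δ)) + (suc k * r * (suc k * r) + Δ * Δ)) ≡⟨ e₂ k r Δ ⟩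
  suc k * (suc k * ((r + Δ) * (r + Δ))) + 2 * (suc k * r * Δ) ∎))
  where
  open ≤-Reasoning
  e₁ : ∀ k q r Δ → suc k * (suc (suc k) * (q + 2 * (r * Δ))) + (suc k * r * (suc k * r) + Δ * Δ)
    ≡ suc (suc k) * (suc k * q) + (2 * (suc k * suc (suc k) * (r * Δ)) + (suc k * r * (suc k * r) + Δ * Δ))
  e₁ = solve-∀
  e₂ : ∀ k r Δ → suc (suc k) * (k * (Δ * Δ)) + (2 * (suc k * suc (suc k) * (r * Δ)) + (suc k * r * (suc k * r) + Δ * Δ))
    ≡ suc k * (suc k * ((r + Δ) * (r + Δ))) + 2 * (suc k * r * Δ)
  e₂ = solve-∀

module Cliques {n : ℕ} (g : Fin n → Fin n → Bool) (g-comm : ∀ a b → g a b ≡ g b a) where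

  # : (Fin n → Bool) → ℕ
  # P = sum (⟦_⟧ ∘ P)

  -- The nested form fits the induction: once v is chosen, the rest is sought in the part of `P`
  -- joined to v.
  Clique : ℕ → (Fin n → Bool) → Set
  Clique zero P = ⊤
  Clique (suc k) P = ∃[ v ] (P v ≡ true × Clique k λ a → P a ∧ g a v)

  inside : (Fin n → Bool) → Fin n → Fin n → Bool
  inside P a b = P a ∧ (P b ∧ g a b)

  clique-list : ∀ k P → Clique k P → ∃[ xs ] (length xs ≡ k × All (λ a → P a ≡ true) xs × AllPairs (λ a b → g a b ≡ true) xs)
  clique-list zero P _ = [] , refl , [] , []
  clique-list (suc k) P (v , Pv , C) = let xs , len , all , pairs = clique-list k (λ a → P a ∧ g a v) C in
    v ∷ xs , cong suc len , Pv ∷ All.map ∧-left all , All.map (λ {a} h → trans (g-comm v a) (∧-right {P a} h)) all ∷ pairs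

  -- Erdős' proof: the edges missing the neighbourhood of a vertex of maximum degree number at most (|P| − Δ)Δ.
  turán : ∀ k P → ¬ Clique (suc (suc k)) P → suc k * ∑∑ (λ a b → ⟦ inside P a b ⟧) ≤ k * (# P * # P)
  turán zero P none = ≤-trans (≤-reflexive (*-identityˡ _)) (≤-trans (∑∑-mono λ a b → ⟦⟧-false λ h →
      none (b , ∧-left (∧-right {P a} h) , a , ∧-true (∧-left h) (∧-right {P b} (∧-right {P a} h)) , tt))
    (≤-reflexive (∑∑-zeros n)))
  turán (suc k) P none = by-vertex (any? λ v → P v ≟ᵇ true)
    where
    d : Fin n → ℕ
    d a = sum λ b → ⟦ inside P a b ⟧
    by-vertex : Dec (∃[ v ] P v ≡ true) → suc (suc k) * sum d ≤ suc k * (# P * # P)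
    by-vertex (no empty) = ≤-trans (≤-reflexive (trans (cong (suc (suc k) *_) zeros) (*-zeroʳ (suc (suc k))))) z≤n
      where
      zeros : sum d ≡ 0
      zeros = n≤0⇒n≡0 (≤-trans (∑∑-mono λ a b → ⟦⟧-false λ h → empty (a , ∧-left h))
        (≤-reflexive (∑∑-zeros n)))
    by-vertex (yes (o , Po)) = at (argmax o d)
      where
      at : ∃[ v ] (∀ a → d a ≤ d v) → suc (suc k) * sum d ≤ suc k * (# P * # P)
      at (v , max) = by-P (bool-cases (P v))
        where
        by-P : P v ≡ true ⊎ P v ≡ false → suc (suc k) * sum d ≤ suc k * (# P * # P)
        -- The maximum may be attained outside `P`; then it is 0 and so is every `d a`.
        by-P (inj₂ Pv) = ≤-trans (*-monoʳ-≤ (suc (suc k)) (sum-mono max))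
          (≤-trans (≤-reflexive (trans (cong (suc (suc k) *_) (trans (sum-const n (d v)) (trans (cong (n *_) dv≡0) (*-zeroʳ n)))) (*-zeroʳ (suc (suc k))))) z≤n)
          where
          dv≡0 : d v ≡ 0
          dv≡0 = trans (sum-cong-≗ λ b → cong (λ p → ⟦ p ∧ (P b ∧ g v b) ⟧) Pv) (sum-zero n)
        by-P (inj₁ Pv) = subst (λ m → suc (suc k) * sum d ≤ suc k * (m * m)) R+Δ
          (turán-arith k (∑∑ λ a b → ⟦ inside Q a b ⟧) (# R) (# Q) (sum d) (turán k Q λ C → none (v , Pv , C)) split)
          where
          Q R : Fin n → Bool
          Q a = P a ∧ g a v
          R a = P a ∧ not (g a v)
          R+Δ : # R + # Q ≡ # P
          R+Δ = trans (sym (∑-distrib-+ (⟦_⟧ ∘ R) (⟦_⟧ ∘ Q))) (sum-cong-≗ λ a → pt (P a) (g a v))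
            where
            pt : ∀ p q → ⟦ p ∧ not q ⟧ + ⟦ p ∧ q ⟧ ≡ ⟦ p ⟧
            pt false q = refl
            pt true false = refl
            pt true true = refl
          dv≡Δ : d v ≡ # Q
          dv≡Δ = sum-cong-≗ λ b → trans (cong (λ p → ⟦ p ∧ (P b ∧ g v b) ⟧) Pv) (cong (λ p → ⟦ P b ∧ p ⟧) (g-comm v b))
          r : Fin n → Fin n → ℕ
          r a b = ⟦ R a ⟧ * ⟦ inside P a b ⟧
          split : sum d ≤ (∑∑ λ a b → ⟦ inside Q a b ⟧) + 2 * (# R * # Q)
          split = begin
            sum d ≤⟨ ∑∑-mono (λ a b → pt (P a) (P b) (g a v) (g b v) (g a b) (g b a) (g-comm a b)) ⟩
            ∑∑ (λ a b → ⟦ inside Q a b ⟧ + (r a b + r b a)) ≡⟨ ∑∑-+ (λ a b → ⟦ inside Q a b ⟧) (λ a b → r a b + r b a) ⟩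
            ∑∑ (λ a b → ⟦ inside Q a b ⟧) + ∑∑ (λ a b → r a b + r b a) ≡⟨ cong (∑∑ (λ a b → ⟦ inside Q a b ⟧) +_) (∑∑-symmetrise r) ⟩
            ∑∑ (λ a b → ⟦ inside Q a b ⟧) + 2 * ∑∑ r ≤⟨ +-monoʳ-≤ (∑∑ (λ a b → ⟦ inside Q a b ⟧)) (*-monoʳ-≤ 2 r≤) ⟩
            ∑∑ (λ a b → ⟦ inside Q a b ⟧) + 2 * (# R * # Q) ∎
            where
            open ≤-Reasoning
            pt : ∀ p q i j h h′ → h ≡ h′ → ⟦ p ∧ (q ∧ h) ⟧ ≤ ⟦ (p ∧ i) ∧ ((q ∧ j) ∧ h) ⟧ + (⟦ p ∧ not i ⟧ * ⟦ p ∧ (q ∧ h) ⟧ + ⟦ q ∧ not j ⟧ * ⟦ q ∧ (p ∧ h′) ⟧)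
            pt false q i j h .h refl = z≤n
            pt true false i j h .h refl = z≤n
            pt true true i j false .false refl = z≤n
            pt true true true true true .true refl = s≤s z≤n
            pt true true true false true .true refl = s≤s z≤n
            pt true true false j true .true refl = s≤s z≤n
            r≤ : ∑∑ r ≤ # R * # Q
            r≤ = begin
              ∑∑ r ≡⟨ sum-cong-≗ (λ a → sym (*-distribˡ-sum ⟦ R a ⟧ λ b → ⟦ inside P a b ⟧)) ⟩
              sum (λ a → ⟦ R a ⟧ * d a) ≤⟨ sum-mono (λ a → *-monoʳ-≤ ⟦ R a ⟧ (≤-trans (max a) (≤-reflexive dv≡Δ))) ⟩
              sum (λ a → ⟦ R a ⟧ * # Q) ≡⟨ sym (*-distribʳ-sum (# Q) (⟦_⟧ ∘ R)) ⟩
              # R * # Q ∎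

-- Numerical contradictions for the two structural arguments.

-- The 5-cycle has independence number 2.
⟦⟧-cycle₅ : ∀ {p q r s t} → (p ≡ true → q ≡ true → ⊥) → (q ≡ true → r ≡ true → ⊥) →
  (r ≡ true → s ≡ true → ⊥) → (s ≡ true → t ≡ true → ⊥) → (t ≡ true → p ≡ true → ⊥) →
  ⟦ p ⟧ + (⟦ q ⟧ + (⟦ r ⟧ + (⟦ s ⟧ + ⟦ t ⟧))) ≤ 2
⟦⟧-cycle₅ {false} {q} {r} pq qr rs st tp = ≤-trans (≤-reflexive (sym (+-assoc ⟦ q ⟧ ⟦ r ⟧ _))) (+-mono-≤ (⟦⟧-excl₂ qr) (⟦⟧-excl₂ st))
⟦⟧-cycle₅ {true} {true} pq qr rs st tp = ⊥-elim (pq refl refl)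
⟦⟧-cycle₅ {true} {false} {r} {s} {t} pq qr rs st tp =
  s≤s (≤-trans (≤-reflexive (sym (+-assoc ⟦ r ⟧ ⟦ s ⟧ ⟦ t ⟧))) (+-mono-≤ (⟦⟧-excl₂ rs) (⟦⟧-false λ e → tp e refl)))

4ab≤[a+b]² : ∀ a b → 4 * (a * b) ≤ (a + b) * (a + b)
4ab≤[a+b]² a b = subst₂ _≤_ (l a b) (r a b) (+-monoˡ-≤ (2 * (a * b)) (2ab≤a²+b² a b))
  where
  l : ∀ a b → 2 * (a * b) + 2 * (a * b) ≡ 4 * (a * b)
  l = solve-∀
  r : ∀ a b → a * a + b * b + 2 * (a * b) ≡ (a + b) * (a + b)
  r = solve-∀

-- With n = x + y the left side is 24n² + 3, while xy ≤ n²/4 leaves at most 22.5n² on the right.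
three-spread-⊥ : ∀ x y → 3 * suc (8 * ((y + x) * (y + x))) ≤ 90 * (1 * (y * x)) → ⊥
three-spread-⊥ x y h = absurd-≤ _ (+-mono-≤ (*-monoʳ-≤ 4 h) (*-monoʳ-≤ 90 (4ab≤[a+b]² y x))) (eq x y)
  where
  eq : ∀ x y → 4 * (3 * suc (8 * ((y + x) * (y + x)))) + 90 * (4 * (y * x))
    ≡ 4 * (90 * (1 * (y * x))) + 90 * ((y + x) * (y + x)) + suc (11 + 6 * ((y + x) * (y + x)))
  eq = solve-∀

-- The hypothesis implies 2(x + y)² < 9xy, that is (y - 2x)(2y - x) < 0.
five-cycle-< : ∀ x y → 5 * suc (8 * ((y + x) * (y + x))) ≤ 90 * (2 * (y * x)) → y < 2 * x
five-cycle-< x y h with y <? 2 * x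
... | yes p = p
... | no ¬p = ⊥-elim (absurd-≤ _ (subst (λ y → 5 * suc (8 * ((y + x) * (y + x))) ≤ 90 * (2 * (y * x))) (sym (m+[n∸m]≡n (≮⇒≥ ¬p))) h) (eq x (y ∸ 2 * x)))
  where
  eq : ∀ x k → 5 * suc (8 * ((2 * x + k + x) * (2 * x + k + x)))
    ≡ 90 * (2 * ((2 * x + k) * x)) + suc (4 + 60 * (x * k) + 40 * (k * k))
  eq = solve-∀

-- The weights y and 2x make r and e enter only through r + e, which is at most y. What remains is a
-- cubic inequality in X = 2x and y whose leading forms agree at X = y, the extremal ratio; its
-- failure just above that point is why `y < 2 * x` has to be established first.
five-cycle-⊥ : ∀ x y r e → y < 2 * x →
  3 * suc (8 * ((y + x) * (y + x))) ≤ 90 * (1 * (y * x) + x * r) →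
  16 * ((y + x) * (y + x)) < 45 * y * e → r + e ≤ y → ⊥
five-cycle-⊥ x y r e y<2x h₃ h₄ r+e≤y = absurd-≤ _ final (eq y (2 * x ∸ suc y))
  where
  open ≤-Reasoning
  L : ℕ → ℕ → ℕ
  L X y = 12 * y + (X + 2 * y) * (X + 2 * y) * (24 * y + 16 * X)
  l : ∀ x y → 12 * y + (2 * x + 2 * y) * (2 * x + 2 * y) * (24 * y + 16 * (2 * x)) + 8 * x ≡ 4 * (3 * suc (8 * ((y + x) * (y + x))) * y + suc (16 * ((y + x) * (y + x))) * (2 * x))
  l = solve-∀
  m : ∀ x y r e → 4 * (90 * (1 * (y * x) + x * r) * y + 45 * y * e * (2 * x)) ≡ 360 * (x * y) * (y + (r + e))
  m = solve-∀
  q : ∀ x y → 360 * (x * y) * (y + y) ≡ 360 * (2 * x * (y * y))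
  q = solve-∀
  bound : L (2 * x) y ≤ 360 * (2 * x * (y * y))
  bound = begin
    L (2 * x) y ≤⟨ m≤m+n _ _ ⟩
    L (2 * x) y + 8 * x ≡⟨ l x y ⟩
    4 * (3 * suc (8 * ((y + x) * (y + x))) * y + suc (16 * ((y + x) * (y + x))) * (2 * x))
      ≤⟨ *-monoʳ-≤ 4 (+-mono-≤ (*-monoˡ-≤ y h₃) (*-monoˡ-≤ (2 * x) h₄)) ⟩
    4 * (90 * (1 * (y * x) + x * r) * y + 45 * y * e * (2 * x)) ≡⟨ m x y r e ⟩
    360 * (x * y) * (y + (r + e)) ≤⟨ *-monoʳ-≤ (360 * (x * y)) (+-monoʳ-≤ y r+e≤y) ⟩
    360 * (x * y) * (y + y) ≡⟨ q x y ⟩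
    360 * (2 * x * (y * y)) ∎
  final : L (suc y + (2 * x ∸ suc y)) y ≤ 360 * ((suc y + (2 * x ∸ suc y)) * (y * y))
  final = subst (λ X → L X y ≤ 360 * (X * (y * y))) (sym (m+[n∸m]≡n y<2x)) bound
  eq : ∀ y k → 12 * y + (suc y + k + 2 * y) * (suc y + k + 2 * y) * (24 * y + 16 * (suc y + k))
    ≡ 360 * ((suc y + k) * (y * y)) + suc (15 + 12 * y + 24 * (y * y * (1 + k)) + 136 * (y * ((1 + k) * (1 + k))) + 16 * (3 * k + 3 * (k * k) + k * k * k))
  eq = solve-∀

-- By Cauchy-Schwarz the degree sum of an edge is on average at least 2e/y, and the density makes
-- this exceed 16m/(45y).
averaging-⊥ : ∀ m e sq y → 8 * m < 45 * e → e * e ≤ sq * y → 45 * y * (2 * sq) ≤ 16 * m * e → ⊥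
averaging-⊥ m e sq y dense cs total = <-irrefl refl (begin-strict
  16 * m * e <⟨ *-monoˡ-< e {{>-nonZero (<*⇒0< 45 e dense)}} (subst₂ _<_ (l m) (r e) (*-monoʳ-< 2 dense)) ⟩
  90 * e * e ≡⟨ *-assoc 90 e e ⟩
  90 * (e * e) ≤⟨ *-monoʳ-≤ 90 cs ⟩
  90 * (sq * y) ≡⟨ arr sq y ⟩
  45 * y * (2 * sq) ≤⟨ total ⟩
  16 * m * e ∎)
  where
  open ≤-Reasoning
  l : ∀ m → 2 * (8 * m) ≡ 16 * m
  l = solve-∀
  r : ∀ m → 2 * (45 * m) ≡ 90 * m
  r = solve-∀
  arr : ∀ a b → 90 * (a * b) ≡ 45 * b * (2 * a)
  arr = solve-∀

-- Both sides are affine in m, so the inequality persists at one end of 0 ≤ m ≤ p. The alternatives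
-- are the ends m = p and m = 0, divided by p.
divide-out : ∀ A B G κ m p → 0 < p → m ≤ p → A * p + κ * m ≤ G * p * m + B * p → A + κ ≤ G * p + B ⊎ A ≤ B
divide-out A B G κ m p 0<p m≤p h with ≤-total (G * p) κ
... | inj₁ Gp≤κ = inj₂ (*-cancelʳ-≤ A B p {{>-nonZero 0<p}} (+-cancelʳ-≤ (κ * m) (A * p) (B * p) (begin
  A * p + κ * m ≤⟨ h ⟩
  G * p * m + B * p ≤⟨ +-monoˡ-≤ (B * p) (*-monoˡ-≤ m Gp≤κ) ⟩
  κ * m + B * p ≡⟨ +-comm (κ * m) (B * p) ⟩
  B * p + κ * m ∎)))
  where open ≤-Reasoning
... | inj₂ κ≤Gp = inj₁ (*-cancelʳ-≤ (A + κ) (G * p + B) p {{>-nonZero 0<p}} (begin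
  (A + κ) * p ≡⟨ *-distribʳ-+ p A κ ⟩
  A * p + κ * p ≡⟨ cong (λ q → A * p + κ * q) (sym (m+[n∸m]≡n m≤p)) ⟩
  A * p + κ * (m + k) ≡⟨ l (A * p) κ m k ⟩
  A * p + κ * m + κ * k ≤⟨ +-mono-≤ h (*-monoˡ-≤ k κ≤Gp) ⟩
  G * p * m + B * p + G * p * k ≡⟨ r (G * p) m (B * p) k ⟩
  G * p * (m + k) + B * p ≡⟨ cong (λ q → G * p * q + B * p) (m+[n∸m]≡n m≤p) ⟩
  G * p * p + B * p ≡⟨ sym (*-distribʳ-+ p (G * p) B) ⟩
  (G * p + B) * p ∎))
  where
  open ≤-Reasoning
  k = p ∸ m
  l : ∀ a κ m k → a + κ * (m + k) ≡ a + κ * m + κ * k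
  l = solve-∀
  r : ∀ g m b k → g * m + b + g * k ≡ g * (m + k) + b
  r = solve-∀

-- Multiply the two bounds; 4uv ≤ (u + v)² then replaces the separate factors x² and y² by their
-- geometric mean xy.
geometric-mean : ∀ c x y u v w → w ≤ c * (x * x * u) → w ≤ c * (y * y * v) → 2 * w ≤ c * (x * y) * (u + v)
geometric-mean c x y u v w h₁ h₂ = m²≤n²⇒m≤n (begin
  2 * w * (2 * w) ≡⟨ l w ⟩
  4 * (w * w) ≤⟨ *-monoʳ-≤ 4 (*-mono-≤ h₁ h₂) ⟩
  4 * (c * (x * x * u) * (c * (y * y * v))) ≡⟨ m c x y u v ⟩
  c * (x * y) * (c * (x * y)) * (4 * (u * v)) ≤⟨ *-monoʳ-≤ (c * (x * y) * (c * (x * y))) (4ab≤[a+b]² u v) ⟩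
  c * (x * y) * (c * (x * y)) * ((u + v) * (u + v)) ≡⟨ r (c * (x * y)) (u + v) ⟩
  c * (x * y) * (u + v) * (c * (x * y) * (u + v)) ∎)
  where
  open ≤-Reasoning
  l : ∀ w → 2 * w * (2 * w) ≡ 4 * (w * w)
  l = solve-∀
  m : ∀ c x y u v → 4 * (c * (x * x * u) * (c * (y * y * v))) ≡ c * (x * y) * (c * (x * y)) * (4 * (u * v))
  m = solve-∀
  r : ∀ a b → a * a * (b * b) ≡ a * b * (a * b)
  r = solve-∀

module Parts (x y s : ℕ) where

  -- For parts of sizes x, y, s these are the squared number of vertices, the number of pairs
  -- between the first two parts, and the number of pairs between the third part and the rest. Thus
  -- `p + b` is the size of the complete 3-partite graph.
  N² p b : ℕ
  N² = (x + y + s) * (x + y + s)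
  p = x * y
  b = s * (x + y)

  4b≤N² : 4 * b ≤ N²
  4b≤N² = subst₂ _≤_ refl (cong₂ _*_ (+-comm s (x + y)) (+-comm s (x + y))) (4ab≤[a+b]² s (x + y))

  4p≤β² : 4 * p ≤ (x + y) * (x + y)
  4p≤β² = 4ab≤[a+b]² x y

  N²-pos : 0 < x + y + s → 0 < N²
  N²-pos pos = *-mono-< pos pos

  not-b-heavy : 0 < x + y + s → ∀ {A B} c → A ≡ c * (4 * N²) → B ≡ c * (15 * b) → 0 < c → A ≤ B → ⊥
  not-b-heavy pos {A} {B} c refl refl 0<c h = <-irrefl refl (begin-strict
    4 * (15 * b) ≡⟨ e b ⟩
    15 * (4 * b) ≤⟨ *-monoʳ-≤ 15 4b≤N² ⟩
    15 * N² <⟨ *-monoˡ-< N² {{>-nonZero (N²-pos pos)}} {15} {16} ≤-refl ⟩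
    16 * N² ≡⟨ f N² ⟩
    4 * (4 * N²) ≤⟨ *-monoʳ-≤ 4 (*-cancelˡ-≤ c {{>-nonZero 0<c}} h) ⟩
    4 * (15 * b) ∎)
    where
    open ≤-Reasoning
    e : ∀ b → 4 * (15 * b) ≡ 15 * (4 * b)
    e = solve-∀
    f : ∀ m → 16 * m ≡ 4 * (4 * m)
    f = solve-∀

  3[p+b]≤N² : 3 * (p + b) ≤ N²
  3[p+b]≤N² = *-cancelˡ-≤ 4 (begin
    4 * (3 * (p + b)) ≡⟨ e x y s ⟩
    3 * (4 * (x * y)) + 6 * (2 * (s * (x + y))) ≤⟨ +-mono-≤ (*-monoʳ-≤ 3 4p≤β²) ≤-refl ⟩
    3 * ((x + y) * (x + y)) + 6 * (2 * (s * (x + y))) ≤⟨ fin ⟩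
    4 * N² ∎)
    where
    open ≤-Reasoning
    e : ∀ x y s → 4 * (3 * (x * y + s * (x + y))) ≡ 3 * (4 * (x * y)) + 6 * (2 * (s * (x + y)))
    e = solve-∀
    f : ∀ β s → 3 * (β * β) + 6 * (2 * (s * β)) ≡ 2 * (2 * s * β) + (3 * (β * β) + 8 * (s * β))
    f = solve-∀
    h : ∀ β s → 2 * s * (2 * s) + β * β + (3 * (β * β) + 8 * (s * β)) ≡ 4 * ((β + s) * (β + s))
    h = solve-∀
    fin : 3 * ((x + y) * (x + y)) + 6 * (2 * (s * (x + y))) ≤ 4 * N²
    fin = subst₂ _≤_ (sym (f (x + y) s)) (h (x + y) s) (+-monoˡ-≤ (3 * ((x + y) * (x + y)) + 8 * (s * (x + y))) (2ab≤a²+b² (2 * s) (x + y)))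

  -- 45 times the excess of 4δ, δ = 4N²/45, over the number of edges of the complete 3-partite graph.
  K : ℕ
  K = 16 * N² ∸ 45 * (p + b)

  K-eq : K + 45 * (p + b) ≡ 16 * N²
  K-eq = m∸n+n≡m (≤-trans (≤-reflexive (*-assoc 15 3 (p + b))) (≤-trans (*-monoʳ-≤ 15 3[p+b]≤N²) (*-monoˡ-≤ N² {15} {16} (n≤1+n 15))))

  -- After p ≤ β²/4 with β = x + y, the claim here and in `no-64` concerns a quadratic form in β and
  -- s of negative discriminant. The AM-GM terms 8s, 5β and 13s, 10β are chosen close to its
  -- minimising direction.
  no-56 : 0 < x + y + s → 56 * N² ≤ 135 * p + 180 * b → ⊥
  no-56 pos h = absurd-≤ _ (+-mono-≤ (+-mono-≤ (+-mono-≤ (+-mono-≤ (*-monoʳ-≤ 20 h) (*-monoʳ-≤ 675 4p≤β²))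
      (*-monoʳ-≤ 17 (2ab≤a²+b² (8 * s) (5 * (x + y))))) (*-monoʳ-≤ 10 (2ab≤a²+b² s (x + y)))) (*-monoʳ-≤ 10 (N²-pos pos)))
    (eq (x + y) s p)
    where
    eq : ∀ β s p → 20 * (56 * ((β + s) * (β + s))) + 675 * (4 * p) + 17 * (2 * (8 * s * (5 * β))) + 10 * (2 * (s * β)) + 10 * 1
      ≡ 20 * (135 * p + 180 * (s * β)) + 675 * (β * β) + 17 * (8 * s * (8 * s) + 5 * β * (5 * β)) + 10 * (s * s + β * β)
        + 10 * ((β + s) * (β + s)) + suc (9 + 12 * (s * s))
    eq = solve-∀

  no-64 : 0 < x + y + s → 64 * N² ≤ 105 * p + 225 * b → ⊥
  no-64 pos h = absurd-≤ _ (+-mono-≤ (+-mono-≤ (+-mono-≤ (+-mono-≤ (*-monoʳ-≤ 260 h) (*-monoʳ-≤ 6825 4p≤β²))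
      (*-monoʳ-≤ 97 (2ab≤a²+b² (13 * s) (10 * (x + y))))) (*-monoʳ-≤ 50 (2ab≤a²+b² s (x + y)))) (*-monoʳ-≤ 50 (N²-pos pos)))
    (eq (x + y) s p)
    where
    eq : ∀ β s p → 260 * (64 * ((β + s) * (β + s))) + 6825 * (4 * p) + 97 * (2 * (13 * s * (10 * β))) + 50 * (2 * (s * β)) + 50 * 1
      ≡ 260 * (105 * p + 225 * (s * β)) + 6825 * (β * β) + 97 * (13 * s * (13 * s) + 10 * β * (10 * β)) + 50 * (s * s + β * β)
        + 50 * ((β + s) * (β + s)) + suc (49 + 15 * (β * β) + 147 * (s * s))
    eq = solve-∀

  -- The geometric mean of the two upper bounds is 2Km ≤ 45pM. It removes M from the last hypothesis
  -- multiplied by p; the outcome is affine in m, and its ends contradict `no-56` and 4b ≤ N².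
  two-edges-⊥ : 0 < x + y + s → ∀ m u v M →
    K * m ≤ 45 * (x * x * u) → K * m ≤ 45 * (y * y * v) → u + v ≤ M → m ≤ p →
    96 * N² + 180 * M ≤ 180 * m + 360 * b → ⊥
  two-edges-⊥ pos m u v M hu hv u+v≤M m≤p h = go (m≤n⇒m<n∨m≡n {0} {p} z≤n)
    where
    open ≤-Reasoning
    l : ∀ N p K m M → 4 * (24 * N * p + 2 * K * m) ≡ 96 * N * p + 4 * (2 * (K * m))
    l = solve-∀
    r : ∀ N p M → 96 * N * p + 4 * (45 * p * M) ≡ (96 * N + 180 * M) * p
    r = solve-∀
    q : ∀ m b p → (180 * m + 360 * b) * p ≡ 4 * (45 * p * m + 90 * b * p)
    q = solve-∀
    e₁ : ∀ N K c → 24 * N + 2 * K + 2 * (45 * c) ≡ 24 * N + 2 * (K + 45 * c)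
    e₁ = solve-∀
    e₂ : ∀ N → 24 * N + 2 * (16 * N) ≡ 56 * N
    e₂ = solve-∀
    e₃ : ∀ p b → 45 * p + 90 * b + 2 * (45 * (p + b)) ≡ 135 * p + 180 * b
    e₃ = solve-∀
    e₄ : ∀ N → 96 * N ≡ 24 * (4 * N)
    e₄ = solve-∀
    e₅ : ∀ N → 360 * N ≡ 24 * (15 * N)
    e₅ = solve-∀
    e₆ : ∀ N → 24 * N ≡ 6 * (4 * N)
    e₆ = solve-∀
    e₇ : ∀ N → 90 * N ≡ 6 * (15 * N)
    e₇ = solve-∀
    scaled : 24 * N² * p + 2 * K * m ≤ 45 * p * m + 90 * b * p
    scaled = *-cancelˡ-≤ 4 (begin
      4 * (24 * N² * p + 2 * K * m) ≡⟨ l N² p K m M ⟩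
      96 * N² * p + 4 * (2 * (K * m)) ≤⟨ +-monoʳ-≤ (96 * N² * p) (*-monoʳ-≤ 4 (geometric-mean 45 x y u v (K * m) hu hv)) ⟩
      96 * N² * p + 4 * (45 * p * (u + v)) ≤⟨ +-monoʳ-≤ (96 * N² * p) (*-monoʳ-≤ 4 (*-monoʳ-≤ (45 * p) u+v≤M)) ⟩
      96 * N² * p + 4 * (45 * p * M) ≡⟨ r N² p M ⟩
      (96 * N² + 180 * M) * p ≤⟨ *-monoˡ-≤ p h ⟩
      (180 * m + 360 * b) * p ≡⟨ q m b p ⟩
      4 * (45 * p * m + 90 * b * p) ∎)
    split : 24 * N² + 2 * K ≤ 45 * p + 90 * b ⊎ 24 * N² ≤ 90 * b → ⊥
    split (inj₂ le) = not-b-heavy pos 6 (e₆ N²) (e₇ b) (s≤s z≤n) le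
    split (inj₁ le) = no-56 pos (begin
      56 * N² ≡⟨ sym (trans (cong (λ c → 24 * N² + 2 * c) K-eq) (e₂ N²)) ⟩
      24 * N² + 2 * (K + 45 * (p + b)) ≡⟨ sym (e₁ N² K (p + b)) ⟩
      24 * N² + 2 * K + 2 * (45 * (p + b)) ≤⟨ +-monoˡ-≤ (2 * (45 * (p + b))) le ⟩
      45 * p + 90 * b + 2 * (45 * (p + b)) ≡⟨ e₃ p b ⟩
      135 * p + 180 * b ∎)
    go : 0 < p ⊎ 0 ≡ p → ⊥
    go (inj₁ 0<p) = split (divide-out (24 * N²) (90 * b) 45 (2 * K) m p 0<p m≤p scaled)
    go (inj₂ 0≡p) = not-b-heavy pos 24 (e₄ N²) (e₅ b) (s≤s z≤n) (begin
      96 * N² ≤⟨ m≤m+n _ _ ⟩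
      96 * N² + 180 * M ≤⟨ h ⟩
      180 * m + 360 * b ≡⟨ cong (λ m → 180 * m + 360 * b) (n≤0⇒n≡0 (subst (m ≤_) (sym 0≡p) m≤p)) ⟩
      360 * b ∎)

  -- The elimination of `two-edges-⊥`, with 3A in the role of m; the end 3A = p contradicts `no-64`.
  triangle-⊥ : 0 < x + y + s → ∀ A u v M →
    K * A ≤ 30 * (x * x * u) → K * A ≤ 30 * (y * y * v) → u + v ≤ 2 * M → 3 * A ≤ p →
    48 * N² + 90 * M ≤ 180 * A + 180 * b → ⊥
  triangle-⊥ pos A u v M hu hv u+v≤2M 3A≤p h = go (m≤n⇒m<n∨m≡n {0} {p} z≤n)
    where
    open ≤-Reasoning
    l : ∀ N p K A → 2 * (48 * N * p + K * (3 * A)) ≡ 96 * N * p + 3 * (2 * (K * A))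
    l = solve-∀
    r : ∀ N p M → 96 * N * p + 3 * (30 * p * (2 * M)) ≡ 2 * ((48 * N + 90 * M) * p)
    r = solve-∀
    q : ∀ A b p → 2 * ((180 * A + 180 * b) * p) ≡ 2 * (60 * p * (3 * A) + 180 * b * p)
    q = solve-∀
    e₁ : ∀ N → 48 * N + 16 * N ≡ 64 * N
    e₁ = solve-∀
    e₃ : ∀ p b → 60 * p + 180 * b + 45 * (p + b) ≡ 105 * p + 225 * b
    e₃ = solve-∀
    e₄ : ∀ N → 48 * N ≡ 12 * (4 * N)
    e₄ = solve-∀
    e₅ : ∀ N → 180 * N ≡ 12 * (15 * N)
    e₅ = solve-∀
    scaled : 48 * N² * p + K * (3 * A) ≤ 60 * p * (3 * A) + 180 * b * p
    scaled = *-cancelˡ-≤ 2 (begin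
      2 * (48 * N² * p + K * (3 * A)) ≡⟨ l N² p K A ⟩
      96 * N² * p + 3 * (2 * (K * A)) ≤⟨ +-monoʳ-≤ (96 * N² * p) (*-monoʳ-≤ 3 (geometric-mean 30 x y u v (K * A) hu hv)) ⟩
      96 * N² * p + 3 * (30 * p * (u + v)) ≤⟨ +-monoʳ-≤ (96 * N² * p) (*-monoʳ-≤ 3 (*-monoʳ-≤ (30 * p) u+v≤2M)) ⟩
      96 * N² * p + 3 * (30 * p * (2 * M)) ≡⟨ r N² p M ⟩
      2 * ((48 * N² + 90 * M) * p) ≤⟨ *-monoʳ-≤ 2 (*-monoˡ-≤ p h) ⟩
      2 * ((180 * A + 180 * b) * p) ≡⟨ q A b p ⟩
      2 * (60 * p * (3 * A) + 180 * b * p) ∎)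
    split : 48 * N² + K ≤ 60 * p + 180 * b ⊎ 48 * N² ≤ 180 * b → ⊥
    split (inj₂ le) = not-b-heavy pos 12 (e₄ N²) (e₅ b) (s≤s z≤n) le
    split (inj₁ le) = no-64 pos (begin
      64 * N² ≡⟨ sym (trans (cong (48 * N² +_) K-eq) (e₁ N²)) ⟩
      48 * N² + (K + 45 * (p + b)) ≡⟨ sym (+-assoc (48 * N²) K (45 * (p + b))) ⟩
      48 * N² + K + 45 * (p + b) ≤⟨ +-monoˡ-≤ (45 * (p + b)) le ⟩
      60 * p + 180 * b + 45 * (p + b) ≡⟨ e₃ p b ⟩
      105 * p + 225 * b ∎)
    go : 0 < p ⊎ 0 ≡ p → ⊥
    go (inj₁ 0<p) = split (divide-out (48 * N²) (180 * b) 60 K (3 * A) p 0<p 3A≤p scaled)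
    go (inj₂ 0≡p) = not-b-heavy pos 12 (e₄ N²) (e₅ b) (s≤s z≤n) (begin
      48 * N² ≤⟨ m≤m+n _ _ ⟩
      48 * N² + 90 * M ≤⟨ h ⟩
      180 * A + 180 * b ≡⟨ cong (λ A → 180 * A + 180 * b) (n≤0⇒n≡0 (≤-trans (m≤n*m A 3) (subst (3 * A ≤_) (sym 0≡p) 3A≤p))) ⟩
      180 * b ∎)

-- Here k and l count missing pairs between S and the other two parts and r counts ordered edges
-- inside S. The degree bound forces r ≤ k + l, so S recovers at most half of what the missing pairs
-- cost.
rest-arith : ∀ m E p q r k l N b → m ≡ N → 2 * (3 * suc (8 * m)) ≤ 90 * (2 * E + 2 * (p + q) + r) →
  (p + k) + (q + l) ≡ b → p + q + r ≤ b → 48 * N + 90 * (k + l) ≤ 180 * E + 180 * b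
rest-arith m E p q r k l N b refl h refl low = +-cancelʳ-≤ (90 * r + 6) _ _ (begin
  48 * m + 90 * (k + l) + (90 * r + 6) ≡⟨ e₁ m k l r ⟩
  2 * (3 * suc (8 * m)) + 90 * (k + l) + 90 * r ≤⟨ +-mono-≤ (+-monoˡ-≤ (90 * (k + l)) h) (*-monoʳ-≤ 90 r≤) ⟩
  90 * (2 * E + 2 * (p + q) + r) + 90 * (k + l) + 90 * (k + l) ≤⟨ m≤m+n _ 6 ⟩
  90 * (2 * E + 2 * (p + q) + r) + 90 * (k + l) + 90 * (k + l) + 6 ≡⟨ e₂ E p q r k l ⟩
  180 * E + 180 * (p + k + (q + l)) + (90 * r + 6) ∎)
  where
  open ≤-Reasoning
  e₁ : ∀ m k l r → 48 * m + 90 * (k + l) + (90 * r + 6) ≡ 2 * (3 * suc (8 * m)) + 90 * (k + l) + 90 * r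
  e₁ = solve-∀
  e₂ : ∀ E p q r k l → 90 * (2 * E + 2 * (p + q) + r) + 90 * (k + l) + 90 * (k + l) + 6 ≡ 180 * E + 180 * (p + k + (q + l)) + (90 * r + 6)
  e₂ = solve-∀
  e₃ : ∀ p q k l → p + k + (q + l) ≡ p + q + (k + l)
  e₃ = solve-∀
  r≤ : r ≤ k + l
  r≤ = +-cancelˡ-≤ (p + q) r (k + l) (subst (p + q + r ≤_) (e₃ p q k l) low)

no-common-arith : ∀ m A D p b N → m ≡ N → 4 * suc (8 * m) ≤ 90 * (A + D) → A ≤ p → D ≤ b → 3 * (p + b) ≤ N → ⊥
no-common-arith m A D p b N refl h A≤p D≤b 3≤ = absurd-≤ _ (≤-trans h
    (≤-trans (*-monoʳ-≤ 90 (+-mono-≤ A≤p D≤b)) (≤-trans (≤-reflexive (*-assoc 30 3 (p + b))) (*-monoʳ-≤ 30 3≤)))) (eq m)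
  where
  eq : ∀ m → 4 * suc (8 * m) ≡ 30 * m + suc (3 + 2 * m)
  eq = solve-∀

excess-arith : ∀ m A D J p b N K → m ≡ N → 4 * suc (8 * m) ≤ 90 * (A + D + J) → A ≤ p → D ≤ b →
  K + 45 * (p + b) ≡ 16 * N → K ≤ 45 * J
excess-arith m A D J p b N K refl h A≤p D≤b K-eq = *-cancelˡ-≤ 2 (+-cancelʳ-≤ (90 * (p + b)) _ _ (begin
  2 * K + 90 * (p + b) ≡⟨ e₁ K (p + b) ⟩
  2 * (K + 45 * (p + b)) ≡⟨ cong (2 *_) K-eq ⟩
  2 * (16 * m) ≤⟨ m≤m+n _ 4 ⟩
  2 * (16 * m) + 4 ≡⟨ e₂ m ⟩
  4 * suc (8 * m) ≤⟨ h ⟩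
  90 * (A + D + J) ≤⟨ *-monoʳ-≤ 90 (+-monoˡ-≤ J (+-mono-≤ A≤p D≤b)) ⟩
  90 * (p + b + J) ≡⟨ e₃ (p + b) J ⟩
  2 * (45 * J) + 90 * (p + b) ∎))
  where
  open ≤-Reasoning
  e₁ : ∀ K c → 2 * K + 90 * c ≡ 2 * (K + 45 * c)
  e₁ = solve-∀
  e₂ : ∀ m → 2 * (16 * m) + 4 ≡ 4 * suc (8 * m)
  e₂ = solve-∀
  e₃ : ∀ c J → 90 * (c + J) ≡ 2 * (45 * J) + 90 * c
  e₃ = solve-∀

transfer : ∀ {K c J E x z} → K ≤ c * J → J * E ≤ x * x * z → K * E ≤ c * (x * x * z)
transfer {K} {c} {J} {E} {x} {z} h₁ h₂ = begin
  K * E ≤⟨ *-monoˡ-≤ E h₁ ⟩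
  c * J * E ≡⟨ *-assoc c J E ⟩
  c * (J * E) ≤⟨ *-monoʳ-≤ c h₂ ⟩
  c * (x * x * z) ∎
  where open ≤-Reasoning

-- ∑∑ counts ordered pairs, so the degree condition 4n² < 45 d becomes 8n² < 45 t.
record Exceeds (m t : ℕ) : Set where
  constructor exceeds
  field bound : 8 * m < 45 * t
open Exceeds

-- Graphs without K₄ whose neighbourhoods span many edges.

tri : ∀ {n} → (Fin n → Fin n → Bool) → Fin n → Fin n → Fin n → Bool
tri g w a b = g a b ∧ (g a w ∧ g b w)

module DenseK₄Free {n : ℕ} (g : Fin n → Fin n → Bool) (g-comm : ∀ a b → g a b ≡ g b a)
  (k₄-free : ∀ {a b c d} → g a b ≡ true → g a c ≡ true → g a d ≡ true → g b c ≡ true → g b d ≡ true → g c d ≡ true → ⊥)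
  (dense : ∀ v → Exceeds (n * n) (∑∑ λ a b → ⟦ tri g v a b ⟧)) where

  open Cliques g g-comm using (#)

  V : Set
  V = Fin n

  infix 4 _∼_
  _∼_ : V → V → Set
  a ∼ b = g a b ≡ true

  ∼-sym : ∀ {a b} → a ∼ b → b ∼ a
  ∼-sym {a} {b} e = trans (g-comm b a) e

  Proper : (V → Bool) → (V → Bool) → Set
  Proper P c = ∀ {a b} → P a ≡ true → P b ≡ true → a ∼ b → c a ≢ c b

  TriangleFree : (V → Bool) → Set
  TriangleFree P = ∀ {a b c} → P a ≡ true → P b ≡ true → P c ≡ true → a ∼ b → a ∼ c → b ∼ c → ⊥

  tri-comm : ∀ w a b → tri g w a b ≡ tri g w b a
  tri-comm w a b = cong₂ _∧_ (g-comm a b) (∧-comm (g a w) (g b w))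

  tri-edge : ∀ {w a b} → tri g w a b ≡ true → a ∼ b
  tri-edge = ∧-left

  tri-left : ∀ {w a b} → tri g w a b ≡ true → a ∼ w
  tri-left {w} {a} {b} e = ∧-left (∧-right {g a b} e)

  tri-right : ∀ {w a b} → tri g w a b ≡ true → b ∼ w
  tri-right {w} {a} {b} e = ∧-right {g a w} (∧-right {g a b} e)

  tri-excl : ∀ {w w′ a b} → w ∼ w′ → tri g w a b ≡ true → tri g w′ a b ≡ true → ⊥
  tri-excl {w} {w′} {a} {b} ww′ e e′ =
    k₄-free (tri-edge {w} {a} e) (tri-left {w} {a} {b} e) (tri-left {w′} {a} {b} e′) (tri-right {w} {a} {b} e) (tri-right {w′} {a} {b} e′) ww′

  seen : List V → V → V → ℕ
  seen W a b = sumˡ (map (λ w → ⟦ tri g w a b ⟧) W)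

  seen-comm : ∀ W a b → seen W a b ≡ seen W b a
  seen-comm [] a b = refl
  seen-comm (w ∷ W) a b = cong₂ (λ p m → ⟦ p ⟧ + m) (tri-comm w a b) (seen-comm W a b)

  seen-none : ∀ W a b → g a b ≡ false → seen W a b ≡ 0
  seen-none [] a b e = refl
  seen-none (w ∷ W) a b e = cong₂ (λ p m → ⟦ p ∧ (g a w ∧ g b w) ⟧ + m) e (seen-none W a b e)

  seen-total : ∀ W → length W * suc (8 * (n * n)) ≤ 45 * ∑∑ (seen W)
  seen-total [] = z≤n
  seen-total (w ∷ W) = ≤-trans (+-mono-≤ (bound (dense w)) (seen-total W))
    (≤-reflexive (trans (sym (*-distribˡ-+ 45 (∑∑ λ a b → ⟦ tri g w a b ⟧) (∑∑ (seen W))))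
      (cong (45 *_) (sym (∑∑-+ (λ a b → ⟦ tri g w a b ⟧) (seen W))))))

  -- The number of edges in the neighbourhoods of the vertices of W is estimated edge by edge.
  Covered : ℕ → List V → (V → V → ℕ) → V → V → Set
  Covered k W f a b = k * seen W a b ≤ f a b + f b a

  weigh : ∀ k W f → (∀ a b → a ∼ b → Covered k W f a b ⊎ Covered k W f b a) →
    k * (length W * suc (8 * (n * n))) ≤ 90 * ∑∑ f
  weigh k W f cov = begin
    k * (length W * suc (8 * (n * n))) ≤⟨ *-monoʳ-≤ k (seen-total W) ⟩
    k * (45 * ∑∑ (seen W)) ≡⟨ arr k 45 (∑∑ (seen W)) ⟩
    45 * (k * ∑∑ (seen W)) ≡⟨ cong (45 *_) (sym (∑∑-* k (seen W))) ⟩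
    45 * ∑∑ (λ a b → k * seen W a b) ≤⟨ *-monoʳ-≤ 45 (∑∑-mono pt) ⟩
    45 * ∑∑ (λ a b → f a b + f b a) ≡⟨ cong (45 *_) (∑∑-symmetrise f) ⟩
    45 * (2 * ∑∑ f) ≡⟨ sym (*-assoc 45 2 (∑∑ f)) ⟩
    90 * ∑∑ f ∎
    where
    open ≤-Reasoning
    arr : ∀ a b c → a * (b * c) ≡ b * (a * c)
    arr = solve-∀
    pt : ∀ a b → Covered k W f a b
    pt a b with bool-cases (g a b)
    ... | inj₂ e = ≤-trans (≤-reflexive (trans (cong (k *_) (seen-none W a b e)) (*-zeroʳ k))) z≤n
    ... | inj₁ e with cov a b e
    ... | inj₁ c = c
    ... | inj₂ c = subst₂ _≤_ (cong (k *_) (seen-comm W b a)) (+-comm (f b a) (f a b)) c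

  degree-sum : (V → Bool) → ℕ
  degree-sum P = ∑∑ λ a b → ⟦ P a ∧ g a b ⟧

  #-complement : ∀ P → # P + # (not ∘ P) ≡ n
  #-complement P = trans (sym (∑-distrib-+ (⟦_⟧ ∘ P) (⟦_⟧ ∘ not ∘ P)))
    (trans (sum-cong-≗ λ a → one (P a)) (trans (sum-const n 1) (*-identityʳ n)))
    where
    one : ∀ p → ⟦ p ⟧ + ⟦ not p ⟧ ≡ 1
    one true = refl
    one false = refl

  -- A dense triangle-free set with small degrees outside is bipartite.

  module SparseOutside (N : V → Bool) (N-free : TriangleFree N)
    (N-dense : Exceeds (n * n) (∑∑ λ a b → ⟦ N a ∧ (N b ∧ g a b) ⟧))
    (outside : degree-sum (not ∘ N) ≤ # N * # (not ∘ N)) where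

    y x : ℕ
    y = # N
    x = # (not ∘ N)

    adj : List V → V → ℕ
    adj W s = sumˡ (map (λ w → ⟦ g s w ⟧) W)

    seen≤adj : ∀ W a b → seen W a b ≤ adj W a
    seen≤adj [] a b = z≤n
    seen≤adj (w ∷ W) a b = +-mono-≤ (⟦⟧-mono (tri-left {w} {a} {b})) (seen≤adj W a b)

    seen-inside : ∀ {W a b} → All (λ w → N w ≡ true) W → N a ≡ true → N b ≡ true → seen W a b ≤ 0
    seen-inside [] Na Nb = z≤n
    seen-inside {w ∷ W} {a} {b} (Nw ∷ NW) Na Nb = +-mono-≤
      (⟦⟧-false λ e → N-free Na Nb Nw (tri-edge {w} {a} e) (tri-left {w} {a} {b} e) (tri-right {w} {a} {b} e))
      (seen-inside NW Na Nb)

    -- An edge inside `N` is seen by no vertex of `N`. Any other edge is charged to its ends outside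
    -- `N`: weight k for each such end, plus the indicator of `R` at an end in `N`. The degrees
    -- outside `N` sum to at most yx, and the extra term to at most x times the size of `R`.
    pencil : ∀ k (R : V → Bool) W → All (λ w → N w ≡ true) W →
      (∀ s → N s ≡ true → adj W s ≤ k + ⟦ R s ⟧) → (∀ a b → seen W a b ≤ 2 * k) →
      length W * suc (8 * (n * n)) ≤ 90 * (k * (y * x) + x * # R)
    pencil k R W NW sees sees₂ = begin
      length W * suc (8 * (n * n)) ≡⟨ sym (*-identityˡ _) ⟩
      1 * (length W * suc (8 * (n * n))) ≤⟨ weigh 1 W f cov ⟩
      90 * ∑∑ f ≡⟨ cong (90 *_) (∑∑-+ (λ a b → k * ⟦ not (N a) ∧ g a b ⟧) λ a b → ⟦ not (N a) ⟧ * ⟦ R b ⟧) ⟩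
      90 * (∑∑ (λ a b → k * ⟦ not (N a) ∧ g a b ⟧) + ∑∑ λ a b → ⟦ not (N a) ⟧ * ⟦ R b ⟧)
        ≡⟨ cong (90 *_) (cong₂ _+_ (∑∑-* k λ a b → ⟦ not (N a) ∧ g a b ⟧) (∑∑-product (⟦_⟧ ∘ not ∘ N) (⟦_⟧ ∘ R))) ⟩
      90 * (k * degree-sum (not ∘ N) + x * # R) ≤⟨ *-monoʳ-≤ 90 (+-monoˡ-≤ (x * # R) (*-monoʳ-≤ k outside)) ⟩
      90 * (k * (y * x) + x * # R) ∎
      where
      open ≤-Reasoning
      f : V → V → ℕ
      f a b = k * ⟦ not (N a) ∧ g a b ⟧ + ⟦ not (N a) ⟧ * ⟦ R b ⟧
      f-out : ∀ {a b} → N a ≡ false → a ∼ b → k + ⟦ R b ⟧ ≤ f a b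
      f-out {a} {b} Na ab rewrite Na | ab = +-mono-≤ (≤-reflexive (sym (*-identityʳ k))) (≤-reflexive (sym (+-identityʳ _)))
      cov : ∀ a b → a ∼ b → Covered 1 W f a b ⊎ Covered 1 W f b a
      cov a b ab with bool-cases (N a) | bool-cases (N b)
      ... | inj₁ Na | inj₁ Nb = inj₁ (≤-trans (≤-reflexive (*-identityˡ _)) (≤-trans (seen-inside NW Na Nb) z≤n))
      ... | inj₁ Na | inj₂ Nb = inj₁ (≤-trans (≤-reflexive (*-identityˡ _))
              (≤-trans (seen≤adj W a b) (≤-trans (sees a Na) (≤-trans (f-out Nb (∼-sym ab)) (m≤n+m (f b a) (f a b))))))
      ... | inj₂ Na | inj₁ Nb = inj₂ (≤-trans (≤-reflexive (*-identityˡ _))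
              (≤-trans (seen≤adj W b a) (≤-trans (sees b Nb) (≤-trans (f-out Na ab) (m≤n+m (f a b) (f b a))))))
      ... | inj₂ Na | inj₂ Nb = inj₁ (≤-trans (≤-reflexive (*-identityˡ _))
              (≤-trans (sees₂ a b) (≤-trans (≤-reflexive (cong (k +_) (+-identityʳ k)))
                (+-mono-≤ (m+n≤o⇒m≤o k (f-out Na ab)) (m+n≤o⇒m≤o k (f-out Nb (∼-sym ab)))))))

    adj-excl : ∀ {s w w′} → N s ≡ true → N w ≡ true → N w′ ≡ true → w ∼ w′ → s ∼ w → s ∼ w′ → ⊥
    adj-excl Ns Nw Nw′ ww′ sw sw′ = N-free Ns Nw Nw′ sw sw′ ww′

    none : V → Bool
    none _ = false

    pencil₀ : ∀ k W → All (λ w → N w ≡ true) W →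
      (∀ s → N s ≡ true → adj W s ≤ k) → (∀ a b → seen W a b ≤ 2 * k) →
      length W * suc (8 * ((y + x) * (y + x))) ≤ 90 * (k * (y * x))
    pencil₀ k W NW sees sees₂ =
      subst₂ (λ m l → length W * suc (8 * (m * m)) ≤ 90 * l) (sym (#-complement N))
        (trans (cong (k * (y * x) +_) (trans (cong (x *_) (sum-zero n)) (*-zeroʳ x))) (+-identityʳ _))
        (pencil k none W NW (λ s Ns → ≤-trans (sees s Ns) (m≤m+n k 0)) sees₂)

    -- No vertex of `N` is joined to two of the three, so `pencil` applies with k = 1; an edge
    -- outside `N` is seen at most twice because w₁ and w₂ are adjacent.
    three-spread : ∀ {w₁ w₂ w₃} → N w₁ ≡ true → N w₂ ≡ true → N w₃ ≡ true → w₁ ∼ w₂ →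
      (∀ {s} → N s ≡ true → s ∼ w₁ → s ∼ w₃ → ⊥) → (∀ {s} → N s ≡ true → s ∼ w₂ → s ∼ w₃ → ⊥) → ⊥
    three-spread {w₁} {w₂} {w₃} N₁ N₂ N₃ w₁₂ no₁₃ no₂₃ = three-spread-⊥ x y
      (pencil₀ 1 (w₁ ∷ w₂ ∷ w₃ ∷ []) (N₁ ∷ N₂ ∷ N₃ ∷ []) sees sees₂)
      where
      sees : ∀ s → N s ≡ true → ⟦ g s w₁ ⟧ + (⟦ g s w₂ ⟧ + (⟦ g s w₃ ⟧ + 0)) ≤ 1
      sees s Ns rewrite +-identityʳ ⟦ g s w₃ ⟧ = ⟦⟧-excl₃ (adj-excl Ns N₁ N₂ w₁₂) (no₁₃ Ns) (no₂₃ Ns)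
      sees₂ : ∀ a b → ⟦ tri g w₁ a b ⟧ + (⟦ tri g w₂ a b ⟧ + (⟦ tri g w₃ a b ⟧ + 0)) ≤ 2
      sees₂ a b rewrite +-identityʳ ⟦ tri g w₃ a b ⟧ = ≤-trans (≤-reflexive (sym (+-assoc ⟦ tri g w₁ a b ⟧ _ _)))
        (+-mono-≤ (⟦⟧-excl₂ (tri-excl {w₁} {w₂} {a} {b} w₁₂)) (⟦⟧≤1 (tri g w₃ a b)))

    inner : V → V → Bool
    inner a b = N a ∧ (N b ∧ g a b)

    inner-comm : ∀ a b → inner a b ≡ inner b a
    inner-comm a b with N a | N b
    ... | true | true = g-comm a b
    ... | true | false = refl
    ... | false | true = refl
    ... | false | false = refl

    open EdgeAveraging inner inner-comm N ∧-left using (squares; cauchy-schwarz; heavy-edge) renaming (deg to d)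

    inner-heavy-edge : ∃[ u ] ∃[ v ] (inner u v ≡ true × 16 * (n * n) < 45 * y * (d u + d v))
    inner-heavy-edge = heavy-edge (45 * y) (16 * (n * n))
      (averaging-⊥ (n * n) (∑∑ λ a b → ⟦ inner a b ⟧) squares y (bound N-dense) cauchy-schwarz)

    module HeavyEdge (u v : V) (Nu : N u ≡ true) (Nv : N v ≡ true) (uv : u ∼ v)
      (big : 16 * (n * n) < 45 * y * (d u + d v)) where

      -- The only vertices of `N` that may be joined to both a and b in `five-cycle`; the choice of
      -- uv keeps this set small.
      R : V → Bool
      R s = N s ∧ (not (g s u) ∧ not (g s v))

      R-size : # R + (d u + d v) ≤ y
      R-size = begin
        # R + (d u + d v) ≡⟨ cong (# R +_) (sym (∑-distrib-+ (λ s → ⟦ inner u s ⟧) λ s → ⟦ inner v s ⟧)) ⟩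
        # R + sum (λ s → ⟦ inner u s ⟧ + ⟦ inner v s ⟧) ≡⟨ sym (∑-distrib-+ (⟦_⟧ ∘ R) λ s → ⟦ inner u s ⟧ + ⟦ inner v s ⟧) ⟩
        sum (λ s → ⟦ R s ⟧ + (⟦ inner u s ⟧ + ⟦ inner v s ⟧)) ≤⟨ sum-mono pt ⟩
        y ∎
        where
        open ≤-Reasoning
        pt : ∀ s → ⟦ R s ⟧ + (⟦ inner u s ⟧ + ⟦ inner v s ⟧) ≤ ⟦ N s ⟧
        pt s rewrite Nu | Nv | g-comm u s | g-comm v s with bool-cases (N s)
        ... | inj₂ Ns rewrite Ns = z≤n
        ... | inj₁ Ns rewrite Ns with bool-cases (g s u) | bool-cases (g s v)
        ... | inj₁ su | inj₁ sv = ⊥-elim (N-free Ns Nu Nv su sv uv)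
        ... | inj₁ su | inj₂ sv rewrite su | sv = ≤-refl
        ... | inj₂ su | inj₁ sv rewrite su | sv = ≤-refl
        ... | inj₂ su | inj₂ sv rewrite su | sv = ≤-refl

      -- In the 5-cycle r, a, u, v, b every vertex of `N` is joined to at most two, which gives y <
      -- 2x. Among a, r, b it is joined to at most one unless it lies in `R`: neighbours of u miss
      -- a, and neighbours of v miss b.
      five-cycle : ∀ {r a b} → N r ≡ true → N a ≡ true → N b ≡ true → a ∼ u → b ∼ v → r ∼ a → r ∼ b → ⊥
      five-cycle {r} {a} {b} Nr Na Nb au bv ra rb = five-cycle-⊥ x y (# R) (d u + d v) y<2x
        (subst (λ m → 3 * suc (8 * (m * m)) ≤ 90 * (1 * (y * x) + x * # R)) (sym (#-complement N)) three)
        (subst (λ m → 16 * (m * m) < 45 * y * (d u + d v)) (sym (#-complement N)) big) R-size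
        where
        excl : ∀ {w w′ s t} → w ∼ w′ → tri g w s t ≡ true → tri g w′ s t ≡ true → ⊥
        excl {w} {w′} {s} {t} = tri-excl {w} {w′} {s} {t}
        W : List V
        W = r ∷ a ∷ u ∷ v ∷ b ∷ []
        sees₅ : ∀ s → N s ≡ true → adj W s ≤ 2
        sees₅ s Ns rewrite +-identityʳ ⟦ g s b ⟧ = ⟦⟧-cycle₅ (adj-excl Ns Nr Na ra) (adj-excl Ns Na Nu au)
          (adj-excl Ns Nu Nv uv) (adj-excl Ns Nv Nb (∼-sym bv)) (adj-excl Ns Nb Nr (∼-sym rb))
        sees₅′ : ∀ s t → seen W s t ≤ 4
        sees₅′ s t rewrite +-identityʳ ⟦ tri g b s t ⟧ = ≤-trans (⟦⟧-cycle₅ (excl {r} {a} {s} {t} ra) (excl {a} {u} {s} {t} au)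
          (excl {u} {v} {s} {t} uv) (excl {v} {b} {s} {t} (∼-sym bv)) (excl {b} {r} {s} {t} (∼-sym rb))) (s≤s (s≤s z≤n))
        y<2x : y < 2 * x
        y<2x = five-cycle-< x y (pencil₀ 2 W (Nr ∷ Na ∷ Nu ∷ Nv ∷ Nb ∷ []) sees₅ sees₅′)
        W′ : List V
        W′ = a ∷ r ∷ b ∷ []
        sees₃ : ∀ s → N s ≡ true → adj W′ s ≤ 1 + ⟦ R s ⟧
        sees₃ s Ns rewrite +-identityʳ ⟦ g s b ⟧ with bool-cases (g s u) | bool-cases (g s v)
        ... | inj₁ su | _ = ≤-trans (+-mono-≤ (⟦⟧-false λ sa → adj-excl Ns Na Nu au sa su) (⟦⟧-excl₂ (adj-excl Ns Nr Nb rb))) (m≤m+n 1 _)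
        ... | inj₂ _ | inj₁ sv = ≤-trans (≤-reflexive (sym (+-assoc ⟦ g s a ⟧ ⟦ g s r ⟧ _)))
          (≤-trans (+-mono-≤ (⟦⟧-excl₂ (adj-excl Ns Na Nr (∼-sym ra))) (⟦⟧-false λ sb → adj-excl Ns Nb Nv bv sb sv)) (m≤m+n 1 _))
        ... | inj₂ su | inj₂ sv rewrite Ns | su | sv = +-mono-≤ (⟦⟧≤1 (g s a)) (⟦⟧-excl₂ (adj-excl Ns Nr Nb rb))
        sees₃′ : ∀ s t → seen W′ s t ≤ 2
        sees₃′ s t rewrite +-identityʳ ⟦ tri g b s t ⟧ = +-mono-≤ (⟦⟧≤1 (tri g a s t)) (⟦⟧-excl₂ (excl {r} {b} {s} {t} rb))
        three : 3 * suc (8 * (n * n)) ≤ 90 * (1 * (y * x) + x * # R)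
        three = pencil 1 R W′ (Na ∷ Nr ∷ Nb ∷ []) sees₃ sees₃′

      meets-v? : ∀ s → Dec (∃[ b ] (N b ≡ true × b ∼ v × s ∼ b))
      meets-v? s = any? λ b → (N b ≟ᵇ true) ×-dec ((g b v ≟ᵇ true) ×-dec (g s b ≟ᵇ true))

      -- The constructors record why a colour is given. A vertex joined to neither u nor v cannot
      -- touch both neighbourhoods, by `five-cycle`; it receives the colour of the neighbours of u
      -- exactly when it touches those of v.
      data Side (s : V) : Bool → Set where
        at-u : s ∼ u → Side s true
        meets : (b : V) → N b ≡ true → b ∼ v → s ∼ b → Side s true
        at-v : s ∼ v → Side s false
        misses : (∀ b → N b ≡ true → b ∼ v → s ∼ b → ⊥) → Side s false

      side : ∀ s → Σ Bool (Side s)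
      side s with bool-cases (g s u) | bool-cases (g s v) | meets-v? s
      ... | inj₁ su | _ | _ = true , at-u su
      ... | inj₂ _ | inj₁ sv | _ = false , at-v sv
      ... | inj₂ _ | inj₂ _ | yes (b , Nb , bv , sb) = true , meets b Nb bv sb
      ... | inj₂ _ | inj₂ _ | no h = false , misses λ b Nb bv sb → h (b , Nb , bv , sb)

      clash : ∀ {s t c} → N s ≡ true → N t ≡ true → s ∼ t → Side s c → Side t c → ⊥
      clash Ns Nt st (at-u su) (at-u tu) = N-free Ns Nt Nu st su tu
      clash Ns Nt st (at-u su) (meets b Nb bv tb) = five-cycle Nt Ns Nb su bv (∼-sym st) tb
      clash Ns Nt st (meets b Nb bv sb) (at-u tu) = five-cycle Ns Nt Nb tu bv st sb
      -- Both ends touch the neighbourhood of v, so neither has a common neighbour with u, and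
      -- `three-spread` applies to the edge and u. Two ends of kind `misses` are treated in the same
      -- way with v.
      clash Ns Nt st (meets b Nb bv sb) (meets b′ Nb′ bv′ tb′) = three-spread Ns Nt Nu st
        (λ Nr rs ru → five-cycle Ns Nr Nb ru bv (∼-sym rs) sb) (λ Nr rt ru → five-cycle Nt Nr Nb′ ru bv′ (∼-sym rt) tb′)
      clash Ns Nt st (at-v sv) (at-v tv) = N-free Ns Nt Nv st sv tv
      clash Ns Nt st (at-v sv) (misses h) = h _ Ns sv (∼-sym st)
      clash Ns Nt st (misses h) (at-v tv) = h _ Nt tv st
      clash Ns Nt st (misses h) (misses h′) = three-spread Ns Nt Nv st
        (λ Nr rs rv → h _ Nr rv (∼-sym rs)) (λ Nr rt rv → h′ _ Nr rv (∼-sym rt))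

      two-colouring : ∃ (Proper N)
      two-colouring = (proj₁ ∘ side) , λ {s} {t} Ns Nt st eq →
        clash Ns Nt st (proj₂ (side s)) (subst (Side t) (sym eq) (proj₂ (side t)))

    bipartite : ∃ (Proper N)
    bipartite = let u , v , e , big = inner-heavy-edge in
      HeavyEdge.two-colouring u v (∧-left e) (∧-left (∧-right {N u} e)) (∧-right {N v} (∧-right {N u} e)) big

  -- Two maximal disjoint independent sets and the rest.

  missing : (V → Bool) → (V → Bool) → ℕ
  missing S Y = ∑∑ λ a b → ⟦ S a ∧ (Y b ∧ not (g a b)) ⟧

  -- `meets-X` and `meets-Y` say that neither independent set can be enlarged by a vertex of `S`.
  -- `low` is what will be kept of a vertex of maximum degree with neighbourhood inside X ∪ Y.
  record Split (X Y S : V → Bool) : Set where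
    field
      partition : ∀ a → ⟦ X a ⟧ + ⟦ Y a ⟧ + ⟦ S a ⟧ ≡ 1
      X-independent : ∀ {a b} → X a ≡ true → X b ≡ true → a ∼ b → ⊥
      Y-independent : ∀ {a b} → Y a ≡ true → Y b ≡ true → a ∼ b → ⊥
      meets-X : ∀ {t} → S t ≡ true → ∃[ a ] (X a ≡ true × a ∼ t)
      meets-Y : ∀ {t} → S t ≡ true → ∃[ b ] (Y b ≡ true × b ∼ t)
      low : degree-sum S ≤ # S * (# X + # Y)

  swap : ∀ {X Y S} → Split X Y S → Split Y X S
  swap {X} {Y} {S} sp = record
    { partition = λ a → trans (cong (_+ ⟦ S a ⟧) (+-comm ⟦ Y a ⟧ ⟦ X a ⟧)) (partition a)
    ; X-independent = Y-independent ; Y-independent = X-independent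
    ; meets-X = meets-Y ; meets-Y = meets-X
    ; low = subst (λ m → degree-sum S ≤ # S * m) (+-comm (# X) (# Y)) low }
    where open Split sp

  module InSplit {X Y S : V → Bool} (sp : Split X Y S) where
    open Split sp

    x y s : ℕ
    x = # X
    y = # Y
    s = # S

    open Parts x y s using (N²; p; b; K; K-eq; 3[p+b]≤N²)

    cover : ∀ a → X a ≡ true ⊎ Y a ≡ true ⊎ S a ≡ true
    cover a = pick (X a) (Y a) (S a) (partition a)
      where
      pick : ∀ p q r → ⟦ p ⟧ + ⟦ q ⟧ + ⟦ r ⟧ ≡ 1 → p ≡ true ⊎ q ≡ true ⊎ r ≡ true
      pick true _ _ _ = inj₁ refl
      pick false true _ _ = inj₂ (inj₁ refl)
      pick false false true _ = inj₂ (inj₂ refl)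

    total : x + y + s ≡ n
    total = trans (cong (_+ s) (sym (∑-distrib-+ (⟦_⟧ ∘ X) (⟦_⟧ ∘ Y))))
      (trans (sym (∑-distrib-+ (λ a → ⟦ X a ⟧ + ⟦ Y a ⟧) (⟦_⟧ ∘ S)))
        (trans (sum-cong-≗ partition) (trans (sum-const n 1) (*-identityʳ n))))

    data Kind (a b : V) : Set where
      XY : X a ≡ true → Y b ≡ true → Kind a b
      XS : X a ≡ true → S b ≡ true → Kind a b
      YS : Y a ≡ true → S b ≡ true → Kind a b
      SS : S a ≡ true → S b ≡ true → Kind a b

    kind : ∀ a b → a ∼ b → Kind a b ⊎ Kind b a
    kind a b ab = go (cover a) (cover b)
      where
      go : X a ≡ true ⊎ Y a ≡ true ⊎ S a ≡ true → X b ≡ true ⊎ Y b ≡ true ⊎ S b ≡ true → Kind a b ⊎ Kind b a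
      go (inj₁ xa) (inj₁ xb) = ⊥-elim (X-independent xa xb ab)
      go (inj₁ xa) (inj₂ (inj₁ yb)) = inj₁ (XY xa yb)
      go (inj₁ xa) (inj₂ (inj₂ sb)) = inj₁ (XS xa sb)
      go (inj₂ (inj₁ ya)) (inj₁ xb) = inj₂ (XY xb ya)
      go (inj₂ (inj₁ ya)) (inj₂ (inj₁ yb)) = ⊥-elim (Y-independent ya yb ab)
      go (inj₂ (inj₁ ya)) (inj₂ (inj₂ sb)) = inj₁ (YS ya sb)
      go (inj₂ (inj₂ sa)) (inj₁ xb) = inj₂ (XS xb sa)
      go (inj₂ (inj₂ sa)) (inj₂ (inj₁ yb)) = inj₂ (YS yb sa)
      go (inj₂ (inj₂ sa)) (inj₂ (inj₂ sb)) = inj₁ (SS sa sb)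

    weigh-kinds : ∀ k W f → (∀ a b → a ∼ b → Kind a b → Covered k W f a b) → k * (length W * suc (8 * (n * n))) ≤ 90 * ∑∑ f
    weigh-kinds k W f cov = weigh k W f λ a b ab → go a b ab (kind a b ab)
      where
      go : ∀ a b → a ∼ b → Kind a b ⊎ Kind b a → Covered k W f a b ⊎ Covered k W f b a
      go a b ab (inj₁ q) = inj₁ (cov a b ab q)
      go a b ab (inj₂ q) = inj₂ (cov b a (∼-sym ab) q)

    -- Pairs are oriented with the end in `X` first, so `E` and `J` count each edge once, whereas
    -- `D` counts edges inside `S` twice.
    e j : V → V → V → ℕ
    e t a b = ⟦ X a ∧ (Y b ∧ tri g t a b) ⟧
    j t a b = ⟦ X a ∧ (S b ∧ tri g t a b) ⟧

    E J : V → ℕ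
    E t = ∑∑ (e t)
    J t = ∑∑ (j t)

    D : ℕ
    D = degree-sum S

    o : V → V → ℕ
    o a b = ⟦ S a ∧ g a b ⟧

    tri≤e : ∀ t {a b} → X a ≡ true → Y b ≡ true → ⟦ tri g t a b ⟧ ≤ e t a b
    tri≤e t xa yb = ⟦⟧-mono λ h → ∧-true xa (∧-true yb h)

    tri≤j : ∀ t {a b} → X a ≡ true → S b ≡ true → ⟦ tri g t a b ⟧ ≤ j t a b
    tri≤j t xa sb = ⟦⟧-mono λ h → ∧-true xa (∧-true sb h)

    1≤o : ∀ {a b} → S a ≡ true → a ∼ b → 1 ≤ o a b
    1≤o sa ab = ⟦⟧-true (∧-true sa ab)

    X-blind : ∀ {w a b} → X w ≡ true → X a ≡ true → ⟦ tri g w a b ⟧ ≤ 0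
    X-blind {w} {a} {b} xw xa = ⟦⟧-false λ h → X-independent xa xw (tri-left {w} {a} {b} h)

    Y-blindˡ : ∀ {w a b} → Y w ≡ true → Y a ≡ true → ⟦ tri g w a b ⟧ ≤ 0
    Y-blindˡ {w} {a} {b} yw ya = ⟦⟧-false λ h → Y-independent ya yw (tri-left {w} {a} {b} h)

    Y-blindʳ : ∀ {w a b} → Y w ≡ true → Y b ≡ true → ⟦ tri g w a b ⟧ ≤ 0
    Y-blindʳ {w} {a} {b} yw yb = ⟦⟧-false λ h → Y-independent yb yw (tri-right {w} {a} {b} h)

    excl₂ : ∀ {w w′} a b → w ∼ w′ → ⟦ tri g w a b ⟧ + ⟦ tri g w′ a b ⟧ ≤ 1
    excl₂ {w} {w′} a b ww′ = ⟦⟧-excl₂ (tri-excl {w} {w′} {a} {b} ww′)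

    excl₃ : ∀ {w w′ w″} a b → w ∼ w′ → w ∼ w″ → w′ ∼ w″ → ⟦ tri g w a b ⟧ + (⟦ tri g w′ a b ⟧ + ⟦ tri g w″ a b ⟧) ≤ 1
    excl₃ {w} {w′} {w″} a b p q r = ⟦⟧-excl₃ (tri-excl {w} {w′} {a} {b} p) (tri-excl {w} {w″} {a} {b} q) (tri-excl {w′} {w″} {a} {b} r)

    -- An edge inside S counts twice in D, so it may be seen twice.
    weigh-parts : ∀ W (f h : V → V → ℕ) →
      (∀ {a b} → X a ≡ true → Y b ≡ true → seen W a b ≤ f a b) →
      (∀ {a b} → X a ≡ true → S b ≡ true → seen W a b ≤ 1 + h a b) →
      (∀ {a b} → Y a ≡ true → S b ≡ true → seen W a b ≤ 1) →
      (∀ a b → seen W a b ≤ 2) →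
      length W * suc (8 * (n * n)) ≤ 90 * (∑∑ f + D + ∑∑ h)
    weigh-parts W f h hXY hXS hYS hSS = subst₂ _≤_ (*-identityˡ _)
      (cong (90 *_) (trans (∑∑-+ (λ a b → f a b + o a b) h) (cong (_+ ∑∑ h) (∑∑-+ f o))))
      (weigh-kinds 1 W F cov)
      where
      F : V → V → ℕ
      F a b = f a b + o a b + h a b
      o≤F : ∀ a b → o a b ≤ F a b
      o≤F a b = ≤-trans (m≤n+m (o a b) (f a b)) (m≤m+n _ (h a b))
      cov : ∀ a b → a ∼ b → Kind a b → Covered 1 W F a b
      cov a b ab k = ≤-trans (≤-reflexive (*-identityˡ _)) (go k)
        where
        go : Kind a b → seen W a b ≤ F a b + F b a
        go (XY xa yb) = ≤-trans (hXY xa yb) (≤-trans (≤-trans (m≤m+n (f a b) (o a b)) (m≤m+n _ (h a b))) (m≤m+n (F a b) (F b a)))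
        go (XS xa sb) = ≤-trans (hXS xa sb) (≤-trans (≤-reflexive (+-comm 1 (h a b)))
          (+-mono-≤ (m≤n+m (h a b) (f a b + o a b)) (≤-trans (1≤o sb (∼-sym ab)) (o≤F b a))))
        go (YS ya sb) = ≤-trans (hYS ya sb) (≤-trans (≤-trans (1≤o sb (∼-sym ab)) (o≤F b a)) (m≤n+m (F b a) (F a b)))
        go (SS sa sb) = ≤-trans (hSS a b) (+-mono-≤ (≤-trans (1≤o sa ab) (o≤F a b)) (≤-trans (1≤o sb (∼-sym ab)) (o≤F b a)))

    see : V → V → V → ℕ
    see w a b = ⟦ tri g w a b ⟧

    zero₂ : V → V → ℕ
    zero₂ _ _ = 0

    ∑∑-zero : ∀ m → m + ∑∑ zero₂ ≡ m
    ∑∑-zero m = trans (cong (m +_) (∑∑-zeros n)) (+-identityʳ m)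

    -- Neither a₀ nor b₀ sees an edge between `X` and `Y`, so these are paid for by `E t` alone. Of
    -- an edge from `X` to `S`, a₀ sees nothing and only one of t, b₀ can see it; likewise for `Y`.
    triple : ∀ {t a₀ b₀} → X a₀ ≡ true → Y b₀ ≡ true → a₀ ∼ t → b₀ ∼ t → 3 * suc (8 * (n * n)) ≤ 90 * (E t + D)
    triple {t} {a₀} {b₀} xa₀ yb₀ at bt = subst (λ m → 3 * suc (8 * (n * n)) ≤ 90 * m) (∑∑-zero (E t + D))
      (weigh-parts (t ∷ a₀ ∷ b₀ ∷ []) (e t) zero₂
        (λ {a} {b} xa yb → le (arr₂ (see t a b) (see a₀ a b) (see b₀ a b)) (+-mono-≤ (+-mono-≤ (tri≤e t xa yb) (X-blind {a₀} {a} {b} xa₀ xa)) (Y-blindʳ {b₀} {a} {b} yb₀ yb)) (trans (+-identityʳ _) (+-identityʳ _)))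
        (λ {a} {b} xa sb → le (arr₁ (see t a b) _ _) (+-mono-≤ (excl₂ a b (∼-sym bt)) (X-blind xa₀ xa)) refl)
        (λ {a} {b} ya sb → le (arr₂ (see t a b) _ _) (+-mono-≤ (excl₂ a b (∼-sym at)) (Y-blindˡ yb₀ ya)) refl)
        (λ a b → le (arr₂ (see t a b) _ _) (+-mono-≤ (excl₂ a b (∼-sym at)) (⟦⟧≤1 (tri g b₀ a b))) refl))
      where
      le : ∀ {i j k l} → i ≡ j → j ≤ k → k ≡ l → i ≤ l
      le refl h refl = h
      arr₁ : ∀ p q r → p + (q + (r + 0)) ≡ p + r + q
      arr₁ = solve-∀
      arr₂ : ∀ p q r → p + (q + (r + 0)) ≡ p + q + r
      arr₂ = solve-∀

    -- Were `E t` zero, three neighbourhoods with more than 12n²/45 edges in all would have to fit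
    -- into D ≤ s(x + y) ≤ n²/4.
    sees-edge : ∀ {t} → S t ≡ true → ∃[ a ] ∃[ b ] (X a ≡ true × Y b ≡ true × a ∼ t × b ∼ t × a ∼ b)
    sees-edge {t} st = let a₀ , xa₀ , at = meets-X st ; b₀ , yb₀ , bt = meets-Y st
                           a , b , pos = ∑∑-pos (e t) (decidable-stable (0 <? E t) (nonzero (triple xa₀ yb₀ at bt)))
                           h = ⟦⟧-pos pos ; r = ∧-right {Y b} (∧-right {X a} h)
                       in a , b , ∧-left h , ∧-left (∧-right {X a} h) , tri-left {t} {a} {b} r , tri-right {t} {a} {b} r , tri-edge {t} {a} r
      where
      nonzero : 3 * suc (8 * (n * n)) ≤ 90 * (E t + D) → ¬ (0 < E t) → ⊥
      nonzero h ¬0<E = three-spread-⊥ s (x + y) (subst (λ m → 3 * suc (8 * (m * m)) ≤ 90 * (1 * ((x + y) * s))) (sym total)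
        (≤-trans h (*-monoʳ-≤ 90 (≤-trans (+-mono-≤ (≮⇒≥ ¬0<E) low) (≤-reflexive (trans (*-comm s (x + y)) (sym (*-identityˡ _))))))))

    bs : (V → Bool) → V → V → ℕ
    bs P a b = ⟦ S a ∧ (P b ∧ g a b) ⟧

    D-split : D ≡ ∑∑ (bs X) + ∑∑ (bs Y) + ∑∑ (bs S)
    D-split = trans (∑∑-cong λ a b → pt (S a) (g a b) (X b) (Y b) (S b) (partition b))
      (trans (∑∑-+ (λ a b → bs X a b + bs Y a b) (bs S)) (cong (_+ ∑∑ (bs S)) (∑∑-+ (bs X) (bs Y))))
      where
      pt : ∀ s g p q r → ⟦ p ⟧ + ⟦ q ⟧ + ⟦ r ⟧ ≡ 1 → ⟦ s ∧ g ⟧ ≡ ⟦ s ∧ (p ∧ g) ⟧ + ⟦ s ∧ (q ∧ g) ⟧ + ⟦ s ∧ (r ∧ g) ⟧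
      pt false g p q r _ = refl
      pt true g true false false _ = sym (trans (+-identityʳ _) (+-identityʳ _))
      pt true g false true false _ = sym (+-identityʳ _)
      pt true g false false true _ = refl

    bs+missing : ∀ P → ∑∑ (bs P) + missing S P ≡ s * # P
    bs+missing P = trans (sym (∑∑-+ (bs P) λ a b → ⟦ S a ∧ (P b ∧ not (g a b)) ⟧))
      (trans (∑∑-cong λ a b → pt (S a) (P b) (g a b)) (∑∑-product (⟦_⟧ ∘ S) (⟦_⟧ ∘ P)))
      where
      pt : ∀ s p g → ⟦ s ∧ (p ∧ g) ⟧ + ⟦ s ∧ (p ∧ not g) ⟧ ≡ ⟦ s ⟧ * ⟦ p ⟧
      pt false p g = refl
      pt true false g = refl
      pt true true true = refl
      pt true true false = refl

    M : ℕ
    M = missing S X + missing S Y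

    -- Now t, a₀, b₀ are mutually adjacent, so no edge is seen twice. An edge inside `S`, present in
    -- both orders, then needs only half the weight of the others, hence the overall factor 2.
    triangle-weight : ∀ {t a₀ b₀} → X a₀ ≡ true → Y b₀ ≡ true → a₀ ∼ t → b₀ ∼ t → a₀ ∼ b₀ →
      2 * (3 * suc (8 * (n * n))) ≤ 90 * (2 * E t + 2 * (∑∑ (bs X) + ∑∑ (bs Y)) + ∑∑ (bs S))
    triangle-weight {t} {a₀} {b₀} xa₀ yb₀ at bt ab₀ = subst (λ m → 2 * (3 * suc (8 * (n * n))) ≤ 90 * m) sum-eq
      (weigh-kinds 2 W f cov)
      where
      W : List V
      W = t ∷ a₀ ∷ b₀ ∷ []
      f : V → V → ℕ
      f a b = 2 * e t a b + 2 * (bs X a b + bs Y a b) + bs S a b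
      sum-eq : ∑∑ f ≡ 2 * E t + 2 * (∑∑ (bs X) + ∑∑ (bs Y)) + ∑∑ (bs S)
      sum-eq = trans (∑∑-+ (λ a b → 2 * e t a b + 2 * (bs X a b + bs Y a b)) (bs S)) (cong (_+ ∑∑ (bs S))
        (trans (∑∑-+ (λ a b → 2 * e t a b) (λ a b → 2 * (bs X a b + bs Y a b)))
          (cong₂ _+_ (∑∑-* 2 (e t)) (trans (∑∑-* 2 λ a b → bs X a b + bs Y a b) (cong (2 *_) (∑∑-+ (bs X) (bs Y)))))))
      sees≤1 : ∀ a b → seen W a b ≤ 1
      sees≤1 a b = ≤-trans (≤-reflexive (cong (λ m → see t a b + (see a₀ a b + m)) (+-identityʳ _))) (excl₃ a b (∼-sym at) (∼-sym bt) ab₀)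
      2≤f : ∀ a b {m} → 1 ≤ m → m ≤ bs X a b + bs Y a b → 2 ≤ f a b
      2≤f a b 1≤m m≤ = ≤-trans (*-monoʳ-≤ 2 (≤-trans 1≤m m≤)) (≤-trans (m≤n+m _ (2 * e t a b)) (m≤m+n _ (bs S a b)))
      1≤bs : ∀ {P a b} → S a ≡ true → P b ≡ true → a ∼ b → 1 ≤ bs P a b
      1≤bs sa pb ab = ⟦⟧-true (∧-true sa (∧-true pb ab))
      1≤f : ∀ {a b} → S a ≡ true → S b ≡ true → a ∼ b → 1 ≤ f a b
      1≤f {a} {b} sa sb ab = ≤-trans (1≤bs {S} sa sb ab) (m≤n+m (bs S a b) (2 * e t a b + 2 * (bs X a b + bs Y a b)))
      cov : ∀ a b → a ∼ b → Kind a b → Covered 2 W f a b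
      cov a b ab (XY xa yb) = ≤-trans (*-monoʳ-≤ 2 (≤-trans
        (+-mono-≤ (tri≤e t xa yb) (+-mono-≤ (X-blind xa₀ xa) (+-mono-≤ (Y-blindʳ {b₀} {a} {b} yb₀ yb) z≤n))) (≤-reflexive (+-identityʳ _))))
        (≤-trans (≤-trans (m≤m+n (2 * e t a b) (2 * (bs X a b + bs Y a b))) (m≤m+n _ (bs S a b))) (m≤m+n _ (f b a)))
      cov a b ab (XS xa sb) = ≤-trans (*-monoʳ-≤ 2 (sees≤1 a b))
        (≤-trans (2≤f b a (1≤bs {X} sb xa (∼-sym ab)) (m≤m+n (bs X b a) (bs Y b a))) (m≤n+m (f b a) (f a b)))
      cov a b ab (YS ya sb) = ≤-trans (*-monoʳ-≤ 2 (sees≤1 a b))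
        (≤-trans (2≤f b a (1≤bs {Y} sb ya (∼-sym ab)) (m≤n+m (bs Y b a) (bs X b a))) (m≤n+m (f b a) (f a b)))
      cov a b ab (SS sa sb) = ≤-trans (*-monoʳ-≤ 2 (sees≤1 a b))
        (+-mono-≤ (1≤f sa sb ab) (1≤f sb sa (∼-sym ab)))

    -- To be read as a lower bound on `E t` that grows by half of the number of missing pairs.
    rest-bound : ∀ {t} → S t ≡ true → 48 * N² + 90 * M ≤ 180 * E t + 180 * b
    rest-bound {t} st = let a , b′ , xa , yb , at , bt , ab = sees-edge st in
      rest-arith (n * n) (E t) (∑∑ (bs X)) (∑∑ (bs Y)) (∑∑ (bs S)) (missing S X) (missing S Y) N² b
        (cong (λ m → m * m) (sym total)) (triangle-weight xa yb at bt ab)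
        (trans (cong₂ _+_ (bs+missing X) (bs+missing Y)) (sym (*-distribˡ-+ s x y)))
        (subst (_≤ b) D-split low)

    share₂ : ∀ {t t′} → t ∼ t′ → ∑∑ (λ a b → e t a b + e t′ a b) ≤ p
    share₂ {t} {t′} tt′ = flip ≤-trans (≤-reflexive (∑∑-product (⟦_⟧ ∘ X) (⟦_⟧ ∘ Y)))
      (∑∑-mono λ a b → pt (X a) (Y b) (tri g t a b) (tri g t′ a b) (excl₂ a b tt′))
      where
      pt : ∀ p q r r′ → ⟦ r ⟧ + ⟦ r′ ⟧ ≤ 1 → ⟦ p ∧ (q ∧ r) ⟧ + ⟦ p ∧ (q ∧ r′) ⟧ ≤ ⟦ p ⟧ * ⟦ q ⟧
      pt false q r r′ h = z≤n
      pt true false r r′ h = z≤n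
      pt true true r r′ h = h

    share₃ : ∀ {t₁ t₂ t₃} → t₁ ∼ t₂ → t₁ ∼ t₃ → t₂ ∼ t₃ → ∑∑ (λ a b → e t₁ a b + (e t₂ a b + e t₃ a b)) ≤ p
    share₃ {t₁} {t₂} {t₃} t₁₂ t₁₃ t₂₃ = flip ≤-trans (≤-reflexive (∑∑-product (⟦_⟧ ∘ X) (⟦_⟧ ∘ Y)))
      (∑∑-mono λ a b → pt (X a) (Y b) (tri g t₁ a b) (tri g t₂ a b) (tri g t₃ a b) (excl₃ a b t₁₂ t₁₃ t₂₃))
      where
      pt : ∀ p q r r′ r″ → ⟦ r ⟧ + (⟦ r′ ⟧ + ⟦ r″ ⟧) ≤ 1 →
        ⟦ p ∧ (q ∧ r) ⟧ + (⟦ p ∧ (q ∧ r′) ⟧ + ⟦ p ∧ (q ∧ r″) ⟧) ≤ ⟦ p ⟧ * ⟦ q ⟧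
      pt false q r r′ r″ h = z≤n
      pt true false r r′ r″ h = z≤n
      pt true true r r′ r″ h = h

    n²≡N² : n * n ≡ N²
    n²≡N² = cong (λ m → m * m) (sym total)

    squeeze : ∀ {i j k} → i ≡ j → j ≤ k → i ≤ k
    squeeze refl h = h

    four₁ : ∀ p q r s → p + (q + (r + (s + 0))) ≡ p + q + (r + s)
    four₁ = solve-∀
    four₂ : ∀ p q r s → p + (q + (r + (s + 0))) ≡ p + (q + s) + r
    four₂ = solve-∀
    four₃ : ∀ p q r s → p + (q + (r + (s + 0))) ≡ p + (q + r) + s
    four₃ = solve-∀
    four₄ : ∀ p q r s → p + (q + (r + (s + 0))) ≡ p + s + q + r
    four₄ = solve-∀
    four₅ : ∀ p q r s → p + (q + (r + (s + 0))) ≡ p + s + (q + r)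
    four₅ = solve-∀

    -- With t and t′, either of a₀, b₀ forms a triangle, while a₀ is blind to edges at `X` and b₀ to
    -- edges at `Y`. So four neighbourhoods, more than 16n²/45 edges, would fit into p + b ≤ n²/3.
    no-common : ∀ {t t′ a₀ b₀} → t ∼ t′ → X a₀ ≡ true → a₀ ∼ t → a₀ ∼ t′ → Y b₀ ≡ true → b₀ ∼ t → b₀ ∼ t′ → ⊥
    no-common {t} {t′} {a₀} {b₀} tt′ xa₀ at at′ yb₀ bt bt′ = no-common-arith (n * n) (∑∑ λ a b → e t a b + e t′ a b) D p b N² n²≡N²
      (subst (λ m → 4 * suc (8 * (n * n)) ≤ 90 * m) (∑∑-zero ((∑∑ λ a b → e t a b + e t′ a b) + D))
        (weigh-parts (t ∷ t′ ∷ a₀ ∷ b₀ ∷ []) (λ a b → e t a b + e t′ a b) zero₂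
          (λ {a} {b} xa yb → squeeze (four₁ (see t a b) (see t′ a b) (see a₀ a b) (see b₀ a b)) (≤-trans (+-mono-≤ (+-mono-≤ (tri≤e t xa yb) (tri≤e t′ xa yb))
            (+-mono-≤ (X-blind {a₀} {a} {b} xa₀ xa) (Y-blindʳ {b₀} {a} {b} yb₀ yb))) (≤-reflexive (+-identityʳ _))))
          (λ {a} {b} xa sb → squeeze (four₂ (see t a b) (see t′ a b) (see a₀ a b) (see b₀ a b)) (+-mono-≤ (excl₃ a b tt′ (∼-sym bt) (∼-sym bt′)) (X-blind {a₀} {a} {b} xa₀ xa)))
          (λ {a} {b} ya sb → squeeze (four₃ (see t a b) (see t′ a b) (see a₀ a b) (see b₀ a b)) (+-mono-≤ (excl₃ a b tt′ (∼-sym at) (∼-sym at′)) (Y-blindˡ {b₀} {a} {b} yb₀ ya)))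
          (λ a b → squeeze (four₃ (see t a b) (see t′ a b) (see a₀ a b) (see b₀ a b)) (+-mono-≤ (excl₃ a b tt′ (∼-sym at) (∼-sym at′)) (⟦⟧≤1 (tri g b₀ a b))))))
      (share₂ tt′) low 3[p+b]≤N²

    -- Here b₀ is joined to t only, so t′ may see an edge from `X` to `S` a second time. Four
    -- neighbourhoods exceed p + b by at least K/45, and these second sightings must account for the
    -- surplus.
    pair-excess : ∀ {t t′ a₀} → S t ≡ true → t ∼ t′ → X a₀ ≡ true → a₀ ∼ t → a₀ ∼ t′ → K ≤ 45 * J t′
    pair-excess {t} {t′} {a₀} st tt′ xa₀ at at′ = let b₀ , yb₀ , bt = meets-Y st in
      excess-arith (n * n) (∑∑ λ a b → e t a b + e t′ a b) D (J t′) p b N² K n²≡N²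
        (weigh-parts (t ∷ t′ ∷ a₀ ∷ b₀ ∷ []) (λ a b → e t a b + e t′ a b) (j t′)
          (λ {a} {b} xa yb → squeeze (four₁ (see t a b) (see t′ a b) (see a₀ a b) (see b₀ a b)) (≤-trans (+-mono-≤ (+-mono-≤ (tri≤e t xa yb) (tri≤e t′ xa yb))
            (+-mono-≤ (X-blind {a₀} {a} {b} xa₀ xa) (Y-blindʳ {b₀} {a} {b} yb₀ yb))) (≤-reflexive (+-identityʳ _))))
          (λ {a} {b} xa sb → squeeze (four₄ (see t a b) (see t′ a b) (see a₀ a b) (see b₀ a b)) (≤-trans (+-mono-≤ (+-mono-≤ (excl₂ a b (∼-sym bt)) (tri≤j t′ xa sb))
            (X-blind {a₀} {a} {b} xa₀ xa)) (≤-reflexive (+-identityʳ _))))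
          (λ {a} {b} ya sb → squeeze (four₃ (see t a b) (see t′ a b) (see a₀ a b) (see b₀ a b)) (+-mono-≤ (excl₃ a b tt′ (∼-sym at) (∼-sym at′)) (Y-blindˡ {b₀} {a} {b} yb₀ ya)))
          (λ a b → squeeze (four₃ (see t a b) (see t′ a b) (see a₀ a b) (see b₀ a b)) (+-mono-≤ (excl₃ a b tt′ (∼-sym at) (∼-sym at′)) (⟦⟧≤1 (tri g b₀ a b)))))
        (share₂ tt′) low K-eq

    -- As in `pair-excess`; both t₂ and t₃ may now repeat what t₁ or b₀ sees between `X` and `S`.
    triangle-excess : ∀ {t₁ t₂ t₃} → S t₁ ≡ true → t₁ ∼ t₂ → t₁ ∼ t₃ → t₂ ∼ t₃ → K ≤ 45 * (J t₂ + J t₃)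
    triangle-excess {t₁} {t₂} {t₃} st₁ t₁₂ t₁₃ t₂₃ = let b₀ , yb₀ , bt = meets-Y st₁ in
      subst (λ m → K ≤ 45 * m) (∑∑-+ (j t₂) (j t₃))
      (excess-arith (n * n) (∑∑ λ a b → e t₁ a b + (e t₂ a b + e t₃ a b)) D (∑∑ λ a b → j t₂ a b + j t₃ a b) p b N² K n²≡N²
        (weigh-parts (t₁ ∷ t₂ ∷ t₃ ∷ b₀ ∷ []) (λ a b → e t₁ a b + (e t₂ a b + e t₃ a b)) (λ a b → j t₂ a b + j t₃ a b)
          (λ {a} {b} xa yb → squeeze (four₃ (see t₁ a b) (see t₂ a b) (see t₃ a b) (see b₀ a b)) (≤-trans (+-mono-≤ (+-mono-≤ (tri≤e t₁ xa yb) (+-mono-≤ (tri≤e t₂ xa yb) (tri≤e t₃ xa yb)))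
            (Y-blindʳ {b₀} {a} {b} yb₀ yb)) (≤-reflexive (+-identityʳ _))))
          (λ {a} {b} xa sb → squeeze (four₅ (see t₁ a b) (see t₂ a b) (see t₃ a b) (see b₀ a b)) (+-mono-≤ (excl₂ a b (∼-sym bt)) (+-mono-≤ (tri≤j t₂ xa sb) (tri≤j t₃ xa sb))))
          (λ {a} {b} ya sb → squeeze (four₃ (see t₁ a b) (see t₂ a b) (see t₃ a b) (see b₀ a b)) (+-mono-≤ (excl₃ a b t₁₂ t₁₃ t₂₃) (Y-blindˡ {b₀} {a} {b} yb₀ ya)))
          (λ a b → squeeze (four₃ (see t₁ a b) (see t₂ a b) (see t₃ a b) (see b₀ a b)) (+-mono-≤ (excl₃ a b t₁₂ t₁₃ t₂₃) (⟦⟧≤1 (tri g b₀ a b)))))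
        (share₃ t₁₂ t₁₃ t₂₃) low K-eq)

    -- If τ ∈ S is linked to t then, by no-common, every pair of τ and a neighbour of t in Y is missing.
    linked? : ∀ t τ → Dec (∃[ σ ] (X σ ≡ true × σ ∼ t × σ ∼ τ))
    linked? t τ = any? λ σ → (X σ ≟ᵇ true) ×-dec ((g σ t ≟ᵇ true) ×-dec (g σ τ ≟ᵇ true))

    linked nearX nearY : V → V → Bool
    linked t τ = S τ ∧ (g τ t ∧ does (linked? t τ))
    nearX t σ = X σ ∧ g σ t
    nearY t σ = Y σ ∧ g σ t

    lost : V → ℕ
    lost t = # (linked t) * # (nearY t)

    -- Edges counted by `J t` run from `nearX t` to `linked t`, those counted by `E t` from
    -- `nearX t` to `nearY t`; multiplying the two rectangle bounds produces `lost t`.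
    J*E≤ : ∀ t → J t * E t ≤ x * x * lost t
    J*E≤ t = begin
      J t * E t ≤⟨ *-mono-≤ J≤ E≤ ⟩
      # (nearX t) * # (linked t) * (# (nearX t) * # (nearY t)) ≡⟨ arr (# (nearX t)) (# (linked t)) (# (nearY t)) ⟩
      # (nearX t) * # (nearX t) * lost t ≤⟨ *-monoˡ-≤ (lost t) (*-mono-≤ nearX≤x nearX≤x) ⟩
      x * x * lost t ∎
      where
      open ≤-Reasoning
      arr : ∀ i j k → i * j * (i * k) ≡ i * i * (j * k)
      arr = solve-∀
      nearX≤x : # (nearX t) ≤ x
      nearX≤x = sum-mono λ σ → ⟦⟧-∧≤ (X σ) (g σ t)
      both : ∀ p q {r} → (r ≡ true → p ≡ true) → (r ≡ true → q ≡ true) → ⟦ r ⟧ ≤ ⟦ p ⟧ * ⟦ q ⟧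
      both p q hp hq = ≤-trans (⟦⟧-mono λ h → ∧-true (hp h) (hq h)) (≤-reflexive (⟦⟧-∧ p q))
      E≤ : E t ≤ # (nearX t) * # (nearY t)
      E≤ = ≤-trans (∑∑-mono λ a b → both (nearX t a) (nearY t b) {X a ∧ (Y b ∧ tri g t a b)}
          (λ h → ∧-true (∧-left h) (tri-left {t} {a} {b} (∧-right {Y b} (∧-right {X a} h))))
          (λ h → ∧-true (∧-left (∧-right {X a} h)) (tri-right {t} {a} {b} (∧-right {Y b} (∧-right {X a} h)))))
        (≤-reflexive (∑∑-product (⟦_⟧ ∘ nearX t) (⟦_⟧ ∘ nearY t)))
      J≤ : J t ≤ # (nearX t) * # (linked t)
      J≤ = ≤-trans (∑∑-mono λ a b → both (nearX t a) (linked t b) {X a ∧ (S b ∧ tri g t a b)}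
          (λ h → ∧-true (∧-left h) (tri-left {t} {a} {b} (∧-right {S b} (∧-right {X a} h))))
          (λ h → let r = ∧-right {S b} (∧-right {X a} h) in ∧-true (∧-left {S b} (∧-right {X a} h)) (∧-true (tri-right {t} {a} {b} r)
            (dec-true (linked? t b) (a , ∧-left h , tri-left {t} {a} {b} r , tri-edge {t} {a} r)))))
        (≤-reflexive (∑∑-product (⟦_⟧ ∘ nearX t) (⟦_⟧ ∘ linked t)))

    linked-S : ∀ {t τ} → linked t τ ≡ true → S τ ≡ true
    linked-S = ∧-left

    linked-∼ : ∀ {t τ} → linked t τ ≡ true → τ ∼ t
    linked-∼ {t} {τ} h = ∧-left (∧-right {S τ} h)

    lost⇒missing : ∀ t τ σ → linked t τ ∧ nearY t σ ≡ true → S τ ∧ (Y σ ∧ not (g τ σ)) ≡ true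
    lost⇒missing t τ σ h = ∧-true (linked-S {t} l) (∧-true (∧-left {Y σ} r) (not-true λ τσ →
        let a , xa , at , aτ = does-true (linked? t τ) (∧-right {g τ t} (∧-right {S τ} l)) in
        no-common (linked-∼ {t} l) xa aτ at (∧-left {Y σ} r) (∼-sym τσ) (∧-right {Y σ} r)))
      where
      l : linked t τ ≡ true
      l = ∧-left h
      r : nearY t σ ≡ true
      r = ∧-right {linked t τ} h

    lost≡ : ∀ t → lost t ≡ ∑∑ λ τ σ → ⟦ linked t τ ∧ nearY t σ ⟧
    lost≡ t = sym (trans (∑∑-cong λ τ σ → ⟦⟧-∧ (linked t τ) (nearY t σ)) (∑∑-product (⟦_⟧ ∘ linked t) (⟦_⟧ ∘ nearY t)))

    -- The two sets of lost pairs are disjoint: a pair in both would contain a common neighbour of t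
    -- and t′ in `Y`, against `no-common`.
    pair-lost : ∀ {t t′ a₀} → t ∼ t′ → X a₀ ≡ true → a₀ ∼ t → a₀ ∼ t′ → lost t + lost t′ ≤ missing S Y
    pair-lost {t} {t′} tt′ xa₀ at at′ = ≤-trans (≤-reflexive (trans (cong₂ _+_ (lost≡ t) (lost≡ t′))
        (sym (∑∑-+ (λ τ σ → ⟦ linked t τ ∧ nearY t σ ⟧) (λ τ σ → ⟦ linked t′ τ ∧ nearY t′ σ ⟧)))))
      (∑∑-mono λ τ σ → pt (lost⇒missing t τ σ) (lost⇒missing t′ τ σ) λ h h′ →
        no-common tt′ xa₀ at at′ (∧-left (∧-right {linked t τ} h)) (∧-right {Y σ} (∧-right {linked t τ} h)) (∧-right {Y σ} (∧-right {linked t′ τ} h′)))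
      where
      pt : ∀ {p q r} → (p ≡ true → r ≡ true) → (q ≡ true → r ≡ true) → (p ≡ true → q ≡ true → ⊥) → ⟦ p ⟧ + ⟦ q ⟧ ≤ ⟦ r ⟧
      pt {false} _ hq _ = ⟦⟧-mono hq
      pt {true} {false} hp _ _ = ⟦⟧-mono hp
      pt {true} {true} _ _ h = ⊥-elim (h refl refl)

    -- A missing pair may be lost for two of the three vertices, but not for all, since its end in
    -- `S` would complete a K₄.
    triangle-lost : ∀ {t₁ t₂ t₃} → t₁ ∼ t₂ → t₁ ∼ t₃ → t₂ ∼ t₃ → lost t₁ + (lost t₂ + lost t₃) ≤ 2 * missing S Y
    triangle-lost {t₁} {t₂} {t₃} t₁₂ t₁₃ t₂₃ = ≤-trans (≤-reflexive (trans
        (cong₂ _+_ (lost≡ t₁) (trans (cong₂ _+_ (lost≡ t₂) (lost≡ t₃)) (sym (∑∑-+ (f t₂) (f t₃)))))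
        (sym (∑∑-+ (f t₁) λ τ σ → f t₂ τ σ + f t₃ τ σ))))
      (≤-trans (∑∑-mono λ τ σ → pt (lost⇒missing t₁ τ σ) (lost⇒missing t₂ τ σ) (lost⇒missing t₃ τ σ) λ h₁ h₂ h₃ →
          k₄-free (linked-∼ {t₁} (∧-left h₁)) (linked-∼ {t₂} (∧-left h₂)) (linked-∼ {t₃} (∧-left h₃)) t₁₂ t₁₃ t₂₃)
        (≤-reflexive (∑∑-* 2 λ τ σ → ⟦ S τ ∧ (Y σ ∧ not (g τ σ)) ⟧)))
      where
      f : V → V → V → ℕ
      f t τ σ = ⟦ linked t τ ∧ nearY t σ ⟧
      pt : ∀ {p q s r} → (p ≡ true → r ≡ true) → (q ≡ true → r ≡ true) → (s ≡ true → r ≡ true) →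
        (p ≡ true → q ≡ true → s ≡ true → ⊥) → ⟦ p ⟧ + (⟦ q ⟧ + ⟦ s ⟧) ≤ 2 * ⟦ r ⟧
      pt {r = r} hp hq hs h with r
      pt {p} {q} {s} hp hq hs h | false = +-mono-≤ (⟦⟧-mono hp) (+-mono-≤ (⟦⟧-mono hq) (⟦⟧-mono hs))
      pt {false} {q} {s} hp hq hs h | true = +-mono-≤ (⟦⟧≤1 q) (⟦⟧≤1 s)
      pt {true} {false} {s} hp hq hs h | true = +-mono-≤ ≤-refl (⟦⟧≤1 s)
      pt {true} {true} {false} hp hq hs h | true = ≤-refl
      pt {true} {true} {true} hp hq hs h | true = ⊥-elim (h refl refl refl)

    E-pair : ∀ {t t′} → t ∼ t′ → E t + E t′ ≤ p
    E-pair {t} {t′} tt′ = ≤-trans (≤-reflexive (sym (∑∑-+ (e t) (e t′)))) (share₂ tt′)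

    E-triangle : ∀ {t₁ t₂ t₃} → t₁ ∼ t₂ → t₁ ∼ t₃ → t₂ ∼ t₃ → E t₁ + (E t₂ + E t₃) ≤ p
    E-triangle {t₁} {t₂} {t₃} t₁₂ t₁₃ t₂₃ = ≤-trans (≤-reflexive
      (sym (trans (∑∑-+ (e t₁) λ a b → e t₂ a b + e t₃ a b) (cong (E t₁ +_) (∑∑-+ (e t₂) (e t₃)))))) (share₃ t₁₂ t₁₃ t₂₃)

    -- The data that a triangle with one vertex in `X` and an edge tt′ in `S` hands to
    -- `two-edges-⊥`: m is `E t + E t′` and u is `lost t + lost t′`.
    PairBound : Set
    PairBound = ∃[ m ] ∃[ u ] (m ≤ p × u ≤ missing S Y × K * m ≤ 45 * (x * x * u) × 96 * N² + 180 * M ≤ 180 * m + 360 * b)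

    pair-bound : ∀ {t t′ a₀} → S t ≡ true → S t′ ≡ true → t ∼ t′ → X a₀ ≡ true → a₀ ∼ t → a₀ ∼ t′ → PairBound
    pair-bound {t} {t′} {a₀} st st′ tt′ xa₀ at at′ = E t + E t′ , lost t + lost t′ , E-pair tt′ , pair-lost tt′ xa₀ at at′ ,
      both {K} {E t} {E t′} {45} {x * x} {lost t} {lost t′} (transfer {K} {45} {J t} {E t} {x} {lost t} (pair-excess st′ (∼-sym tt′) xa₀ at′ at) (J*E≤ t))
        (transfer {K} {45} {J t′} {E t′} {x} {lost t′} (pair-excess st tt′ xa₀ at at′) (J*E≤ t′)) ,
      subst₂ _≤_ (r₁ N² M) (r₂ (E t) (E t′) b) (+-mono-≤ (rest-bound st) (rest-bound st′))
      where
      r₁ : ∀ N M → 48 * N + 90 * M + (48 * N + 90 * M) ≡ 96 * N + 180 * M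
      r₁ = solve-∀
      r₂ : ∀ E E′ b → 180 * E + 180 * b + (180 * E′ + 180 * b) ≡ 180 * (E + E′) + 360 * b
      r₂ = solve-∀
      both : ∀ {k e e′ c z l l′} → k * e ≤ c * (z * l) → k * e′ ≤ c * (z * l′) → k * (e + e′) ≤ c * (z * (l + l′))
      both {k} {e} {e′} {c} {z} {l} {l′} h h′ = subst₂ _≤_ (sym (*-distribˡ-+ k e e′))
        (trans (sym (*-distribˡ-+ c (z * l) (z * l′))) (cong (c *_) (sym (*-distribˡ-+ z l l′)))) (+-mono-≤ h h′)

    -- A stands for the smallest of the three values of `E`. Adding the three excess inequalities
    -- counts every `J` twice, which turns 45 into 30.
    triangle-bound : ∀ {t₁ t₂ t₃} A → S t₁ ≡ true → S t₂ ≡ true → S t₃ ≡ true → t₁ ∼ t₂ → t₁ ∼ t₃ → t₂ ∼ t₃ →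
      A ≤ E t₁ → A ≤ E t₂ → A ≤ E t₃ → ∃[ u ] (u ≤ 2 * missing S Y × K * A ≤ 30 * (x * x * u))
    triangle-bound {t₁} {t₂} {t₃} A st₁ st₂ st₃ t₁₂ t₁₃ t₂₃ A₁ A₂ A₃ = lost t₁ + (lost t₂ + lost t₃) , triangle-lost t₁₂ t₁₃ t₂₃ ,
      transfer {K} {30} {J t₁ + (J t₂ + J t₃)} {A} {x} {lost t₁ + (lost t₂ + lost t₃)}
        (thrice K (J t₁) (J t₂) (J t₃) (triangle-excess st₁ t₁₂ t₁₃ t₂₃) (triangle-excess st₂ (∼-sym t₁₂) t₂₃ t₁₃) (triangle-excess st₃ (∼-sym t₁₃) (∼-sym t₂₃) t₁₂))
        (≤-trans (≤-reflexive (d₁ (J t₁) (J t₂) (J t₃) A))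
          (≤-trans (+-mono-≤ (*-monoʳ-≤ (J t₁) A₁) (+-mono-≤ (*-monoʳ-≤ (J t₂) A₂) (*-monoʳ-≤ (J t₃) A₃)))
            (≤-trans (+-mono-≤ (J*E≤ t₁) (+-mono-≤ (J*E≤ t₂) (J*E≤ t₃)))
              (≤-reflexive (d₂ (x * x) (lost t₁) (lost t₂) (lost t₃))))))
      where
      d₁ : ∀ p q r A → (p + (q + r)) * A ≡ p * A + (q * A + r * A)
      d₁ = solve-∀
      d₂ : ∀ z p q r → z * p + (z * q + z * r) ≡ z * (p + (q + r))
      d₂ = solve-∀
      thrice : ∀ K p q r → K ≤ 45 * (q + r) → K ≤ 45 * (p + r) → K ≤ 45 * (p + q) → K ≤ 30 * (p + (q + r))
      thrice K p q r h₁ h₂ h₃ = *-cancelˡ-≤ 3 (subst₂ _≤_ (l K) (m p q r) (+-mono-≤ (+-mono-≤ h₁ h₂) h₃))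
        where
        l : ∀ K → K + K + K ≡ 3 * K
        l = solve-∀
        m : ∀ p q r → 45 * (q + r) + 45 * (p + r) + 45 * (p + q) ≡ 3 * (30 * (p + (q + r)))
        m = solve-∀

  module Obstruction {X Y S : V → Bool} (sp : Split X Y S) where

    open InSplit sp
    open Parts x y s
    module Swapped = InSplit (swap sp)

    positive : V → 0 < x + y + s
    positive v = subst (0 <_) (sym total) (inhabited v)
      where
      inhabited : ∀ {n} → Fin n → 0 < n
      inhabited {suc n} _ = s≤s z≤n

    p-swap : y * x ≡ p
    p-swap = *-comm y x

    b-swap : s * (y + x) ≡ b
    b-swap = cong (s *_) (+-comm y x)

    N²-swap : Parts.N² y x s ≡ N²
    N²-swap = cong (λ m → (m + s) * (m + s)) (+-comm y x)

    K-swap : Parts.K y x s ≡ K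
    K-swap = cong₂ (λ i j → 16 * i ∸ 45 * j) N²-swap (cong₂ _+_ p-swap b-swap)

    M-swap : Swapped.M ≡ M
    M-swap = +-comm (missing S Y) (missing S X)

    E-swap : ∀ t → Swapped.E t ≡ E t
    E-swap t = trans (∑∑-cong λ a b → pt (Y a) (X b) (tri-comm t a b)) (∑∑-comm (λ a b → e t b a))
      where
      pt : ∀ p q {r r′} → r ≡ r′ → ⟦ p ∧ (q ∧ r) ⟧ ≡ ⟦ q ∧ (p ∧ r′) ⟧
      pt false false refl = refl
      pt false true refl = refl
      pt true false refl = refl
      pt true true refl = refl

    -- One pair loses pairs between `S` and `Y`, the other pairs between `S` and `X`, so both losses
    -- fit into `M`. The smaller m satisfies both upper bounds and comes with its own lower bound.
    no-two-edges : V → PairBound → Swapped.PairBound → ⊥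
    no-two-edges o (m , u , m≤p , u≤ , hu , h) (m′ , v , m′≤p , v≤ , hv , h′) = go (≤-total m m′)
      where
      hv′ : K * m′ ≤ 45 * (y * y * v)
      hv′ = subst (λ k → k * m′ ≤ 45 * (y * y * v)) K-swap hv
      h″ : 96 * N² + 180 * M ≤ 180 * m′ + 360 * b
      h″ = subst₂ _≤_ (cong₂ (λ i j → 96 * i + 180 * j) N²-swap M-swap) (cong (λ i → 180 * m′ + 360 * i) b-swap) h′
      u+v≤M : u + v ≤ M
      u+v≤M = ≤-trans (+-mono-≤ u≤ v≤) (≤-reflexive (+-comm (missing S Y) (missing S X)))
      go : m ≤ m′ ⊎ m′ ≤ m → ⊥
      go (inj₁ le) = two-edges-⊥ (positive o) m u v M hu (≤-trans (*-monoʳ-≤ K le) hv′) u+v≤M m≤p h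
      go (inj₂ le) = two-edges-⊥ (positive o) m′ u v M (≤-trans (*-monoʳ-≤ K le) hu) hv′ u+v≤M (subst (m′ ≤_) p-swap m′≤p) h″

    no-triangle : ∀ {t₁ t₂ t₃} → S t₁ ≡ true → S t₂ ≡ true → S t₃ ≡ true → t₁ ∼ t₂ → t₁ ∼ t₃ → t₂ ∼ t₃ → ⊥
    no-triangle {t₁} {t₂} {t₃} st₁ st₂ st₃ t₁₂ t₁₃ t₂₃ = go (≤-total (E t₁) (E t₂)) (≤-total (E t₁) (E t₃)) (≤-total (E t₂) (E t₃))
      where
      at : ∀ A → A ≤ E t₁ → A ≤ E t₂ → A ≤ E t₃ → 48 * N² + 90 * M ≤ 180 * A + 180 * b → ⊥
      at A A₁ A₂ A₃ h = let u , u≤ , hu = triangle-bound A st₁ st₂ st₃ t₁₂ t₁₃ t₂₃ A₁ A₂ A₃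
                            v , v≤ , hv = Swapped.triangle-bound A st₁ st₂ st₃ t₁₂ t₁₃ t₂₃ (via t₁ A₁) (via t₂ A₂) (via t₃ A₃) in
        triangle-⊥ (positive t₁) A u v M hu (subst (λ k → k * A ≤ 30 * (y * y * v)) K-swap hv)
          (≤-trans (+-mono-≤ u≤ v≤) (≤-reflexive (trans (+-comm (2 * missing S Y) (2 * missing S X)) (sym (*-distribˡ-+ 2 (missing S X) (missing S Y))))))
          (≤-trans (≤-trans (≤-reflexive (three A)) (+-mono-≤ A₁ (+-mono-≤ A₂ A₃))) (E-triangle t₁₂ t₁₃ t₂₃)) h
        where
        via : ∀ t → A ≤ E t → A ≤ Swapped.E t
        via t = subst (A ≤_) (sym (E-swap t))
        three : ∀ A → 3 * A ≡ A + (A + A)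
        three = solve-∀
      go : E t₁ ≤ E t₂ ⊎ E t₂ ≤ E t₁ → E t₁ ≤ E t₃ ⊎ E t₃ ≤ E t₁ → E t₂ ≤ E t₃ ⊎ E t₃ ≤ E t₂ → ⊥
      go (inj₁ h₁₂) (inj₁ h₁₃) _ = at (E t₁) ≤-refl h₁₂ h₁₃ (rest-bound st₁)
      go (inj₂ h₂₁) _ (inj₁ h₂₃) = at (E t₂) h₂₁ ≤-refl h₂₃ (rest-bound st₂)
      go (inj₁ h₁₂) (inj₂ h₃₁) _ = at (E t₃) h₃₁ (≤-trans h₃₁ h₁₂) ≤-refl (rest-bound st₃)
      go (inj₂ h₂₁) _ (inj₂ h₃₂) = at (E t₃) (≤-trans h₃₂ h₂₁) h₃₂ ≤-refl (rest-bound st₃)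

    -- A triangle off `X` has at most one vertex in the independent set `Y`, and `no-triangle`
    -- excludes three in `S`.
    find-pair : ∀ {a b c} → X a ≡ false → X b ≡ false → X c ≡ false → a ∼ b → a ∼ c → b ∼ c →
      ∃[ o ] ∃[ t ] ∃[ t′ ] (Y o ≡ true × S t ≡ true × S t′ ≡ true × o ∼ t × o ∼ t′ × t ∼ t′)
    find-pair {a} {b} {c} xa xb xc ab ac bc = go (outside a xa) (outside b xb) (outside c xc)
      where
      outside : ∀ v → X v ≡ false → Y v ≡ true ⊎ S v ≡ true
      outside v xv = drop (cover v)
        where
        drop : X v ≡ true ⊎ Y v ≡ true ⊎ S v ≡ true → Y v ≡ true ⊎ S v ≡ true
        drop (inj₁ e) = case trans (sym e) xv of λ ()
        drop (inj₂ h) = h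
      go : Y a ≡ true ⊎ S a ≡ true → Y b ≡ true ⊎ S b ≡ true → Y c ≡ true ⊎ S c ≡ true →
        ∃[ o ] ∃[ t ] ∃[ t′ ] (Y o ≡ true × S t ≡ true × S t′ ≡ true × o ∼ t × o ∼ t′ × t ∼ t′)
      go (inj₁ ya) (inj₁ yb) _ = ⊥-elim (Split.Y-independent sp ya yb ab)
      go (inj₁ ya) (inj₂ _) (inj₁ yc) = ⊥-elim (Split.Y-independent sp ya yc ac)
      go (inj₁ ya) (inj₂ sb) (inj₂ sc) = a , b , c , ya , sb , sc , ab , ac , bc
      go (inj₂ _) (inj₁ yb) (inj₁ yc) = ⊥-elim (Split.Y-independent sp yb yc bc)
      go (inj₂ sa) (inj₁ yb) (inj₂ sc) = b , a , c , yb , sa , sc , ∼-sym ab , bc , ac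
      go (inj₂ sa) (inj₂ sb) (inj₁ yc) = c , a , b , yc , sa , sb , ∼-sym ac , ∼-sym bc , ab
      go (inj₂ sa) (inj₂ sb) (inj₂ sc) = ⊥-elim (no-triangle sa sb sc ab ac bc)

  Triangle : (V → Bool) → Set
  Triangle P = ∃[ a ] ∃[ b ] ∃[ c ] (P a ≡ true × P b ≡ true × P c ≡ true × a ∼ b × a ∼ c × b ∼ c)

  triangle? : ∀ P → Dec (Triangle P)
  triangle? P = any? λ a → any? λ b → any? λ c → (P a ≟ᵇ true) ×-dec ((P b ≟ᵇ true) ×-dec ((P c ≟ᵇ true) ×-dec
    ((g a b ≟ᵇ true) ×-dec ((g a c ≟ᵇ true) ×-dec (g b c ≟ᵇ true)))))

  not-false : ∀ {p} → not p ≡ true → p ≡ false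
  not-false {false} _ = refl

  no-both-triangles : ∀ {X Y S} → Split X Y S → Triangle (not ∘ X) → Triangle (not ∘ Y) → ⊥
  no-both-triangles sp (a , b , c , xa , xb , xc , ab , ac , bc) (a′ , b′ , c′ , ya , yb , yc , ab′ , ac′ , bc′) =
    let o , t , t′ , yo , st , st′ , ot , ot′ , tt′ = Obstruction.find-pair sp (not-false xa) (not-false xb) (not-false xc) ab ac bc
        o′ , w , w′ , xo , sw , sw′ , ow , ow′ , ww′ = Obstruction.find-pair (swap sp) (not-false ya) (not-false yb) (not-false yc) ab′ ac′ bc′ in
    Obstruction.no-two-edges sp o (InSplit.pair-bound sp sw sw′ ww′ xo ow ow′) (InSplit.pair-bound (swap sp) st st′ tt′ yo ot ot′)

  -- From a vertex of maximum degree to a 3-colouring.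

  valency : V → ℕ
  valency a = sum λ b → ⟦ g a b ⟧

  degree-sum≤ : ∀ P m → (∀ a → P a ≡ true → valency a ≤ m) → degree-sum P ≤ # P * m
  degree-sum≤ P m h = ≤-trans (sum-mono λ a → row a (bool-cases (P a))) (≤-reflexive (sym (*-distribʳ-sum m (⟦_⟧ ∘ P))))
    where
    row : ∀ a → P a ≡ true ⊎ P a ≡ false → sum (λ b → ⟦ P a ∧ g a b ⟧) ≤ ⟦ P a ⟧ * m
    row a (inj₁ e) rewrite e = ≤-trans (h a e) (≤-reflexive (sym (*-identityˡ m)))
    row a (inj₂ e) rewrite e = ≤-reflexive (sum-zero n)

  Colouring : Set
  Colouring = Σ (V → Fin 3) λ c → ∀ {a b} → a ∼ b → c a ≢ c b

  exceeds-mono : ∀ {f h : V → V → Bool} → (∀ a b → f a b ≡ true → h a b ≡ true) →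
    Exceeds (n * n) (∑∑ λ a b → ⟦ f a b ⟧) → Exceeds (n * n) (∑∑ λ a b → ⟦ h a b ⟧)
  exceeds-mono imp (exceeds lt) = exceeds (<-≤-trans lt (*-monoʳ-≤ 45 (∑∑-mono λ a b → ⟦⟧-mono (imp a b))))

  -- All neighbours of a vertex of I lie outside I. This bounds the degrees in I by the size of the
  -- complement, and the neighbourhood of v makes the complement dense, so `SparseOutside` applies
  -- to it.
  colour-around : ∀ I → (∀ {a b} → I a ≡ true → I b ≡ true → a ∼ b → ⊥) → ∃[ v ] I v ≡ true → ¬ Triangle (not ∘ I) → Colouring
  colour-around I I-indep (v , Iv) none = pick , proper
    where
    outside : ∀ {a b} → I b ≡ true → a ∼ b → not (I a) ≡ true
    outside Ib ab = not-true λ Ia → I-indep Ia Ib ab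
    N-dense : Exceeds (n * n) (∑∑ λ a b → ⟦ not (I a) ∧ (not (I b) ∧ g a b) ⟧)
    N-dense = exceeds-mono {tri g v} (λ a b h → ∧-true (outside Iv (tri-left {v} {a} {b} h)) (∧-true (outside Iv (tri-right {v} {a} {b} h)) (tri-edge {v} {a} h))) (dense v)
    sparse : degree-sum (not ∘ not ∘ I) ≤ # (not ∘ I) * # (not ∘ not ∘ I)
    sparse = ≤-trans (degree-sum≤ (not ∘ not ∘ I) (# (not ∘ I)) λ a h → sum-mono λ b → ⟦⟧-mono {g a b} λ ab →
        outside {b} (unnot h) (∼-sym ab)) (≤-reflexive (*-comm (# (not ∘ not ∘ I)) (# (not ∘ I))))
      where
      unnot : ∀ {p} → not (not p) ≡ true → p ≡ true
      unnot {true} _ = refl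
    two : ∃ (Proper (not ∘ I))
    two = SparseOutside.bipartite (not ∘ I) (λ a b c ab ac bc → none (_ , _ , _ , a , b , c , ab , ac , bc)) N-dense sparse
    code : Bool → Bool → Fin 3
    code true _ = zero
    code false true = suc zero
    code false false = suc (suc zero)
    pick : V → Fin 3
    pick a = code (I a) (proj₁ two a)
    code-inj : ∀ {i i′ c c′} → code i c ≡ code i′ c′ → (i ≡ true × i′ ≡ true) ⊎ (not i ≡ true × not i′ ≡ true × c ≡ c′)
    code-inj {true} {true} _ = inj₁ (refl , refl)
    code-inj {true} {false} {c′ = true} ()
    code-inj {true} {false} {c′ = false} ()
    code-inj {false} {true} {true} ()
    code-inj {false} {true} {false} ()
    code-inj {false} {false} {true} {true} _ = inj₂ (refl , refl , refl)
    code-inj {false} {false} {true} {false} ()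
    code-inj {false} {false} {false} {true} ()
    code-inj {false} {false} {false} {false} _ = inj₂ (refl , refl , refl)
    proper : ∀ {a b} → a ∼ b → pick a ≢ pick b
    proper {a} {b} ab eq = go (code-inj eq)
      where
      go : (I a ≡ true × I b ≡ true) ⊎ (not (I a) ≡ true × not (I b) ≡ true × proj₁ two a ≡ proj₁ two b) → ⊥
      go (inj₁ (Ia , Ib)) = I-indep Ia Ib ab
      go (inj₂ (Na , Nb , c)) = proj₂ two Na Nb ab c

  record Independent₂ (X Y : V → Bool) : Set where
    field
      disjoint : ∀ {a} → X a ≡ true → Y a ≡ true → ⊥
      indepX : ∀ {a b} → X a ≡ true → X b ≡ true → a ∼ b → ⊥
      indepY : ∀ {a b} → Y a ≡ true → Y b ≡ true → a ∼ b → ⊥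

  flip₂ : ∀ {X Y} → Independent₂ X Y → Independent₂ Y X
  flip₂ i = record { disjoint = λ y x → disjoint x y ; indepX = indepY ; indepY = indepX }
    where open Independent₂ i

  infix 4 _⊆_
  _⊆_ : (V → Bool) → (V → Bool) → Set
  P ⊆ Q = ∀ {a} → P a ≡ true → Q a ≡ true

  Meets : (V → Bool) → V → Set
  Meets X v = ∃[ a ] (X a ≡ true × a ∼ v)

  meets? : ∀ X v → Dec (Meets X v)
  meets? X v = any? λ a → (X a ≟ᵇ true) ×-dec (g a v ≟ᵇ true)

  -- Stable under enlarging the two sets, so one pass over all vertices reaches a maximal pair.
  Settled : (V → Bool) → (V → Bool) → V → Set
  Settled X Y v = X v ≡ true ⊎ Y v ≡ true ⊎ Meets X v × Meets Y v

  add : V → (V → Bool) → V → Bool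
  add v X a = does (a ≟ᶠ v) ∨ X a

  add-old : ∀ v X → X ⊆ add v X
  add-old v X {a} e rewrite e = ∨-zeroʳ (does (a ≟ᶠ v))

  add-new : ∀ v X → add v X v ≡ true
  add-new v X rewrite dec-true (v ≟ᶠ v) refl = refl

  add-inv : ∀ v X {a} → add v X a ≡ true → a ≡ v ⊎ X a ≡ true
  add-inv v X {a} h with a ≟ᶠ v
  ... | yes e = inj₁ e
  ... | no _ = inj₂ h

  add-indep : ∀ {v X Y} → Independent₂ X Y → (X v ≡ true → ⊥) → (Y v ≡ true → ⊥) → ¬ Meets X v → Independent₂ (add v X) Y
  add-indep {v} {X} {Y} i ¬Xv ¬Yv ¬m = record { disjoint = λ {a} h → dis (add-inv v X h) ; indepX = λ h h′ → ind (add-inv v X h) (add-inv v X h′) ; indepY = indepY }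
    where
    open Independent₂ i
    dis : ∀ {a} → a ≡ v ⊎ X a ≡ true → Y a ≡ true → ⊥
    dis (inj₁ refl) = ¬Yv
    dis (inj₂ h) = disjoint h
    ind : ∀ {a b} → a ≡ v ⊎ X a ≡ true → b ≡ v ⊎ X b ≡ true → a ∼ b → ⊥
    -- A loop would count as a K₄ with four equal vertices.
    ind (inj₁ refl) (inj₁ refl) vv = k₄-free vv vv vv vv vv vv
    ind (inj₁ refl) (inj₂ xb) vb = ¬m (_ , xb , ∼-sym vb)
    ind (inj₂ xa) (inj₁ refl) av = ¬m (_ , xa , av)
    ind (inj₂ xa) (inj₂ xb) ab = indepX xa xb ab

  Extension : (V → Bool) → (V → Bool) → (V → Set) → Set
  Extension X Y P = ∃[ X′ ] ∃[ Y′ ] (Independent₂ X′ Y′ × X ⊆ X′ × Y ⊆ Y′ × (∀ v → P v → Settled X′ Y′ v))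

  settled-mono : ∀ {X Y X′ Y′ v} → X ⊆ X′ → Y ⊆ Y′ → Settled X Y v → Settled X′ Y′ v
  settled-mono f h (inj₁ x) = inj₁ (f x)
  settled-mono f h (inj₂ (inj₁ y)) = inj₂ (inj₁ (h y))
  settled-mono f h (inj₂ (inj₂ ((a , xa , av) , (b , yb , bv)))) = inj₂ (inj₂ ((a , f xa , av) , (b , h yb , bv)))

  settle : ∀ {X Y} v → Independent₂ X Y → Extension X Y (_≡ v)
  settle {X} {Y} v i = go (bool-cases (X v)) (bool-cases (Y v)) (meets? X v) (meets? Y v)
    where
    absent : ∀ {p} → p ≡ false → p ≡ true → ⊥
    absent refl ()
    go : X v ≡ true ⊎ X v ≡ false → Y v ≡ true ⊎ Y v ≡ false → Dec (Meets X v) → Dec (Meets Y v) → Extension X Y (_≡ v)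
    go (inj₁ x) _ _ _ = X , Y , i , id , id , λ { _ refl → inj₁ x }
    go (inj₂ _) (inj₁ y) _ _ = X , Y , i , id , id , λ { _ refl → inj₂ (inj₁ y) }
    go (inj₂ x) (inj₂ y) (no ¬m) _ = add v X , Y , add-indep i (absent x) (absent y) ¬m , add-old v X , id , λ { _ refl → inj₁ (add-new v X) }
    go (inj₂ x) (inj₂ y) (yes _) (no ¬m) = X , add v Y , flip₂ (add-indep (flip₂ i) (absent y) (absent x) ¬m) , id , add-old v Y , λ { _ refl → inj₂ (inj₁ (add-new v Y)) }
    go (inj₂ x) (inj₂ y) (yes m) (yes m′) = X , Y , i , id , id , λ { _ refl → inj₂ (inj₂ (m , m′)) }

  settle-all : ∀ {X Y} (l : List V) → Independent₂ X Y → Extension X Y (_∈ l)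
  settle-all [] i = _ , _ , i , id , id , λ _ ()
  settle-all (v ∷ l) i =
    let X₁ , Y₁ , i₁ , X⊆ , Y⊆ , s₁ = settle v i
        X₂ , Y₂ , i₂ , X₁⊆ , Y₁⊆ , s₂ = settle-all l i₁ in
    X₂ , Y₂ , i₂ , (λ h → X₁⊆ (X⊆ h)) , (λ h → Y₁⊆ (Y⊆ h)) ,
    λ { w (here e) → settled-mono {v = w} X₁⊆ Y₁⊆ (s₁ w e) ; w (there m) → s₂ w m }

  colour-split : ∀ {X Y S} → Split X Y S → ∃[ a ] X a ≡ true → ∃[ b ] Y b ≡ true → Colouring
  colour-split {X} {Y} sp X-inhabited Y-inhabited = choose (triangle? (not ∘ X)) (triangle? (not ∘ Y))
    where
    open Split sp
    choose : Dec (Triangle (not ∘ X)) → Dec (Triangle (not ∘ Y)) → Colouring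
    choose (no none) _ = colour-around X X-independent X-inhabited none
    choose (yes _) (no none) = colour-around Y Y-independent Y-inhabited none
    choose (yes Δ) (yes Δ′) = ⊥-elim (no-both-triangles sp Δ Δ′)

  module MaxDegree (q : V) (max : ∀ a → valency a ≤ valency q) where

    N : V → Bool
    N a = g a q

    #N : # N ≡ valency q
    #N = sum-cong-≗ λ a → cong ⟦_⟧ (g-comm a q)

    neighbourhood-bipartite : ∃ (Proper N)
    neighbourhood-bipartite = SparseOutside.bipartite N (λ a b c ab ac bc → k₄-free ab ac a bc b c)
      (exceeds-mono {tri g q} (λ a b h → ∧-true (tri-left {q} {a} {b} h) (∧-true (tri-right {q} {a} {b} h) (tri-edge {q} {a} h))) (dense q))
      (≤-trans (degree-sum≤ (not ∘ N) (# N) λ a _ → ≤-trans (max a) (≤-reflexive (sym #N))) (≤-reflexive (*-comm (# (not ∘ N)) (# N))))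

    module _ (c : V → Bool) (c-proper : Proper N c) where

      X₀ Y₀ : V → Bool
      X₀ a = N a ∧ c a
      Y₀ a = N a ∧ not (c a)

      base : Independent₂ X₀ Y₀
      base = record
        { disjoint = λ {a} h h′ → case trans (sym (not-false (∧-right {N a} h′))) (∧-right {N a} h) of λ ()
        ; indepX = λ {a} {b} h h′ ab → c-proper (∧-left h) (∧-left h′) ab (trans (∧-right {N a} h) (sym (∧-right {N b} h′)))
        ; indepY = λ {a} {b} h h′ ab → c-proper (∧-left h) (∧-left h′) ab (trans (not-false (∧-right {N a} h)) (sym (not-false (∧-right {N b} h′)))) }

      inhabited : ∃ (λ a → X₀ a ≡ true) × ∃ (λ b → Y₀ b ≡ true)
      inhabited = let a , b , pos = ∑∑-pos (λ a b → ⟦ tri g q a b ⟧) (<*⇒0< 45 (∑∑ λ a b → ⟦ tri g q a b ⟧) (Exceeds.bound (dense q))) in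
        from a b (⟦⟧-pos pos) (bool-cases (c a)) (bool-cases (c b))
        where
        from : ∀ a b → tri g q a b ≡ true → c a ≡ true ⊎ c a ≡ false → c b ≡ true ⊎ c b ≡ false → ∃ (λ a → X₀ a ≡ true) × ∃ (λ b → Y₀ b ≡ true)
        from a b h (inj₁ ca) (inj₂ cb) = (a , ∧-true (tri-left {q} {a} {b} h) ca) , (b , ∧-true (tri-right {q} {a} {b} h) (cong not cb))
        from a b h (inj₂ ca) (inj₁ cb) = (b , ∧-true (tri-right {q} {a} {b} h) cb) , (a , ∧-true (tri-left {q} {a} {b} h) (cong not ca))
        from a b h (inj₁ ca) (inj₁ cb) = ⊥-elim (c-proper (tri-left {q} {a} {b} h) (tri-right {q} {a} {b} h) (tri-edge {q} {a} h) (trans ca (sym cb)))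
        from a b h (inj₂ ca) (inj₂ cb) = ⊥-elim (c-proper (tri-left {q} {a} {b} h) (tri-right {q} {a} {b} h) (tri-edge {q} {a} h) (trans ca (sym cb)))

      maximal-split : ∀ X Y → Independent₂ X Y → X₀ ⊆ X → Y₀ ⊆ Y → (∀ v → v ∈ allFin n → Settled X Y v) →
        Split X Y (λ a → not (X a) ∧ not (Y a))
      maximal-split X Y ind X₀⊆ Y₀⊆ settled = record
        { partition = λ a → part (X a) (Y a) disjoint
        ; X-independent = indepX ; Y-independent = indepY
        ; meets-X = λ {t} st → proj₁ (pick t st (settled t (∈-allFin t))) ; meets-Y = λ {t} st → proj₂ (pick t st (settled t (∈-allFin t)))
        -- No degree exceeds that of q, whose neighbourhood is covered by X ∪ Y.
        ; low = degree-sum≤ (λ a → not (X a) ∧ not (Y a)) (# X + # Y) λ a _ → ≤-trans (max a) (≤-trans (≤-reflexive (sym #N))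
            (≤-trans (sum-mono λ b → split b (bool-cases (c b))) (≤-reflexive (∑-distrib-+ (⟦_⟧ ∘ X) (⟦_⟧ ∘ Y))))) }
        where
        open Independent₂ ind
        pick : ∀ t → not (X t) ∧ not (Y t) ≡ true → Settled X Y t → Meets X t × Meets Y t
        pick t st (inj₁ x) = case trans (sym x) (not-false (∧-left st)) of λ ()
        pick t st (inj₂ (inj₁ y)) = case trans (sym y) (not-false (∧-right {not (X t)} st)) of λ ()
        pick t st (inj₂ (inj₂ m)) = m
        part : ∀ p q → (p ≡ true → q ≡ true → ⊥) → ⟦ p ⟧ + ⟦ q ⟧ + ⟦ not p ∧ not q ⟧ ≡ 1
        part true true h = ⊥-elim (h refl refl)
        part true false h = refl
        part false true h = refl
        part false false h = refl
        split : ∀ b → c b ≡ true ⊎ c b ≡ false → ⟦ N b ⟧ ≤ ⟦ X b ⟧ + ⟦ Y b ⟧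
        split b (inj₁ cb) = ≤-trans (⟦⟧-mono λ Nb → X₀⊆ (∧-true Nb cb)) (m≤m+n _ _)
        split b (inj₂ cb) = ≤-trans (⟦⟧-mono λ Nb → Y₀⊆ (∧-true Nb (cong not cb))) (m≤n+m _ _)

      colour-extension : Extension X₀ Y₀ (_∈ allFin n) → Colouring
      colour-extension (X , Y , ind , X₀⊆ , Y₀⊆ , settled) =
        let (a , xa) , (b , yb) = inhabited in
        colour-split (maximal-split X Y ind X₀⊆ Y₀⊆ settled) (a , X₀⊆ xa) (b , Y₀⊆ yb)

  three-colouring : V → Colouring
  three-colouring o = let q , max = argmax o valency
                          c , c-proper = MaxDegree.neighbourhood-bipartite q max in
    MaxDegree.colour-extension q max c c-proper (settle-all (allFin n) (MaxDegree.base q max c c-proper))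

-- Tools for the shadow graph: lists and numerical contradictions.

allPairs-lookup : ∀ {A : Set} {R : A → A → Set} {xs : List A} → AllPairs R xs → ∀ i j → toℕ i < toℕ j → R (lookup xs i) (lookup xs j)
allPairs-lookup (px ∷ _) zero (suc j) _ = All.lookup px (∈-lookup j)
allPairs-lookup (_ ∷ pxs) (suc i) (suc j) (s≤s i<j) = allPairs-lookup pxs i j i<j

distinct⇒length≤ : ∀ {m} {xs : List (Fin m)} → AllPairs _≢_ xs → length xs ≤ m
distinct⇒length≤ {m} {xs} distinct = ≮⇒≥ λ m<len →
  let i , j , i<j , eq = pigeonhole m<len (lookup xs) in allPairs-lookup distinct i j i<j eq

bool-ext : ∀ {p q} → (p ≡ true → q ≡ true) → (q ≡ true → p ≡ true) → p ≡ q
bool-ext {true} f _ = sym (f refl)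
bool-ext {false} {true} _ h = h refl
bool-ext {false} {false} _ _ = refl

k₆-arith : ∀ N n T U → 5000 * n ≤ N → 6 * suc (8 * N) ≤ 45 * T → T ≤ U + 15 * (2 * n) → U ≤ N → ⊥
k₆-arith N n T U big h T≤ U≤ = absurd-≤ _ (+-mono-≤ (≤-trans h (*-monoʳ-≤ 45 (≤-trans T≤ (+-monoˡ-≤ _ U≤)))) (*-monoʳ-≤ 3 big)) (eq N n)
  where
  eq : ∀ N n → 6 * suc (8 * N) + 3 * (5000 * n) ≡ 45 * (N + 15 * (2 * n)) + 3 * N + suc (5 + 13650 * n)
  eq = solve-∀

-- The point is 8/45 > (2/5)².
heavy-arith : ∀ n h → 5000 * n ≤ n * n → suc (8 * (n * n)) ≤ 45 * (h * h + 2 * (n * 2)) → 2 * n ≤ 5 * h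
heavy-arith n h big le = ≮⇒≥ λ lt → absurd-≤ _
  (+-mono-≤ (+-mono-≤ (*-monoʳ-≤ 25 le) (*-monoʳ-≤ 45 (*-mono-≤ (<⇒≤ lt) (<⇒≤ lt)))) big) (eq n h)
  where
  eq : ∀ n h → 25 * suc (8 * (n * n)) + 45 * (5 * h * (5 * h)) + 5000 * n
    ≡ 25 * (45 * (h * h + 2 * (n * 2))) + 45 * (2 * n * (2 * n)) + n * n + suc (24 + 19 * (n * n) + 500 * n)
  eq = solve-∀

-- 32/45 - 2/3 - 4/100 = 1/225, and n²/225 has to exceed the linear errors 12n and 8n.
good-arith : ∀ N n T Λ S U W → 5000 * n ≤ N → 4 * suc (8 * N) ≤ 45 * T → T ≤ S + Λ → 100 * Λ ≤ 4 * N →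
  S ≤ U + 6 * (2 * n) → U ≤ W + 4 * (2 * n) → 3 * W ≤ 2 * N → ⊥
good-arith N n T Λ S U W big h T≤ Λ≤ S≤ U≤ W≤ = absurd-≤ _
  (+-mono-≤ (+-mono-≤ (+-mono-≤ (*-monoʳ-≤ 300 (≤-trans h (*-monoʳ-≤ 45 T≤′))) (*-monoʳ-≤ 135 Λ≤)) (*-monoʳ-≤ 4500 W≤)) (*-monoʳ-≤ 60 big)) (eq N n Λ W)
  where
  T≤′ : T ≤ W + 4 * (2 * n) + 6 * (2 * n) + Λ
  T≤′ = ≤-trans T≤ (+-monoˡ-≤ Λ (≤-trans S≤ (+-monoˡ-≤ (6 * (2 * n)) U≤)))
  eq : ∀ N n Λ W → 300 * (4 * suc (8 * N)) + 135 * (100 * Λ) + 4500 * (3 * W) + 60 * (5000 * n)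
    ≡ 300 * (45 * (W + 4 * (2 * n) + 6 * (2 * n) + Λ)) + 135 * (4 * N) + 4500 * (2 * N) + 60 * N + suc (1199 + 30000 * n)
  eq = solve-∀

-- The margin 2n²/45 has to exceed 160n for the bad vertices and 12n for the overlaps of the links.
k₄-arith : ∀ N n T U W → 5000 * n ≤ N → 4 * suc (8 * N) ≤ 45 * T → T ≤ U + 6 * (2 * n) → U ≤ W + 2 * (80 * n) → 3 * W ≤ 2 * N → ⊥
k₄-arith N n T U W big h T≤ U≤ W≤ = absurd-≤ _
  (+-mono-≤ (+-mono-≤ (*-monoʳ-≤ 3 (≤-trans h (*-monoʳ-≤ 45 (≤-trans T≤ (+-monoˡ-≤ (6 * (2 * n)) U≤))))) (*-monoʳ-≤ 45 W≤)) (*-monoʳ-≤ 6 big)) (eq N n W)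
  where
  eq : ∀ N n W → 3 * (4 * suc (8 * N)) + 45 * (3 * W) + 6 * (5000 * n)
    ≡ 3 * (45 * (W + 2 * (80 * n) + 6 * (2 * n))) + 45 * (2 * N) + 6 * N + suc (11 + 6780 * n)
  eq = solve-∀

-- The shadow of an F₅-free 3-graph has no K₄.

module Links {n : ℕ} (e : Fin n → Fin n → Fin n → Bool)
  (e-swap : ∀ {a b c} → e a b c ≡ true → e b a c ≡ true)
  (e-rot : ∀ {a b c} → e a b c ≡ true → e b c a ≡ true)
  (f₅-free : ∀ {a b c d z} → e a b c ≡ true → e a b d ≡ true → e c d z ≡ true → z ≢ a → z ≢ b → ⊥)
  (dense : ∀ v → Exceeds (n * n) (∑∑ λ a b → ⟦ e v a b ⟧)) (large : 5000 ≤ n) where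

  V : Set
  V = Fin n

  big : 5000 * n ≤ n * n
  big = *-monoˡ-≤ n large

  covered? : ∀ a b → Dec (∃[ c ] e a b c ≡ true)
  covered? a b = any? λ c → e a b c ≟ᵇ true

  g : V → V → Bool
  g a b = does (covered? a b)

  g-intro : ∀ {a b c} → e a b c ≡ true → g a b ≡ true
  g-intro {a} {b} {c} h = dec-true (covered? a b) (c , h)

  g-elim : ∀ {a b} → g a b ≡ true → ∃[ c ] e a b c ≡ true
  g-elim {a} {b} = does-true (covered? a b)

  g-sym : ∀ {a b} → g a b ≡ true → g b a ≡ true
  g-sym h = g-intro (e-swap (proj₂ (g-elim h)))

  g-comm : ∀ a b → g a b ≡ g b a
  g-comm a b = bool-ext g-sym g-sym

  open Cliques g g-comm using (#; Clique; inside; clique-list; turán)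

  Adjacent : List V → Set
  Adjacent = AllPairs λ a b → g a b ≡ true

  common : ∀ {x y} → g x y ≡ true → ∑∑ (λ a b → ⟦ e x a b ∧ e y a b ⟧) ≤ 2 * n
  common {x} {y} xy = let z , xyz = g-elim xy in
    ≤-trans (∑∑-mono λ a b → pt z xyz a b (a ≟ᶠ z) (b ≟ᶠ z)) (≤-reflexive (∑∑-cross z))
    where
    pt : ∀ z → e x y z ≡ true → ∀ a b (p : Dec (a ≡ z)) (q : Dec (b ≡ z)) → ⟦ e x a b ∧ e y a b ⟧ ≤ ⟦ does p ⟧ + ⟦ does q ⟧
    pt z xyz a b (yes _) q = ≤-trans (⟦⟧≤1 (e x a b ∧ e y a b)) (m≤m+n 1 _)
    pt z xyz a b (no _) (yes _) = ⟦⟧≤1 (e x a b ∧ e y a b)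
    pt z xyz a b (no a≢z) (no b≢z) = ⟦⟧-false λ h → f₅-free (e-rot (∧-left h)) (e-rot (∧-right {e x a b} h)) xyz (≢-sym a≢z) (≢-sym b≢z)

  union : (V → V → V → Bool) → List V → V → V → Bool
  union q [] a b = false
  union q (x ∷ xs) a b = q x a b ∨ union q xs a b

  total : (V → V → V → Bool) → List V → ℕ
  total q xs = sumˡ (map (λ x → ∑∑ λ a b → ⟦ q x a b ⟧) xs)

  -- The binomial coefficient of k over 2, the number of overlaps of k links.
  pairs : ℕ → ℕ
  pairs zero = 0
  pairs (suc k) = k + pairs k

  shared : ∀ q → (∀ {x a b} → q x a b ≡ true → e x a b ≡ true) → ∀ x xs → All (λ y → g x y ≡ true) xs →
    ∑∑ (λ a b → ⟦ q x a b ∧ union q xs a b ⟧) ≤ length xs * (2 * n)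
  shared q imp x [] [] = ≤-trans (∑∑-mono λ a b → ⟦⟧-false {q x a b ∧ false} λ h → case ∧-right {q x a b} h of λ ())
    (≤-reflexive (∑∑-zeros n))
  shared q imp x (y ∷ xs) (xy ∷ all) = ≤-trans (∑∑-mono λ a b → pt (q x a b) (q y a b) (union q xs a b) (e x a b) (e y a b) imp imp)
    (≤-trans (≤-reflexive (∑∑-+ (λ a b → ⟦ e x a b ∧ e y a b ⟧) (λ a b → ⟦ q x a b ∧ union q xs a b ⟧)))
      (+-mono-≤ (common xy) (shared q imp x xs all)))
    where
    pt : ∀ p r u i j → (p ≡ true → i ≡ true) → (r ≡ true → j ≡ true) → ⟦ p ∧ (r ∨ u) ⟧ ≤ ⟦ i ∧ j ⟧ + ⟦ p ∧ u ⟧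
    pt false r u i j _ _ = z≤n
    pt true false u i j _ _ = m≤n+m _ _
    pt true true u i j hi hj = ≤-trans (⟦⟧-true (∧-true (hi refl) (hj refl))) (m≤m+n _ _)

  union-bound : ∀ q → (∀ {x a b} → q x a b ≡ true → e x a b ≡ true) → ∀ xs → Adjacent xs →
    total q xs ≤ ∑∑ (λ a b → ⟦ union q xs a b ⟧) + pairs (length xs) * (2 * n)
  union-bound q imp [] _ = z≤n
  union-bound q imp (x ∷ xs) (all ∷ adj) = begin
    qx + total q xs ≤⟨ +-monoʳ-≤ qx (union-bound q imp xs adj) ⟩
    qx + (us + P) ≡⟨ sym (+-assoc qx us P) ⟩
    qx + us + P ≡⟨ cong (_+ P) (sym (∑∑-+ (λ a b → ⟦ q x a b ⟧) (λ a b → ⟦ union q xs a b ⟧))) ⟩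
    ∑∑ (λ a b → ⟦ q x a b ⟧ + ⟦ union q xs a b ⟧) + P ≡⟨ cong (_+ P) (∑∑-cong λ a b → pt (q x a b) (union q xs a b)) ⟩
    ∑∑ (λ a b → ⟦ q x a b ∨ union q xs a b ⟧ + ⟦ q x a b ∧ union q xs a b ⟧) + P
      ≡⟨ cong (_+ P) (∑∑-+ (λ a b → ⟦ q x a b ∨ union q xs a b ⟧) (λ a b → ⟦ q x a b ∧ union q xs a b ⟧)) ⟩
    uu + ∑∑ (λ a b → ⟦ q x a b ∧ union q xs a b ⟧) + P ≤⟨ +-monoˡ-≤ P (+-monoʳ-≤ uu (shared q imp x xs all)) ⟩
    uu + length xs * (2 * n) + P ≡⟨ +-assoc uu (length xs * (2 * n)) P ⟩
    uu + (length xs * (2 * n) + P) ≡⟨ cong (uu +_) (sym (*-distribʳ-+ (2 * n) (length xs) (pairs (length xs)))) ⟩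
    uu + (length xs + pairs (length xs)) * (2 * n) ∎
    where
    open ≤-Reasoning
    qx us uu P : ℕ
    qx = ∑∑ λ a b → ⟦ q x a b ⟧
    us = ∑∑ λ a b → ⟦ union q xs a b ⟧
    uu = ∑∑ λ a b → ⟦ q x a b ∨ union q xs a b ⟧
    P = pairs (length xs) * (2 * n)
    pt : ∀ p r → ⟦ p ⟧ + ⟦ r ⟧ ≡ ⟦ p ∨ r ⟧ + ⟦ p ∧ r ⟧
    pt false r = sym (+-identityʳ _)
    pt true r = refl

  degree-total : ∀ xs → length xs * suc (8 * (n * n)) ≤ 45 * total e xs
  degree-total [] = z≤n
  degree-total (x ∷ xs) = ≤-trans (+-mono-≤ (Exceeds.bound (dense x)) (degree-total xs))
    (≤-reflexive (sym (*-distribˡ-+ 45 (∑∑ λ a b → ⟦ e x a b ⟧) (total e xs))))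

  no-K₆ : ∀ xs → length xs ≡ 6 → Adjacent xs → ⊥
  no-K₆ xs len adj = k₆-arith (n * n) n (total e xs) (∑∑ λ a b → ⟦ union e xs a b ⟧) big
    (subst (λ k → k * suc (8 * (n * n)) ≤ 45 * total e xs) len (degree-total xs))
    (subst (λ k → total e xs ≤ ∑∑ (λ a b → ⟦ union e xs a b ⟧) + pairs k * (2 * n)) len (union-bound e id xs adj))
    (≤-trans (∑∑-mono λ a b → ⟦⟧≤1 (union e xs a b)) (≤-reflexive (trans (∑∑-const n 1) (cong (n *_) (*-identityʳ n)))))

  all : V → Bool
  all _ = true

  #-all : # all ≡ n
  #-all = trans (sum-const n 1) (*-identityʳ n)

  shadow-size : 5 * ∑∑ (λ a b → ⟦ g a b ⟧) ≤ 4 * (n * n)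
  shadow-size = subst (λ m → 5 * ∑∑ (λ a b → ⟦ g a b ⟧) ≤ 4 * (m * m)) #-all
    (turán 4 all λ C → let xs , len , _ , adj = clique-list 6 all C in no-K₆ xs len adj)

  codegree : V → V → ℕ
  codegree a b = sum λ c → ⟦ e a b c ⟧

  -- The threshold is 3 because the configurations to be excluded confine the third vertex to two
  -- possibilities, see `light-triangle`.
  heavy light : V → V → Bool
  heavy a b = does (3 ≤? codegree a b)
  light a b = not (heavy a b)

  light-bound : ∀ {a b} → light a b ≡ true → codegree a b ≤ 2
  light-bound {a} {b} = decide (3 ≤? codegree a b)
    where
    decide : ∀ {m} (d : Dec (3 ≤ m)) → not (does d) ≡ true → m ≤ 2
    decide (no ¬3≤m) _ = ≤-pred (≰⇒> ¬3≤m)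

  heavy-elim : ∀ {a b} → heavy a b ≡ true → 3 ≤ codegree a b
  heavy-elim {a} {b} = does-true (3 ≤? codegree a b)

  heavy⇒g : ∀ {a b} → heavy a b ≡ true → g a b ≡ true
  heavy⇒g {a} {b} h = let c , pos = sum-pos (λ c → ⟦ e a b c ⟧) (≤-trans (s≤s z≤n) (heavy-elim h)) in g-intro (⟦⟧-pos pos)

  -- A pair of the link of v with both ends heavy to v lies in a square of side `# (heavy v)`; every
  -- other pair has a light end, and each light vertex accounts for at most two.
  many-heavy : ∀ v → 2 * n ≤ 5 * # (heavy v)
  many-heavy v = heavy-arith n (# (heavy v)) big (≤-trans (Exceeds.bound (dense v)) (*-monoʳ-≤ 45 (begin
    ∑∑ (λ a b → ⟦ e v a b ⟧) ≤⟨ ∑∑-mono (λ a b → pt (heavy v a) (heavy v b) (e v a b) (e v b a) (flip-e a b)) ⟩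
    ∑∑ (λ a b → ⟦ heavy v a ⟧ * ⟦ heavy v b ⟧ + (l a b + l b a)) ≡⟨ ∑∑-+ (λ a b → ⟦ heavy v a ⟧ * ⟦ heavy v b ⟧) (λ a b → l a b + l b a) ⟩
    ∑∑ (λ a b → ⟦ heavy v a ⟧ * ⟦ heavy v b ⟧) + ∑∑ (λ a b → l a b + l b a) ≡⟨ cong₂ _+_ (∑∑-product (⟦_⟧ ∘ heavy v) (⟦_⟧ ∘ heavy v)) (∑∑-symmetrise l) ⟩
    # (heavy v) * # (heavy v) + 2 * ∑∑ l ≤⟨ +-monoʳ-≤ (# (heavy v) * # (heavy v)) (*-monoʳ-≤ 2 (≤-trans (sum-mono λ a → row a (bool-cases (heavy v a))) (≤-reflexive (sum-const n 2)))) ⟩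
    # (heavy v) * # (heavy v) + 2 * (n * 2) ∎)))
    where
    open ≤-Reasoning
    l : V → V → ℕ
    l a b = ⟦ light v a ∧ e v a b ⟧
    flip-e : ∀ a b → e v a b ≡ e v b a
    flip-e a b = bool-ext (λ h → e-swap (e-rot (e-rot h))) (λ h → e-swap (e-rot (e-rot h)))
    pt : ∀ p q i j → i ≡ j → ⟦ i ⟧ ≤ ⟦ p ⟧ * ⟦ q ⟧ + (⟦ not p ∧ i ⟧ + ⟦ not q ∧ j ⟧)
    pt true true i .i refl = ≤-trans (⟦⟧≤1 i) (s≤s z≤n)
    pt true false i .i refl = ≤-refl
    pt false q i .i refl = m≤m+n _ _
    row : ∀ a → heavy v a ≡ true ⊎ heavy v a ≡ false → sum (l a) ≤ 2
    row a (inj₁ h) = ≤-trans (≤-reflexive (trans (sum-cong-≗ λ b → cong (λ p → ⟦ not p ∧ e v a b ⟧) h) (sum-zero n))) z≤n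
    row a (inj₂ h) = ≤-trans (sum-mono λ b → ⟦⟧-mono {light v a ∧ e v a b} {e v a b} (∧-right {light v a})) (light-bound (cong not h))

  light-pairs : ℕ
  light-pairs = ∑∑ λ a b → ⟦ g a b ∧ light a b ⟧

  -- Of at most 4n²/5 ordered shadow pairs, at least 2n²/5 are heavy.
  few-light-pairs : 5 * light-pairs ≤ 2 * (n * n)
  few-light-pairs = +-cancelʳ-≤ (2 * (n * n)) _ _ (begin
    5 * light-pairs + 2 * (n * n) ≤⟨ +-monoʳ-≤ (5 * light-pairs) heavy-total ⟩
    5 * light-pairs + 5 * H ≡⟨ sym (*-distribˡ-+ 5 light-pairs H) ⟩
    5 * (light-pairs + H) ≡⟨ cong (5 *_) (trans (sym (∑∑-+ (λ a b → ⟦ g a b ∧ light a b ⟧) (λ a b → ⟦ heavy a b ⟧)))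
      (∑∑-cong λ a b → pt (g a b) (heavy a b) heavy⇒g)) ⟩
    5 * ∑∑ (λ a b → ⟦ g a b ⟧) ≤⟨ shadow-size ⟩
    4 * (n * n) ≡⟨ *-distribʳ-+ (n * n) 2 2 ⟩
    2 * (n * n) + 2 * (n * n) ∎)
    where
    open ≤-Reasoning
    H : ℕ
    H = ∑∑ λ a b → ⟦ heavy a b ⟧
    pt : ∀ p q → (q ≡ true → p ≡ true) → ⟦ p ∧ not q ⟧ + ⟦ q ⟧ ≡ ⟦ p ⟧
    pt true true _ = refl
    pt true false _ = refl
    pt false false _ = refl
    pt false true h = case h refl of λ ()
    arr : ∀ n → n * (2 * n) ≡ 2 * (n * n)
    arr = solve-∀
    heavy-total : 2 * (n * n) ≤ 5 * H
    heavy-total = ≤-trans (≤-reflexive (trans (sym (arr n)) (sym (sum-const n (2 * n)))))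
      (≤-trans (sum-mono many-heavy) (≤-reflexive (sym (*-distribˡ-sum 5 λ v → # (heavy v)))))

  weak : V → ℕ
  weak v = ∑∑ λ a b → ⟦ e v a b ∧ light a b ⟧

  weak-total : sum weak ≤ 2 * light-pairs
  weak-total = begin
    sum (λ v → sum λ a → sum λ b → ⟦ e v a b ∧ light a b ⟧) ≡⟨ ∑-comm (λ v a → sum λ b → ⟦ e v a b ∧ light a b ⟧) ⟩
    sum (λ a → sum λ v → sum λ b → ⟦ e v a b ∧ light a b ⟧) ≡⟨ sum-cong-≗ (λ a → ∑-comm λ v b → ⟦ e v a b ∧ light a b ⟧) ⟩
    ∑∑ (λ a b → sum λ v → ⟦ e v a b ∧ light a b ⟧) ≤⟨ ∑∑-mono (λ a b → pt a b (bool-cases (light a b)) (bool-cases (g a b))) ⟩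
    ∑∑ (λ a b → 2 * ⟦ g a b ∧ light a b ⟧) ≡⟨ ∑∑-* 2 (λ a b → ⟦ g a b ∧ light a b ⟧) ⟩
    2 * light-pairs ∎
    where
    open ≤-Reasoning
    zeros : ∀ {f : V → ℕ} {m} → (∀ v → f v ≤ 0) → sum f ≤ m
    zeros {f} h = ≤-trans (sum-mono h) (≤-trans (≤-reflexive (sum-zero n)) z≤n)
    pt : ∀ a b → light a b ≡ true ⊎ light a b ≡ false → g a b ≡ true ⊎ g a b ≡ false →
      sum (λ v → ⟦ e v a b ∧ light a b ⟧) ≤ 2 * ⟦ g a b ∧ light a b ⟧
    pt a b (inj₂ h) _ = zeros λ v → ⟦⟧-false λ t → case trans (sym h) (∧-right {e v a b} t) of λ ()
    pt a b (inj₁ _) (inj₂ h) = zeros λ v → ⟦⟧-false λ t → case trans (sym h) (g-intro (e-rot (∧-left {e v a b} t))) of λ ()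
    pt a b (inj₁ h) (inj₁ k) = ≤-trans (sum-mono λ v → ⟦⟧-mono {e v a b ∧ light a b} {e a b v} λ t → e-rot (∧-left {e v a b} t))
      (≤-trans (light-bound h) (*-monoʳ-≤ 2 (⟦⟧-true (∧-true k h))))

  -- With threshold n²/100, four good vertices together lose at most n²/25 link pairs, within the
  -- margin 2n²/45.
  bad good : V → Bool
  bad v = does (n * n <? 100 * weak v)
  good v = not (bad v)

  good-bound : ∀ {v} → good v ≡ true → 100 * weak v ≤ n * n
  good-bound {v} = decide (n * n <? 100 * weak v)
    where
    decide : ∀ {m k} (d : Dec (m < k)) → not (does d) ≡ true → k ≤ m
    decide (no ¬lt) _ = ≮⇒≥ ¬lt

  n²-pos : 0 < n * n
  n²-pos = *-mono-< pos pos
    where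
    pos : 0 < n
    pos = ≤-trans (s≤s z≤n) large

  -- Markov's inequality: the total weakness is at most 2 · 2n²/5, and a bad vertex accounts for
  -- more than n²/100 of it.
  few-bad : # bad ≤ 80
  few-bad = *-cancelˡ-≤ 5 (*-cancelʳ-≤ (5 * # bad) (5 * 80) (n * n) {{>-nonZero n²-pos}} (begin
    5 * # bad * (n * n) ≡⟨ *-assoc 5 (# bad) (n * n) ⟩
    5 * (# bad * (n * n)) ≤⟨ *-monoʳ-≤ 5 bad-total ⟩
    5 * (100 * sum weak) ≤⟨ *-monoʳ-≤ 5 (*-monoʳ-≤ 100 weak-total) ⟩
    5 * (100 * (2 * light-pairs)) ≡⟨ arr light-pairs ⟩
    200 * (5 * light-pairs) ≤⟨ *-monoʳ-≤ 200 few-light-pairs ⟩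
    200 * (2 * (n * n)) ≡⟨ sym (*-assoc 200 2 (n * n)) ⟩
    5 * 80 * (n * n) ∎))
    where
    open ≤-Reasoning
    arr : ∀ m → 5 * (100 * (2 * m)) ≡ 200 * (5 * m)
    arr = solve-∀
    bad-total : # bad * (n * n) ≤ 100 * sum weak
    bad-total = ≤-trans (≤-reflexive (*-distribʳ-sum (n * n) (⟦_⟧ ∘ bad)))
      (≤-trans (sum-mono λ v → pt (n * n <? 100 * weak v)) (≤-reflexive (sym (*-distribˡ-sum 100 weak))))
      where
      pt : ∀ {m k} (d : Dec (m < k)) → ⟦ does d ⟧ * m ≤ k
      pt (yes lt) = ≤-trans (≤-reflexive (*-identityˡ _)) (<⇒≤ lt)
      pt (no _) = z≤n

  e-flip : ∀ {x a b} → e x a b ≡ true → e x b a ≡ true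
  e-flip h = e-swap (e-rot (e-rot h))

  codegree-comm : ∀ a b → codegree a b ≡ codegree b a
  codegree-comm a b = sum-cong-≗ {n} {λ c → ⟦ e a b c ⟧} {λ c → ⟦ e b a c ⟧} λ c → cong ⟦_⟧ (bool-ext e-swap e-swap)

  -- The edges cpr and cqr share the pair cr, so an edge pqz completes an F₅ unless z is c or r.
  light-triangle : ∀ {c p q r} → e c p r ≡ true → e c q r ≡ true → codegree p q ≤ 2
  light-triangle {c} {p} {q} {r} cpr cqr = ≤-trans (sum-mono λ z → pt z (z ≟ᶠ c) (z ≟ᶠ r))
    (≤-reflexive (trans (∑-distrib-+ (λ z → ⟦ does (z ≟ᶠ c) ⟧) (λ z → ⟦ does (z ≟ᶠ r) ⟧)) (cong₂ _+_ (sum-point c) (sum-point r))))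
    where
    pt : ∀ z (i : Dec (z ≡ c)) (j : Dec (z ≡ r)) → ⟦ e p q z ⟧ ≤ ⟦ does i ⟧ + ⟦ does j ⟧
    pt z (yes _) j = ≤-trans (⟦⟧≤1 (e p q z)) (m≤m+n 1 _)
    pt z (no _) (yes _) = ⟦⟧≤1 (e p q z)
    pt z (no z≢c) (no z≢r) = ⟦⟧-false λ h → f₅-free (e-flip cpr) (e-flip cqr) h z≢c z≢r

  -- For x in a fixed K₄ these are the colour classes of the overview, restricted to heavy pairs.
  m : V → V → V → Bool
  m x a b = e x a b ∧ heavy a b

  m⇒e : ∀ {x a b} → m x a b ≡ true → e x a b ≡ true
  m⇒e = ∧-left

  m-flip : ∀ {x a b} → m x a b ≡ true → m x b a ≡ true
  m-flip {x} {a} {b} h = ∧-true (e-flip (∧-left h))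
    (dec-true (3 ≤? codegree b a) (subst (3 ≤_) (codegree-comm a b) (heavy-elim (∧-right {e x a b} h))))

  m⇒g : ∀ {x a b} → m x a b ≡ true → g a b ≡ true
  m⇒g h = g-intro (e-rot (m⇒e h))

  m⇒gˡ : ∀ {x a b} → m x a b ≡ true → g x a ≡ true
  m⇒gˡ h = g-intro (m⇒e h)

  m⇒gʳ : ∀ {x a b} → m x a b ≡ true → g x b ≡ true
  m⇒gʳ h = g-intro (e-flip (m⇒e h))

  -- If c′ = c, the triangle v, a, b lies in one link, which makes the heavy pair va light.
  -- Otherwise cva, cvb and abc′ form an F₅.
  clash : ∀ {c c′ v a b} → m c v a ≡ true → m c v b ≡ true → m c′ a b ≡ true → c′ ≢ v → ⊥
  clash {c} {c′} {v} {a} {b} va vb ab c′≢v = by (c′ ≟ᶠ c)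
    where
    by : Dec (c′ ≡ c) → ⊥
    by (yes refl) = <⇒≱ (heavy-elim (∧-right {e c v a} va)) (light-triangle (m⇒e vb) (m⇒e ab))
    by (no c′≢c) = f₅-free (m⇒e va) (m⇒e vb) (e-rot (m⇒e ab)) c′≢c c′≢v

  member : List V → V → Bool
  member [] a = false
  member (x ∷ xs) a = does (a ≟ᶠ x) ∨ member xs a

  member-lookup : ∀ xs i → member xs (lookup xs i) ≡ true
  member-lookup (x ∷ xs) zero rewrite dec-true (x ≟ᶠ x) refl = refl
  member-lookup (x ∷ xs) (suc i) rewrite member-lookup xs i = ∨-zeroʳ (does (lookup xs i ≟ᶠ x))

  member-size : ∀ xs → sum (⟦_⟧ ∘ member xs) ≤ length xs
  member-size [] = ≤-reflexive (sum-zero n)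
  member-size (x ∷ xs) = ≤-trans (sum-mono λ a → pt (does (a ≟ᶠ x)) (member xs a))
    (≤-trans (≤-reflexive (∑-distrib-+ (λ a → ⟦ does (a ≟ᶠ x) ⟧) (⟦_⟧ ∘ member xs))) (+-mono-≤ (≤-reflexive (sum-point x)) (member-size xs)))
    where
    pt : ∀ p q → ⟦ p ∨ q ⟧ ≤ ⟦ p ⟧ + ⟦ q ⟧
    pt true q = s≤s z≤n
    pt false q = ≤-refl

  union-elim : ∀ {q a b} xs → union q xs a b ≡ true → ∃[ i ] q (lookup xs i) a b ≡ true
  union-elim {q} {a} {b} (x ∷ xs) h = by (bool-cases (q x a b))
    where
    tail : q x a b ≡ false → union q xs a b ≡ true
    tail qf = subst (λ p → p ∨ union q xs a b ≡ true) qf h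
    by : q x a b ≡ true ⊎ q x a b ≡ false → ∃[ i ] q (lookup (x ∷ xs) i) a b ≡ true
    by (inj₁ qt) = zero , qt
    by (inj₂ qf) = let i , h′ = union-elim xs (tail qf) in suc i , h′

  union-map : ∀ {q r : V → V → V → Bool} {a b c d} → (∀ {x} → q x a b ≡ true → r x c d ≡ true) → ∀ xs → union q xs a b ≡ true → union r xs c d ≡ true
  union-map {q} {r} {a} {b} {c} {d} f (x ∷ xs) h = by (bool-cases (q x a b))
    where
    by : q x a b ≡ true ⊎ q x a b ≡ false → r x c d ∨ union r xs c d ≡ true
    by (inj₁ qt) rewrite f qt = refl
    by (inj₂ qf) = trans (cong (r x c d ∨_) (union-map {q} {r} f xs (subst (λ p → p ∨ union q xs a b ≡ true) qf h))) (∨-zeroʳ (r x c d))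

  module GoodK₄ (xs : List V) (len : length xs ≡ 4) (all-good : All (λ v → good v ≡ true) xs) (adj : Adjacent xs) where

    free : V → Bool
    free a = not (member xs a)

    -- Deleting the vertices of the K₄ ensures that no colour is itself a vertex of the coloured
    -- graph, as `clash` demands.
    M : V → V → Bool
    M a b = union m xs a b ∧ (free a ∧ free b)

    M-comm : ∀ a b → M a b ≡ M b a
    M-comm a b = cong₂ _∧_ (bool-ext (union-map m-flip xs) (union-map m-flip xs)) (∧-comm (free a) (free b))

    Colour : Set
    Colour = Fin (length xs)

    colour : ∀ {a b} → M a b ≡ true → ∃[ i ] m (lookup xs i) a b ≡ true
    colour h = union-elim xs (∧-left h)

    freeˡ : ∀ {a b} → M a b ≡ true → free a ≡ true
    freeˡ {a} {b} h = ∧-left (∧-right {union m xs a b} h)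

    freeʳ : ∀ {a b} → M a b ≡ true → free b ≡ true
    freeʳ {a} {b} h = ∧-right {free a} (∧-right {union m xs a b} h)

    avoids : ∀ {v} i → free v ≡ true → lookup xs i ≢ v
    avoids i fv refl = case trans (sym fv) (cong not (member-lookup xs i)) of λ ()

    distinct-colours : ∀ {v a b} {i j k : Colour} → free v ≡ true → m (lookup xs i) v a ≡ true → m (lookup xs j) v b ≡ true → m (lookup xs k) a b ≡ true → i ≢ j
    distinct-colours {k = k} fv va vb ab refl = clash va vb ab (avoids k fv)

    adjacent : ∀ {i j : Colour} → i ≢ j → g (lookup xs i) (lookup xs j) ≡ true
    adjacent {i} {j} i≢j = by (<-cmp (toℕ i) (toℕ j))
      where
      by : Tri (toℕ i < toℕ j) (toℕ i ≡ toℕ j) (toℕ j < toℕ i) → g (lookup xs i) (lookup xs j) ≡ true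
      by (tri< lt _ _) = allPairs-lookup adj i j lt
      by (tri≈ _ eq _) = ⊥-elim (i≢j (toℕ-injective eq))
      by (tri> _ _ gt) = g-sym (allPairs-lookup adj j i gt)

    -- The clique vertex of colour i is joined to all of p, q, r, s through pq and rs, that of
    -- colour j through pr and qs; together the six form a K₆.
    two-matchings : ∀ {p q r s} {i j : Colour} → i ≢ j →
      m (lookup xs i) p q ≡ true → m (lookup xs i) r s ≡ true → m (lookup xs j) p r ≡ true → m (lookup xs j) q s ≡ true →
      g p s ≡ true → g q r ≡ true → ⊥
    two-matchings i≢j pq rs pr qs ps qr = no-K₆ _ refl
      ((adjacent i≢j ∷ m⇒gˡ pq ∷ m⇒gʳ pq ∷ m⇒gˡ rs ∷ m⇒gʳ rs ∷ [])
      ∷ (m⇒gˡ pr ∷ m⇒gˡ qs ∷ m⇒gʳ pr ∷ m⇒gʳ qs ∷ [])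
      ∷ (m⇒g pq ∷ m⇒g pr ∷ ps ∷ []) ∷ (qr ∷ m⇒g qs ∷ []) ∷ (m⇒g rs ∷ []) ∷ [] ∷ [])

    five-colours : ∀ {i i′ j j′ k : Colour} → i ≢ i′ → i ≢ j → i ≢ j′ → i ≢ k → i′ ≢ j → i′ ≢ j′ → i′ ≢ k → j ≢ j′ → j ≢ k → j′ ≢ k → ⊥
    five-colours a b c d e f g h i j = <⇒≱ (≤-reflexive (cong suc len))
      (distinct⇒length≤ ((a ∷ b ∷ c ∷ d ∷ []) ∷ (e ∷ f ∷ g ∷ []) ∷ (h ∷ i ∷ []) ∷ (j ∷ []) ∷ [] ∷ []))

    -- The three perfect matchings of the K₄ use disjoint sets of colours, and there are only four
    -- colours, so two of the matchings are monochromatic.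
    no-M-K₄ : ∀ {p q r s} → M p q ≡ true → M p r ≡ true → M p s ≡ true → M q r ≡ true → M q s ≡ true → M r s ≡ true → ⊥
    no-M-K₄ {p} {q} {r} {s} pq pr ps qr qs rs =
      let i , cpq = colour pq ; i′ , crs = colour rs ; j , cpr = colour pr ; j′ , cqs = colour qs ; k , cps = colour ps ; k′ , cqr = colour qr
      in by i i′ j j′ k k′ cpq crs cpr cqs cps cqr (i ≟ᶠ i′) (j ≟ᶠ j′) (k ≟ᶠ k′)
      where
      fp = freeˡ pq
      fq = freeʳ pq
      fr = freeʳ pr
      fs = freeʳ ps
      by : ∀ (i i′ j j′ k k′ : Colour) → m (lookup xs i) p q ≡ true → m (lookup xs i′) r s ≡ true → m (lookup xs j) p r ≡ true →
        m (lookup xs j′) q s ≡ true → m (lookup xs k) p s ≡ true → m (lookup xs k′) q r ≡ true →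
        Dec (i ≡ i′) → Dec (j ≡ j′) → Dec (k ≡ k′) → ⊥
      by i i′ j j′ k k′ cpq crs cpr cqs cps cqr = cases
        where
        ij : i ≢ j
        ij = distinct-colours fp cpq cpr cqr
        ij′ : i ≢ j′
        ij′ = distinct-colours fq (m-flip cpq) cqs cps
        i′j : i′ ≢ j
        i′j = distinct-colours fr crs (m-flip cpr) (m-flip cps)
        i′j′ : i′ ≢ j′
        i′j′ = distinct-colours fs (m-flip crs) (m-flip cqs) (m-flip cqr)
        ik : i ≢ k
        ik = distinct-colours fp cpq cps cqs
        ik′ : i ≢ k′
        ik′ = distinct-colours fq (m-flip cpq) cqr cpr
        i′k : i′ ≢ k
        i′k = distinct-colours fs (m-flip crs) (m-flip cps) (m-flip cpr)
        i′k′ : i′ ≢ k′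
        i′k′ = distinct-colours fr crs (m-flip cqr) (m-flip cqs)
        jk : j ≢ k
        jk = distinct-colours fp cpr cps crs
        jk′ : j ≢ k′
        jk′ = distinct-colours fr (m-flip cpr) (m-flip cqr) cpq
        j′k : j′ ≢ k
        j′k = distinct-colours fs (m-flip cqs) (m-flip cps) (m-flip cpq)
        j′k′ : j′ ≢ k′
        j′k′ = distinct-colours fq cqs cqr (m-flip crs)
        cases : Dec (i ≡ i′) → Dec (j ≡ j′) → Dec (k ≡ k′) → ⊥
        cases (yes refl) (yes refl) _ = two-matchings ij cpq crs cpr cqs (m⇒g cps) (m⇒g cqr)
        cases (yes refl) (no _) (yes refl) = two-matchings ik cpq (m-flip crs) cps cqr (m⇒g cpr) (m⇒g cqs)
        cases (no _) (yes refl) (yes refl) = two-matchings jk cpr (m-flip cqs) cps (m-flip cqr) (m⇒g cpq) (m⇒g crs)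
        cases (no ii′) (no jj′) _ = five-colours ii′ ij ij′ ik i′j i′j′ i′k jj′ jk j′k
        cases (no ii′) (yes _) (no kk′) = five-colours ii′ ik ik′ ij i′k i′k′ i′j kk′ (≢-sym jk) (≢-sym jk′)
        cases (yes _) (no jj′) (no kk′) = five-colours jj′ jk jk′ (≢-sym ij) j′k j′k′ (≢-sym ij′) kk′ (≢-sym ik) (≢-sym ik′)

    module ML = Cliques M M-comm

    M-size : 3 * ∑∑ (λ a b → ⟦ M a b ⟧) ≤ 2 * (n * n)
    M-size = subst (λ k → 3 * ∑∑ (λ a b → ⟦ M a b ⟧) ≤ 2 * (k * k)) #-all
      (ML.turán 2 all λ C → let ys , len′ , _ , pairs′ = ML.clique-list 4 all C in four ys len′ pairs′)
      where
      four : ∀ ys → length ys ≡ 4 → AllPairs (λ a b → M a b ≡ true) ys → ⊥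
      four (p ∷ q ∷ r ∷ s ∷ []) refl ((pq ∷ pr ∷ ps ∷ []) ∷ (qr ∷ qs ∷ []) ∷ (rs ∷ []) ∷ [] ∷ []) = no-M-K₄ pq pr ps qr qs rs

    union-size : ∑∑ (λ a b → ⟦ union m xs a b ⟧) ≤ ∑∑ (λ a b → ⟦ M a b ⟧) + 4 * (2 * n)
    union-size = begin
      ∑∑ (λ a b → ⟦ union m xs a b ⟧) ≤⟨ ∑∑-mono (λ a b → pt (union m xs a b) (member xs a) (member xs b)) ⟩
      ∑∑ (λ a b → ⟦ M a b ⟧ + (f a b + f b a)) ≡⟨ ∑∑-+ (λ a b → ⟦ M a b ⟧) (λ a b → f a b + f b a) ⟩
      ∑∑ (λ a b → ⟦ M a b ⟧) + ∑∑ (λ a b → f a b + f b a) ≡⟨ cong (∑∑ (λ a b → ⟦ M a b ⟧) +_) (∑∑-symmetrise f) ⟩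
      ∑∑ (λ a b → ⟦ M a b ⟧) + 2 * ∑∑ f ≤⟨ +-monoʳ-≤ (∑∑ (λ a b → ⟦ M a b ⟧)) (*-monoʳ-≤ 2 f≤) ⟩
      ∑∑ (λ a b → ⟦ M a b ⟧) + 2 * (n * 4) ≡⟨ cong (∑∑ (λ a b → ⟦ M a b ⟧) +_) (arr n) ⟩
      ∑∑ (λ a b → ⟦ M a b ⟧) + 4 * (2 * n) ∎
      where
      open ≤-Reasoning
      f : V → V → ℕ
      f a _ = ⟦ member xs a ⟧
      arr : ∀ n → 2 * (n * 4) ≡ 4 * (2 * n)
      arr = solve-∀
      f≤ : ∑∑ f ≤ n * 4
      f≤ = ≤-trans (≤-reflexive (trans (sum-cong-≗ λ a → sum-const n ⟦ member xs a ⟧) (sym (*-distribˡ-sum n (⟦_⟧ ∘ member xs)))))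
        (*-monoʳ-≤ n (≤-trans (member-size xs) (≤-reflexive len)))
      pt : ∀ u p q → ⟦ u ⟧ ≤ ⟦ u ∧ (not p ∧ not q) ⟧ + (⟦ p ⟧ + ⟦ q ⟧)
      pt false p q = z≤n
      pt true true q = s≤s z≤n
      pt true false true = s≤s z≤n
      pt true false false = s≤s z≤n

    weak-sum : ∀ ys → total e ys ≤ total m ys + sumˡ (map weak ys)
    weak-sum [] = z≤n
    weak-sum (y ∷ ys) = ≤-trans (+-mono-≤ split (weak-sum ys)) (≤-reflexive (arr (∑∑ λ a b → ⟦ m y a b ⟧) (weak y) (total m ys) (sumˡ (map weak ys))))
      where
      arr : ∀ a b c d → a + b + (c + d) ≡ a + c + (b + d)
      arr = solve-∀
      pt : ∀ p q → ⟦ p ⟧ ≤ ⟦ p ∧ q ⟧ + ⟦ p ∧ not q ⟧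
      pt false q = z≤n
      pt true true = s≤s z≤n
      pt true false = s≤s z≤n
      split : ∑∑ (λ a b → ⟦ e y a b ⟧) ≤ ∑∑ (λ a b → ⟦ m y a b ⟧) + weak y
      split = ≤-trans (∑∑-mono λ a b → pt (e y a b) (heavy a b)) (≤-reflexive (∑∑-+ (λ a b → ⟦ m y a b ⟧) (λ a b → ⟦ e y a b ∧ light a b ⟧)))

    good-sum : ∀ {ys} → All (λ v → good v ≡ true) ys → 100 * sumˡ (map weak ys) ≤ length ys * (n * n)
    good-sum [] = z≤n
    good-sum {y ∷ ys} (gy ∷ gys) = ≤-trans (≤-reflexive (*-distribˡ-+ 100 (weak y) (sumˡ (map weak ys)))) (+-mono-≤ (good-bound gy) (good-sum gys))

    impossible : ⊥
    impossible = good-arith (n * n) n (total e xs) (sumˡ (map weak xs)) (total m xs) (∑∑ λ a b → ⟦ union m xs a b ⟧) (∑∑ λ a b → ⟦ M a b ⟧) big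
      (subst (λ k → k * suc (8 * (n * n)) ≤ 45 * total e xs) len (degree-total xs))
      (weak-sum xs)
      (subst (λ k → 100 * sumˡ (map weak xs) ≤ k * (n * n)) len (good-sum all-good))
      (subst (λ k → total m xs ≤ ∑∑ (λ a b → ⟦ union m xs a b ⟧) + pairs k * (2 * n)) len (union-bound m m⇒e xs adj))
      union-size M-size

  good-size : 3 * ∑∑ (λ a b → ⟦ inside good a b ⟧) ≤ 2 * (n * n)
  good-size = ≤-trans (turán 2 good λ C → let xs , len , all-good , adj = clique-list 4 good C in GoodK₄.impossible xs len all-good adj)
    (*-monoʳ-≤ 2 (*-mono-≤ good≤n good≤n))
    where
    good≤n : # good ≤ n
    good≤n = ≤-trans (sum-mono λ v → ⟦⟧≤1 (good v)) (≤-reflexive (trans (sum-const n 1) (*-identityʳ n)))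

  -- The union of four links lies in the shadow, where at most 160n ordered pairs meet a bad vertex
  -- and, by `good-size`, at most 2n²/3 avoid them all.
  k₄-free : ∀ {a b c d} → g a b ≡ true → g a c ≡ true → g a d ≡ true → g b c ≡ true → g b d ≡ true → g c d ≡ true → ⊥
  k₄-free {a} {b} {c} {d} ab ac ad bc bd cd = k₄-arith (n * n) n (total e xs) (∑∑ λ a b → ⟦ union e xs a b ⟧) (∑∑ λ a b → ⟦ inside good a b ⟧) big
    (degree-total xs) (union-bound e id xs adj) U≤ good-size
    where
    xs : List V
    xs = a ∷ b ∷ c ∷ d ∷ []
    adj : Adjacent xs
    adj = (ab ∷ ac ∷ ad ∷ []) ∷ (bc ∷ bd ∷ []) ∷ (cd ∷ []) ∷ [] ∷ []
    f : V → V → ℕ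
    f a _ = ⟦ bad a ⟧
    U≤ : ∑∑ (λ a b → ⟦ union e xs a b ⟧) ≤ ∑∑ (λ a b → ⟦ inside good a b ⟧) + 2 * (80 * n)
    U≤ = begin
      ∑∑ (λ a b → ⟦ union e xs a b ⟧) ≤⟨ ∑∑-mono (λ a b → ≤-trans (⟦⟧-mono λ h → let _ , h′ = union-elim {e} xs h in g-intro (e-rot h′)) (pt (g a b) (bad a) (bad b))) ⟩
      ∑∑ (λ a b → ⟦ inside good a b ⟧ + (f a b + f b a)) ≡⟨ ∑∑-+ (λ a b → ⟦ inside good a b ⟧) (λ a b → f a b + f b a) ⟩
      ∑∑ (λ a b → ⟦ inside good a b ⟧) + ∑∑ (λ a b → f a b + f b a) ≡⟨ cong (∑∑ (λ a b → ⟦ inside good a b ⟧) +_) (∑∑-symmetrise f) ⟩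
      ∑∑ (λ a b → ⟦ inside good a b ⟧) + 2 * ∑∑ f ≤⟨ +-monoʳ-≤ (∑∑ (λ a b → ⟦ inside good a b ⟧)) (*-monoʳ-≤ 2 f≤) ⟩
      ∑∑ (λ a b → ⟦ inside good a b ⟧) + 2 * (80 * n) ∎
      where
      open ≤-Reasoning
      pt : ∀ u p q → ⟦ u ⟧ ≤ ⟦ not p ∧ (not q ∧ u) ⟧ + (⟦ p ⟧ + ⟦ q ⟧)
      pt u true q = ≤-trans (⟦⟧≤1 u) (s≤s z≤n)
      pt u false true = ⟦⟧≤1 u
      pt u false false = m≤m+n _ _
      f≤ : ∑∑ f ≤ 80 * n
      f≤ = ≤-trans (≤-reflexive (trans (sum-cong-≗ λ a → sum-const n ⟦ bad a ⟧) (trans (sym (*-distribˡ-sum n (⟦_⟧ ∘ bad))) (*-comm n (# bad)))))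
        (*-monoˡ-≤ n few-bad)

-- Degrees of the 3-graph and ordered pairs in its links.

length-filter-concatMap : ∀ {A B : Set} {P : B → Set} (P? : ∀ b → Dec (P b)) {n} (h : Fin n → A) (f : A → List B) →
  length (filter P? (concatMap f (tabulate h))) ≡ sum λ i → length (filter P? (f (h i)))
length-filter-concatMap P? {zero} h f = refl
length-filter-concatMap P? {suc n} h f =
  trans (cong length (filter-++ P? (f (h zero)) (concatMap f (tabulate (h ∘ suc)))))
    (trans (length-++ (filter P? (f (h zero)))) (cong (length (filter P? (f (h zero))) +_) (length-filter-concatMap P? (h ∘ suc) f)))

count≤ : ∀ {B : Set} {P : B → Set} (P? : ∀ b → Dec (P b)) {n} (f : Fin n → List B) (k : Fin n → ℕ) →
  (∀ i → length (filter P? (f i)) ≤ k i) → length (filter P? (concatMap f (allFin n))) ≤ sum k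
count≤ P? f k le = ≤-trans (≤-reflexive (length-filter-concatMap P? id f)) (sum-mono le)

sum-at : ∀ {n} (v : Fin n) x → sum (λ i → ⟦ does (i ≟ᶠ v) ⟧ * x) ≡ x
sum-at v x = trans (sym (*-distribʳ-sum x λ i → ⟦ does (i ≟ᶠ v) ⟧)) (trans (cong (_* x) (sum-point v)) (*-identityˡ x))

⌊⌋-yes : ∀ {A : Set} (d : Dec A) → A → ⌊ d ⌋ ≡ true
⌊⌋-yes (yes _) _ = refl
⌊⌋-yes (no ¬a) a = ⊥-elim (¬a a)

⌊⌋-no : ∀ {A : Set} (d : Dec A) → ¬ A → ⌊ d ⌋ ≡ false
⌊⌋-no (yes a) ¬a = ⊥-elim (¬a a)
⌊⌋-no (no _) _ = refl

module _ {n : ℕ} (H : ThreeGraph n) where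

  Triple : Set
  Triple = Fin n × Fin n × Fin n

  -- The predicate and the list entries used in Defs are local there; they are recovered here by unification.
  test : ∀ {v} {P : Triple → Set} {P? : ∀ t → Dec (P t)} → degree H v ≡ length (filter P? (sortedTriples n)) → ∀ t → Dec (P t)
  test {P? = P?} _ = P?

  entry : ∀ {f : Fin n → Fin n → Fin n → List Triple} →
    sortedTriples n ≡ concatMap (λ a → concatMap (λ b → concatMap (λ c → f a b c) (allFin n)) (allFin n)) (allFin n) →
    Fin n → Fin n → Fin n → List Triple
  entry {f} _ = f

  Edge-swap : ∀ {x y z} → Edge H x y z → Edge H y x z
  Edge-swap (xy , xz , yz , a , b , c , s , t , mx , my , mz) = ≢-sym xy , yz , xz , a , b , c , s , t , my , mx , mz

  Edge-rot : ∀ {x y z} → Edge H x y z → Edge H y z x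
  Edge-rot (xy , xz , yz , a , b , c , s , t , mx , my , mz) = yz , ≢-sym xy , ≢-sym xz , a , b , c , s , t , my , mz , mx

  edge? : ∀ x y z → Dec (Edge H x y z)
  edge? x y z = ¬? (x ≟ᶠ y) ×-dec (¬? (x ≟ᶠ z) ×-dec (¬? (y ≟ᶠ z) ×-dec
    any? λ a → any? λ b → any? λ c → ((toℕ a <? toℕ b) ×-dec (toℕ b <? toℕ c)) ×-dec ((edgeAt H a b c ≟ᵇ true) ×-dec
      (one-of x a b c ×-dec (one-of y a b c ×-dec one-of z a b c)))))
    where
    one-of : ∀ x a b c → Dec (x ≡ a ⊎ x ≡ b ⊎ x ≡ c)
    one-of x a b c = (x ≟ᶠ a) ⊎-dec ((x ≟ᶠ b) ⊎-dec (x ≟ᶠ c))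

  abstract
    edge : Fin n → Fin n → Fin n → Bool
    edge x y z = does (edge? x y z)

    edge-elim : ∀ {x y z} → edge x y z ≡ true → Edge H x y z
    edge-elim {x} {y} {z} = does-true (edge? x y z)

    edge-intro : ∀ {x y z} → Edge H x y z → edge x y z ≡ true
    edge-intro {x} {y} {z} = dec-true (edge? x y z)

  edge-swap : ∀ {x y z} → edge x y z ≡ true → edge y x z ≡ true
  edge-swap h = edge-intro (Edge-swap (edge-elim h))

  edge-rot : ∀ {x y z} → edge x y z ≡ true → edge y z x ≡ true
  edge-rot h = edge-intro (Edge-rot (edge-elim h))

  edge-f₅-free : F5Free H → ∀ {a b c d z} → edge a b c ≡ true → edge a b d ≡ true → edge c d z ≡ true → z ≢ a → z ≢ b → ⊥
  edge-f₅-free free {a} {b} {c} {d} {z} abc abd cdz z≢a z≢b = f (edge-elim abc) (edge-elim abd) (edge-elim cdz)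
    where
    f : Edge H a b c → Edge H a b d → Edge H c d z → ⊥
    f p@(ab , ac , bc , _) q@(_ , ad , bd , _) r@(cd , cz , dz , _) =
      free (a , b , c , d , z , ab , ac , ad , ≢-sym z≢a , bc , bd , ≢-sym z≢b , cd , cz , dz , p , q , r)

  module _ (v : Fin n) where

    abstract
      lt : Fin n → Fin n → Bool
      lt p q = does (toℕ p <? toℕ q)

      lt-elim : ∀ {p q} → lt p q ≡ true → toℕ p < toℕ q
      lt-elim {p} {q} = does-true (toℕ p <? toℕ q)

      lt-intro : ∀ {p q} → toℕ p < toℕ q → lt p q ≡ true
      lt-intro {p} {q} = dec-true (toℕ p <? toℕ q)

    -- A sorted edge through v has v in first, second or third place. In each case the other two
    -- vertices are an increasing pair of the link of v, and that pair determines the place of v.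
    low mid top : Fin n → Fin n → Bool
    low p q = edge v p q ∧ (lt v p ∧ lt p q)
    mid p q = edge v p q ∧ (lt p v ∧ lt v q)
    top p q = edge v p q ∧ (lt p q ∧ lt q v)

    at : Fin n → ℕ
    at a = ⟦ does (a ≟ᶠ v) ⟧

    placed : Fin n → Fin n → Fin n → ℕ
    placed a b c = at a * ⟦ low b c ⟧ + (at b * ⟦ mid a c ⟧ + at c * ⟦ top a b ⟧)

    placed-sum : (sum λ a → sum λ b → sum λ c → placed a b c) ≡ ∑∑ (λ p q → ⟦ low p q ⟧) + (∑∑ (λ p q → ⟦ mid p q ⟧) + ∑∑ (λ p q → ⟦ top p q ⟧))
    placed-sum = trans (split₃ (λ a b c → at a * ⟦ low b c ⟧) (λ a b c → at b * ⟦ mid a c ⟧ + at c * ⟦ top a b ⟧))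
      (cong₂ _+_ low-sum (trans (split₃ (λ a b c → at b * ⟦ mid a c ⟧) (λ a b c → at c * ⟦ top a b ⟧)) (cong₂ _+_ mid-sum top-sum)))
      where
      ∑∑∑ : (Fin n → Fin n → Fin n → ℕ) → ℕ
      ∑∑∑ f = sum λ a → ∑∑ (f a)
      split₃ : ∀ f h → ∑∑∑ (λ a b c → f a b c + h a b c) ≡ ∑∑∑ f + ∑∑∑ h
      split₃ f h = trans (sum-cong-≗ λ a → ∑∑-+ (f a) (h a)) (∑-distrib-+ (∑∑ ∘ f) (∑∑ ∘ h))
      low-sum : ∑∑∑ (λ a b c → at a * ⟦ low b c ⟧) ≡ ∑∑ λ p q → ⟦ low p q ⟧
      low-sum = trans (sum-cong-≗ λ a → ∑∑-* (at a) λ b c → ⟦ low b c ⟧) (sum-at v (∑∑ λ p q → ⟦ low p q ⟧))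
      mid-sum : ∑∑∑ (λ a b c → at b * ⟦ mid a c ⟧) ≡ ∑∑ λ p q → ⟦ mid p q ⟧
      mid-sum = sum-cong-≗ λ a → trans (sum-cong-≗ λ b → sym (*-distribˡ-sum (at b) λ c → ⟦ mid a c ⟧)) (sum-at v (sum λ c → ⟦ mid a c ⟧))
      top-sum : ∑∑∑ (λ a b c → at c * ⟦ top a b ⟧) ≡ ∑∑ λ p q → ⟦ top p q ⟧
      top-sum = ∑∑-cong λ a b → sum-at v ⟦ top a b ⟧

    increasing : Fin n → Fin n → ℕ
    increasing p q = ⟦ edge v p q ∧ lt p q ⟧

    positions : ∑∑ (λ p q → ⟦ low p q ⟧) + (∑∑ (λ p q → ⟦ mid p q ⟧) + ∑∑ (λ p q → ⟦ top p q ⟧)) ≤ ∑∑ increasing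
    positions = ≤-trans (≤-reflexive (trans (cong (∑∑ (λ p q → ⟦ low p q ⟧) +_) (sym (∑∑-+ (λ p q → ⟦ mid p q ⟧) (λ p q → ⟦ top p q ⟧))))
        (sym (∑∑-+ (λ p q → ⟦ low p q ⟧) (λ p q → ⟦ mid p q ⟧ + ⟦ top p q ⟧)))))
      (∑∑-mono λ p q → pt (edge v p q) (λ l r → <-asym (lt-elim (∧-left l)) (lt-elim (∧-left r)))
        (λ l r → <-asym (<-trans (lt-elim (∧-left l)) (lt-elim (∧-right {lt v p} l))) (lt-elim (∧-right {lt p q} r)))
        (λ l r → <-asym (lt-elim (∧-right {lt p v} l)) (lt-elim (∧-right {lt p q} r)))
        (∧-right {lt v p}) (λ l → lt-intro (<-trans (lt-elim (∧-left l)) (lt-elim (∧-right {lt p v} l)))) ∧-left)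
      where
      pt : ∀ i {x y z w} → (x ≡ true → y ≡ true → ⊥) → (x ≡ true → z ≡ true → ⊥) → (y ≡ true → z ≡ true → ⊥) →
        (x ≡ true → w ≡ true) → (y ≡ true → w ≡ true) → (z ≡ true → w ≡ true) →
        ⟦ i ∧ x ⟧ + (⟦ i ∧ y ⟧ + ⟦ i ∧ z ⟧) ≤ ⟦ i ∧ w ⟧
      pt false _ _ _ _ _ _ = z≤n
      pt true {w = true} xy xz yz _ _ _ = ⟦⟧-excl₃ xy xz yz
      pt true {w = false} _ _ _ xw yw zw = +-mono-≤ (⟦⟧-mono xw) (+-mono-≤ (⟦⟧-mono yw) (⟦⟧-mono zw))

    degree≤ : degree H v ≤ sum λ a → sum λ b → sum λ c → placed a b c
    degree≤ = count≤ _ _ _ λ a → count≤ _ _ _ λ b → count≤ _ _ _ λ c → triple a b c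
      where
      first : ∀ {a b c} → v ≡ a → edge v b c ≡ true → toℕ a < toℕ b → toℕ b < toℕ c → 1 ≤ placed a b c
      first {a} {b} {c} refl h a<b b<c = ≤-trans (*-mono-≤ (⟦⟧-true (dec-true (a ≟ᶠ a) refl)) (⟦⟧-true (∧-true h (∧-true (lt-intro a<b) (lt-intro b<c))))) (m≤m+n _ _)
      second : ∀ {a b c} → v ≡ b → edge v a c ≡ true → toℕ a < toℕ b → toℕ b < toℕ c → 1 ≤ placed a b c
      second {a} {b} {c} refl h a<b b<c = ≤-trans (*-mono-≤ (⟦⟧-true (dec-true (b ≟ᶠ b) refl)) (⟦⟧-true (∧-true h (∧-true (lt-intro a<b) (lt-intro b<c)))))
        (≤-trans (m≤m+n _ (at c * ⟦ top a b ⟧)) (m≤n+m _ (at a * ⟦ low b c ⟧)))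
      third : ∀ {a b c} → v ≡ c → edge v a b ≡ true → toℕ a < toℕ b → toℕ b < toℕ c → 1 ≤ placed a b c
      third {a} {b} {c} refl h a<b b<c = ≤-trans (*-mono-≤ (⟦⟧-true (dec-true (c ≟ᶠ c) refl)) (⟦⟧-true (∧-true h (∧-true (lt-intro a<b) (lt-intro b<c)))))
        (≤-trans (m≤n+m _ (at b * ⟦ mid a c ⟧)) (m≤n+m _ (at a * ⟦ low b c ⟧)))
      apart : ∀ {p q : Fin n} → toℕ p < toℕ q → p ≢ q
      apart lt refl = <-irrefl refl lt
      counted : ∀ {a b c} → toℕ a < toℕ b → toℕ b < toℕ c → edgeAt H a b c ≡ true → v ≡ a ⊎ v ≡ b ⊎ v ≡ c → 1 ≤ placed a b c
      counted {a} {b} {c} a<b b<c t = go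
        where
        abc : Edge H a b c
        abc = apart a<b , apart (<-trans a<b b<c) , apart b<c , a , b , c , (a<b , b<c) , t , inj₁ refl , inj₂ (inj₁ refl) , inj₂ (inj₂ refl)
        go : v ≡ a ⊎ v ≡ b ⊎ v ≡ c → 1 ≤ placed a b c
        go (inj₁ e) = first e (subst (λ v → edge v b c ≡ true) (sym e) (edge-intro abc)) a<b b<c
        go (inj₂ (inj₁ e)) = second e (subst (λ v → edge v a c ≡ true) (sym e) (edge-intro (Edge-swap abc))) a<b b<c
        go (inj₂ (inj₂ e)) = third e (subst (λ v → edge v a b ≡ true) (sym e) (edge-intro (Edge-rot (Edge-rot abc)))) a<b b<c
      which : ∀ {a b c} → ⌊ v ≟ᶠ a ⌋ ∨ ⌊ v ≟ᶠ b ⌋ ∨ ⌊ v ≟ᶠ c ⌋ ≡ true → v ≡ a ⊎ v ≡ b ⊎ v ≡ c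
      which {a} {b} {c} h with v ≟ᶠ a | v ≟ᶠ b | v ≟ᶠ c
      ... | yes e | _ | _ = inj₁ e
      ... | no _ | yes e | _ = inj₂ (inj₁ e)
      ... | no _ | no _ | yes e = inj₂ (inj₂ e)
      triple : ∀ a b c → length (filter (test {v} refl) (entry refl a b c)) ≤ placed a b c
      triple a b c = go (toℕ a <? toℕ b) (toℕ b <? toℕ c) (bool-cases (edgeAt H a b c ∧ (⌊ v ≟ᶠ a ⌋ ∨ ⌊ v ≟ᶠ b ⌋ ∨ ⌊ v ≟ᶠ c ⌋)))
        where
        go : Dec (toℕ a < toℕ b) → Dec (toℕ b < toℕ c) → edgeAt H a b c ∧ (⌊ v ≟ᶠ a ⌋ ∨ ⌊ v ≟ᶠ b ⌋ ∨ ⌊ v ≟ᶠ c ⌋) ≡ true ⊎ edgeAt H a b c ∧ (⌊ v ≟ᶠ a ⌋ ∨ ⌊ v ≟ᶠ b ⌋ ∨ ⌊ v ≟ᶠ c ⌋) ≡ false →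
          length (filter (test {v} refl) (entry refl a b c)) ≤ placed a b c
        go (no ¬p) _ _ rewrite ⌊⌋-no (toℕ a <? toℕ b) ¬p = z≤n
        go (yes p) (no ¬q) _ rewrite ⌊⌋-yes (toℕ a <? toℕ b) p | ⌊⌋-no (toℕ b <? toℕ c) ¬q = z≤n
        go (yes p) (yes q) (inj₂ f) rewrite ⌊⌋-yes (toℕ a <? toℕ b) p | ⌊⌋-yes (toℕ b <? toℕ c) q | f = z≤n
        go (yes p) (yes q) (inj₁ t) = ≤-trans one (counted p q (∧-left t) (which (∧-right {edgeAt H a b c} t)))
          where
          one : length (filter (test {v} refl) (entry refl a b c)) ≤ 1
          one rewrite ⌊⌋-yes (toℕ a <? toℕ b) p | ⌊⌋-yes (toℕ b <? toℕ c) q | t = ≤-refl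

    edge-flip : ∀ p q → edge v p q ≡ edge v q p
    edge-flip p q = bool-ext (λ h → edge-swap (edge-rot (edge-rot h))) (λ h → edge-swap (edge-rot (edge-rot h)))

    twice-degree : 2 * degree H v ≤ ∑∑ λ p q → ⟦ edge v p q ⟧
    twice-degree = ≤-trans (*-monoʳ-≤ 2 (≤-trans degree≤ (≤-trans (≤-reflexive placed-sum) positions)))
      (≤-trans (≤-reflexive (sym (∑∑-symmetrise increasing))) (∑∑-mono λ p q → pt (edge v p q) (edge v q p) (edge-flip p q)
        λ l r → <-asym (lt-elim l) (lt-elim r)))
      where
      pt : ∀ i j {x y} → i ≡ j → (x ≡ true → y ≡ true → ⊥) → ⟦ i ∧ x ⟧ + ⟦ j ∧ y ⟧ ≤ ⟦ i ⟧
      pt false .false refl _ = z≤n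
      pt true .true refl xy = ⟦⟧-excl₂ xy

theorem1p1 : (n : ℕ) → 5000 ≤ n → (H : ThreeGraph n) → F5Free H →
    (∀ (v : Fin n) → 4 * (n * n) < 45 * degree H v) → ThreePartite H
theorem1p1 n 5000≤n H free dense = c , λ x y z xyz →
    c-proper (L.g-intro (edge-intro H xyz)) , c-proper (L.g-intro (edge-intro H (Edge-swap H (Edge-rot H (Edge-rot H xyz))))) ,
    c-proper (L.g-intro (edge-intro H (Edge-rot H xyz)))
  where
  ordered : ∀ v → Exceeds (n * n) (∑∑ λ a b → ⟦ edge H v a b ⟧)
  ordered v = exceeds (double (n * n) (degree H v) _ (dense v) (twice-degree H v))
    where
    double : ∀ m d t → 4 * m < 45 * d → 2 * d ≤ t → 8 * m < 45 * t
    double m d t lt le = <-≤-trans (subst₂ _<_ (l m) (r d) (*-monoʳ-< 2 lt)) (*-monoʳ-≤ 45 le)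
      where
      l : ∀ m → 2 * (4 * m) ≡ 8 * m
      l = solve-∀
      r : ∀ d → 2 * (45 * d) ≡ 45 * (2 * d)
      r = solve-∀
  module L = Links (edge H) (edge-swap H) (edge-rot H) (edge-f₅-free H free) ordered 5000≤n
  -- An edge vab puts the shadow edge ab into the shadow neighbourhood of v, so the density of the
  -- links passes to the neighbourhoods.
  triangles : ∀ v → Exceeds (n * n) (∑∑ λ a b → ⟦ tri L.g v a b ⟧)
  triangles v = exceeds (<-≤-trans (Exceeds.bound (ordered v)) (*-monoʳ-≤ 45 (∑∑-mono λ a b → ⟦⟧-mono {edge H v a b} {tri L.g v a b} λ h →
    ∧-true (L.g-intro (edge-rot H h)) (∧-true (L.g-sym (L.g-intro h)) (L.g-intro (edge-rot H (edge-rot H h)))))))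
  vertex : ∀ {n} → 5000 ≤ n → Fin n
  vertex {suc _} _ = zero
  colouring : DenseK₄Free.Colouring L.g L.g-comm L.k₄-free triangles
  colouring = DenseK₄Free.three-colouring L.g L.g-comm L.k₄-free triangles (vertex 5000≤n)
  c : Fin n → Fin 3
  c = proj₁ colouring
  c-proper : ∀ {a b} → L.g a b ≡ true → c a ≢ c b
  c-proper = proj₂ colouring
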